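{- Let $G$ be an ordered group and let $s$ be a positive integer. If $S$ is a finite subset of $G$ with $|S|\ge 2^{s+2}$ and $|S^2|=3|S|-2+s$, then $\langle S\rangle$ is metabelian. Moreover, if $G$ is nilpotent, then $\langle S\rangle$ is nilpotent of class at most $2$.
   Context: An ordered group is a group $G$ with a total order $\le$ such that $a\le b$ implies $xay\le xby$ for all $a,b,x,y\in G$. For a subset $S$, $S^2=\{x_1x_2 : x_1,x_2\in S\}$, and $\langle S\rangle$ is the subgroup generated by $S$. A group is metabelian if its derived subgroup is abelian. -}

module Defs where

open import Level using (Level; _⊔_)
open import Data.Nat using (ℕ; zero; suc)
open import Data.Product using (Σ; ∃; _×_; _,_)
open import Data.List using (List; length)
open import Relation.Binary.PropositionalEquality using (_≡_)
open import Data.Unit.Polymorphic using (⊤)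
open import Algebra.Bundles using (Group)
open import Relation.Binary.Structures using (IsTotalOrder)
open import Relation.Binary.Core using (Rel)
import Data.List.Membership.Setoid as SetoidMembership
import Data.List.Relation.Unary.Unique.Setoid as SetoidUnique

record OrderedGroup (c ℓ ℓ₂ : Level) : Set (Level.suc (c ⊔ ℓ ⊔ ℓ₂)) where
  field
    group : Group c ℓ
  open Group group public
  field
    _≤_          : Rel Carrier ℓ₂
    isTotalOrder : IsTotalOrder _≈_ _≤_
    compatible   : ∀ {a b} x y → a ≤ b → ((x ∙ a) ∙ y) ≤ ((x ∙ b) ∙ y)

module GroupNotions {c ℓ : Level} (G : Group c ℓ) where
  open Group G
  open SetoidMembership setoid using (_∈_)
  open SetoidUnique setoid using (Unique)

  Pred : Set (Level.suc (c ⊔ ℓ))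
  Pred = Carrier → Set (c ⊔ ℓ)

  Whole : Pred
  Whole _ = ⊤

  data ⟨_⟩ (P : Pred) : Carrier → Set (c ⊔ ℓ) where
    gen  : ∀ {x} → P x → ⟨ P ⟩ x
    unit : ⟨ P ⟩ ε
    mul  : ∀ {x y} → ⟨ P ⟩ x → ⟨ P ⟩ y → ⟨ P ⟩ (x ∙ y)
    inv  : ∀ {x} → ⟨ P ⟩ x → ⟨ P ⟩ (x ⁻¹)
    resp : ∀ {x y} → x ≈ y → ⟨ P ⟩ x → ⟨ P ⟩ y

  [_,_] : Carrier → Carrier → Carrier
  [ x , y ] = ((x ⁻¹ ∙ y ⁻¹) ∙ x) ∙ y

  -- Lower central series of a subgroup H:
  -- γ H 0 = H  (γ₁ in the usual indexing),
  -- γ H (i+1) = ⟨ [x , y] : x ∈ γ H i, y ∈ H ⟩.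
  -- In particular γ H 1 is the derived subgroup H'.
  γ : Pred → ℕ → Pred
  γ H zero    = H
  γ H (suc i) = ⟨ (λ g → Σ Carrier λ x → Σ Carrier λ y →
                    γ H i x × H y × g ≈ [ x , y ]) ⟩

  Abelian : Pred → Set (c ⊔ ℓ)
  Abelian H = ∀ {a b} → H a → H b → (a ∙ b) ≈ (b ∙ a)

  Metabelian : Pred → Set (c ⊔ ℓ)
  Metabelian H = Abelian (γ H 1)

  -- H is nilpotent of class at most k: γ_{k+1}(H) is trivial.
  NilpotentOfClassAtMost : ℕ → Pred → Set (c ⊔ ℓ)
  NilpotentOfClassAtMost k H = ∀ {g} → γ H k g → g ≈ ε

  Nilpotent : Pred → Set (c ⊔ ℓ)
  Nilpotent H = ∃ λ k → NilpotentOfClassAtMost k H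

  Mem : List Carrier → Pred
  Mem S x = x ∈ S

  Square : List Carrier → Pred
  Square S z = Σ Carrier λ x → Σ Carrier λ y → x ∈ S × y ∈ S × z ≈ (x ∙ y)

  HasCard : Pred → ℕ → Set (c ⊔ ℓ)
  HasCard P n = Σ (List Carrier) λ T →
    Unique T × (∀ z → (z ∈ T → P z) × (P z → z ∈ T)) × length T ≡ n

module OrderedGroupNotions {c ℓ ℓ₂ : Level} (G : OrderedGroup c ℓ ℓ₂) where
  open OrderedGroup G using (group; setoid) public
  open Group group using (Carrier) public
  open GroupNotions group public
  open SetoidUnique setoid using (Unique) public

-- Write S = {x₀ < … < x_{k−1}} and S_j = {x₀, …, x_{j−1}}.  Deleting the largest element X of S_{j+1}
-- deletes at least X², XY and YX from its square, where Y is the second largest element.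
--
-- If four products are deleted, then S_j satisfies the hypothesis with s − 1.  Either X ∈ ⟨S_j⟩, or
-- XS_j ∪ S_jX is disjoint from S_j²; in the second case a count shows that S_j lies in an arithmetic
-- progression, and that the elements which X conjugates into S_j generate ⟨S_j⟩.
--
-- If at most three products are deleted, then with few exceptions xᵢX and Xxᵢ lie in S_j², and the
-- larger of the two must be a product of elements above xᵢ.  Hence the few largest elements generate
-- ⟨S⟩.  When this happens twice in a row, comparing the products of the four largest elements gives
-- relations between them.
--
-- In every case S commutes or ⟨S⟩ ≤ ⟨a, b, t⟩ with ab = ba and ⟨a, b⟩ᵗ ≤ ⟨a, b⟩.  The union of the
-- conjugates of ⟨a, b⟩ is then an abelian normal subgroup with cyclic quotient.  In a nilpotent group,
-- g ↦ [g, t] is a nilpotent endomorphism of ⟨a, b⟩, which has rank at most 2 and no torsion, so its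
-- square is zero by the Cayley–Hamilton theorem.
--
-- Equality in G is not decidable, but equality of products of two elements of S is.

module Submission where

-- Write |S²| = 3|S| - 3 + r, so that r = s + 1 and r = 0 is the commutative case. Deleting an
-- element together with four products lowers r by one, but with three products r stays and the
-- induction gains nothing; this is why two consecutive deletions are examined. If three products go
-- and then four, the induction resumes two elements lower with r - 1. The size condition 2r + 4 ≤
-- |S| survives exactly this step and also feeds the counts for an X that is not reached. It follows
-- from 2(s + 1) + 4 ≤ 2^(s + 2), an equality for s = 1.
--
-- The inclusion ⟨a, b⟩ᵗ ≤ ⟨a, b⟩ is one-sided because one outcome is the Baumslag-Solitar relation
-- aᵗ = a²; another is the Fibonacci action a ↦ b ↦ ab.
--
-- Many arguments presuppose which of two products such as XZ and ZX is the larger. The opposite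
-- group, with the same order, supplies the other case.

open import Defs
open import Level using (Level; _⊔_)
open import Algebra.Bundles using (Group)
import Algebra.Construct.Flip.Op as Op
import Algebra.Properties.Group as GroupProperties
open import Data.Bool using (Bool; true; false; not)
open import Data.Empty using (⊥; ⊥-elim)
open import Data.Fin using (Fin)
import Data.Fin.Properties as Fin
open import Data.Integer using (ℤ; +_; -[1+_]; 0ℤ; 1ℤ; -1ℤ)
import Data.Integer as ℤ
import Data.Integer.Properties as ℤ
open import Data.Integer.Solver using (module +-*-Solver)
open import Data.List using (List; []; _∷_; _++_; length; map; downFrom)
import Data.List.Properties as List
open import Data.List.Membership.Propositional using (_∈_)
import Data.List.Membership.Propositional.Properties as ∈
open import Data.List.Relation.Unary.All as All using (All; []; _∷_)
import Data.List.Relation.Unary.All.Properties as All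
open import Data.List.Relation.Unary.AllPairs as AllPairs using (AllPairs; []; _∷_)
import Data.List.Relation.Unary.AllPairs.Properties as AllPairs
open import Data.List.Relation.Unary.Any as Any using (here; there; _─_)
open import Data.Nat using (ℕ; zero; suc; s≤s; z≤n; _+_; _*_)
import Data.Nat as ℕ
import Data.Nat.Properties as ℕ
open import Data.Nat.Tactic.RingSolver using (solve-∀)
open import Data.Product using (Σ; _×_; _,_; proj₁; proj₂)
open import Data.Sum using (_⊎_; inj₁; inj₂; [_,_]′; map₁; map₂)
open import Data.Unit.Polymorphic using (tt)
open import Data.Vec using (Vec; lookup)
open import Relation.Binary.Bundles using (Poset)
import Relation.Binary.Construct.NonStrictToStrict as ToStrict
open import Relation.Binary.Definitions using (tri<; tri≈; tri>)
open import Relation.Binary.PropositionalEquality as ≡ using (_≡_)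
import Relation.Binary.Reasoning.PartialOrder as PosetReasoning
import Relation.Binary.Reasoning.Setoid as SetoidReasoning
import Relation.Binary.Reflection as Reflection
open import Relation.Binary.Structures using (IsPartialOrder; IsTotalOrder)
open import Relation.Nullary using (Dec; yes; no; ¬_)

-- Word identities in groups

module GroupSolver {c ℓ} (G : Group c ℓ) where
  open Group G
  open GroupProperties G using (⁻¹-involutive; ⁻¹-anti-homo-∙; ε⁻¹≈ε)
  open SetoidReasoning setoid

  infixl 7 _⊙_
  infix 8 _⁻

  data Expr (n : ℕ) : Set where
    var : Fin n → Expr n
    _⊙_ : Expr n → Expr n → Expr n
    _⁻  : Expr n → Expr n
    ι   : Expr n

  ⟦_⟧ : ∀ {n} → Expr n → Vec Carrier n → Carrier
  ⟦ var i ⟧ ρ = lookup ρ i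
  ⟦ s ⊙ t ⟧ ρ = ⟦ s ⟧ ρ ∙ ⟦ t ⟧ ρ
  ⟦ s ⁻ ⟧   ρ = ⟦ s ⟧ ρ ⁻¹
  ⟦ ι ⟧     ρ = ε

  Word : ℕ → Set
  Word n = List (Bool × Fin n)

  infix 8 _^±_

  _^±_ : Carrier → Bool → Carrier
  g ^± true  = g
  g ^± false = g ⁻¹

  evalWord : ∀ {n} → Word n → Vec Carrier n → Carrier
  evalWord []            ρ = ε
  evalWord ((b , i) ∷ w) ρ = lookup ρ i ^± b ∙ evalWord w ρ

  push : ∀ {n} → Bool × Fin n → Word n → Word n
  push l [] = l ∷ []
  push (b , i) ((b′ , j) ∷ w) with i Fin.≟ j
  push (true  , i) ((false , j) ∷ w) | yes _ = w
  push (false , i) ((true  , j) ∷ w) | yes _ = w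
  push (b     , i) ((b′    , j) ∷ w) | _     = (b , i) ∷ (b′ , j) ∷ w

  -- The Boolean `false` records a pending inverse, which is carried down to the variables. The
  -- accumulator is already freely reduced, so cancelling at its head is enough to keep it so.
  pushAll : ∀ {n} → Bool → Expr n → Word n → Word n
  pushAll b     (var i) w = push (b , i) w
  pushAll true  (s ⊙ t) w = pushAll true s (pushAll true t w)
  pushAll false (s ⊙ t) w = pushAll false t (pushAll false s w)
  pushAll b     (s ⁻)   w = pushAll (not b) s w
  pushAll b     ι       w = w

  ⟦_⇓⟧ : ∀ {n} → Expr n → Vec Carrier n → Carrier
  ⟦ s ⇓⟧ ρ = evalWord (pushAll true s []) ρ

  push-correct : ∀ {n} b (i : Fin n) w ρ →
    evalWord (push (b , i) w) ρ ≈ lookup ρ i ^± b ∙ evalWord w ρ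
  push-correct b i [] ρ = refl
  push-correct b i ((b′ , j) ∷ w) ρ with i Fin.≟ j
  push-correct true  i ((false , .i) ∷ w) ρ | yes ≡.refl = begin
    evalWord w ρ                          ≈⟨ identityˡ _ ⟨
    ε ∙ evalWord w ρ                      ≈⟨ ∙-congʳ (inverseʳ _) ⟨
    lookup ρ i ∙ lookup ρ i ⁻¹ ∙ evalWord w ρ ≈⟨ assoc _ _ _ ⟩
    lookup ρ i ∙ (lookup ρ i ⁻¹ ∙ evalWord w ρ) ∎
  push-correct false i ((true  , .i) ∷ w) ρ | yes ≡.refl = begin
    evalWord w ρ                          ≈⟨ identityˡ _ ⟨
    ε ∙ evalWord w ρ                      ≈⟨ ∙-congʳ (inverseˡ _) ⟨
    lookup ρ i ⁻¹ ∙ lookup ρ i ∙ evalWord w ρ ≈⟨ assoc _ _ _ ⟩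
    lookup ρ i ⁻¹ ∙ (lookup ρ i ∙ evalWord w ρ) ∎
  push-correct true  i ((true  , j) ∷ w) ρ | yes _ = refl
  push-correct false i ((false , j) ∷ w) ρ | yes _ = refl
  push-correct true  i ((true  , j) ∷ w) ρ | no _  = refl
  push-correct true  i ((false , j) ∷ w) ρ | no _  = refl
  push-correct false i ((true  , j) ∷ w) ρ | no _  = refl
  push-correct false i ((false , j) ∷ w) ρ | no _  = refl

  pushAll-correct : ∀ {n} b (s : Expr n) w ρ →
    evalWord (pushAll b s w) ρ ≈ ⟦ s ⟧ ρ ^± b ∙ evalWord w ρ
  pushAll-correct b     (var i) w ρ = push-correct b i w ρ
  pushAll-correct true  (s ⊙ t) w ρ = begin
    evalWord (pushAll true s (pushAll true t w)) ρ ≈⟨ pushAll-correct true s _ ρ ⟩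
    ⟦ s ⟧ ρ ∙ evalWord (pushAll true t w) ρ        ≈⟨ ∙-congˡ (pushAll-correct true t w ρ) ⟩
    ⟦ s ⟧ ρ ∙ (⟦ t ⟧ ρ ∙ evalWord w ρ)             ≈⟨ assoc _ _ _ ⟨
    ⟦ s ⟧ ρ ∙ ⟦ t ⟧ ρ ∙ evalWord w ρ               ∎
  pushAll-correct false (s ⊙ t) w ρ = begin
    evalWord (pushAll false t (pushAll false s w)) ρ ≈⟨ pushAll-correct false t _ ρ ⟩
    ⟦ t ⟧ ρ ⁻¹ ∙ evalWord (pushAll false s w) ρ      ≈⟨ ∙-congˡ (pushAll-correct false s w ρ) ⟩
    ⟦ t ⟧ ρ ⁻¹ ∙ (⟦ s ⟧ ρ ⁻¹ ∙ evalWord w ρ)         ≈⟨ assoc _ _ _ ⟨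
    ⟦ t ⟧ ρ ⁻¹ ∙ ⟦ s ⟧ ρ ⁻¹ ∙ evalWord w ρ           ≈⟨ ∙-congʳ (⁻¹-anti-homo-∙ _ _) ⟨
    (⟦ s ⟧ ρ ∙ ⟦ t ⟧ ρ) ⁻¹ ∙ evalWord w ρ            ∎
  pushAll-correct true  (s ⁻) w ρ = pushAll-correct false s w ρ
  pushAll-correct false (s ⁻) w ρ =
    trans (pushAll-correct true s w ρ) (∙-congʳ (sym (⁻¹-involutive _)))
  pushAll-correct true  ι w ρ = sym (identityˡ _)
  pushAll-correct false ι w ρ = sym (trans (∙-congʳ ε⁻¹≈ε) (identityˡ _))

  correct : ∀ {n} (s : Expr n) ρ → ⟦ s ⇓⟧ ρ ≈ ⟦ s ⟧ ρ
  correct s ρ = trans (pushAll-correct true s [] ρ) (identityʳ _)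

  open Reflection setoid var ⟦_⟧ ⟦_⇓⟧ correct public using (solve; _⊜_)

-- Subgroups

module Subgroups {c ℓ} (G : Group c ℓ) where
  open Group G
  open GroupNotions G
  open GroupProperties G using (∙-cancelˡ; ∙-cancelʳ)
  open GroupSolver G
  open SetoidReasoning setoid

  record IsSubgroup {p} (Q : Carrier → Set p) : Set (c ⊔ ℓ ⊔ p) where
    field
      ε∈   : Q ε
      ∙∈   : ∀ {g h} → Q g → Q h → Q (g ∙ h)
      ⁻¹∈  : ∀ {g} → Q g → Q (g ⁻¹)
      ≈∈   : ∀ {g h} → g ≈ h → Q g → Q h

  open IsSubgroup

  ⟨⟩-isSubgroup : ∀ {P} → IsSubgroup ⟨ P ⟩
  ⟨⟩-isSubgroup = record { ε∈ = unit ; ∙∈ = mul ; ⁻¹∈ = inv ; ≈∈ = resp }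

  ⟨⟩-least : ∀ {p} {P : Pred} {Q : Carrier → Set p} → IsSubgroup Q →
             (∀ {g} → P g → Q g) → ∀ {g} → ⟨ P ⟩ g → Q g
  ⟨⟩-least sub P⊆Q (gen x)    = P⊆Q x
  ⟨⟩-least sub P⊆Q unit       = ε∈ sub
  ⟨⟩-least sub P⊆Q (mul x y)  = ∙∈ sub (⟨⟩-least sub P⊆Q x) (⟨⟩-least sub P⊆Q y)
  ⟨⟩-least sub P⊆Q (inv x)    = ⁻¹∈ sub (⟨⟩-least sub P⊆Q x)
  ⟨⟩-least sub P⊆Q (resp e x) = ≈∈ sub e (⟨⟩-least sub P⊆Q x)

  infix 4 _⟷_

  _⟷_ : Carrier → Carrier → Set ℓ
  g ⟷ h = g ∙ h ≈ h ∙ g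

  ⟷-sym : ∀ {g h} → g ⟷ h → h ⟷ g
  ⟷-sym = sym

  centralizer-isSubgroup : ∀ h → IsSubgroup (_⟷ h)
  centralizer-isSubgroup h = record
    { ε∈ = trans (identityˡ h) (sym (identityʳ h))
    ; ∙∈ = λ {g} {k} p q → begin
        g ∙ k ∙ h   ≈⟨ assoc g k h ⟩
        g ∙ (k ∙ h) ≈⟨ ∙-congˡ q ⟩
        g ∙ (h ∙ k) ≈⟨ assoc g h k ⟨
        g ∙ h ∙ k   ≈⟨ ∙-congʳ p ⟩
        h ∙ g ∙ k   ≈⟨ assoc h g k ⟩
        h ∙ (g ∙ k) ∎
    ; ⁻¹∈ = λ {g} p → begin
        g ⁻¹ ∙ h               ≈⟨ solve 2 (λ g h → g ⁻ ⊙ h ⊜ g ⁻ ⊙ (h ⊙ g) ⊙ g ⁻) refl g h ⟩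
        g ⁻¹ ∙ (h ∙ g) ∙ g ⁻¹  ≈⟨ ∙-congʳ (∙-congˡ p) ⟨
        g ⁻¹ ∙ (g ∙ h) ∙ g ⁻¹  ≈⟨ solve 2 (λ g h → g ⁻ ⊙ (g ⊙ h) ⊙ g ⁻ ⊜ h ⊙ g ⁻) refl g h ⟩
        h ∙ g ⁻¹               ∎
    ; ≈∈ = λ e p → trans (∙-congʳ (sym e)) (trans p (∙-congˡ e))
    }

  ⟨⟩-⟷ : ∀ {P : Pred} {h} → (∀ {g} → P g → g ⟷ h) → ∀ {g} → ⟨ P ⟩ g → g ⟷ h
  ⟨⟩-⟷ = ⟨⟩-least (centralizer-isSubgroup _)

  ⟨⟩-abelian : ∀ {P : Pred} → (∀ {g h} → P g → P h → g ⟷ h) →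
               ∀ {g h} → ⟨ P ⟩ g → ⟨ P ⟩ h → g ⟷ h
  ⟨⟩-abelian ab p q = ⟨⟩-⟷ (λ r → ⟷-sym (⟨⟩-⟷ (λ r′ → ab r′ r) q)) p

  conj : Carrier → Carrier → Carrier
  conj t g = t ⁻¹ ∙ g ∙ t

  conj-cong : ∀ t {g h} → g ≈ h → conj t g ≈ conj t h
  conj-cong t e = ∙-congʳ (∙-congˡ e)

  conj-∙ : ∀ t g h → conj t (g ∙ h) ≈ conj t g ∙ conj t h
  conj-∙ = solve 3 (λ t g h → t ⁻ ⊙ (g ⊙ h) ⊙ t ⊜ (t ⁻ ⊙ g ⊙ t) ⊙ (t ⁻ ⊙ h ⊙ t)) refl

  conj-⁻¹ : ∀ t g → conj t (g ⁻¹) ≈ conj t g ⁻¹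
  conj-⁻¹ = solve 2 (λ t g → t ⁻ ⊙ g ⁻ ⊙ t ⊜ (t ⁻ ⊙ g ⊙ t) ⁻) refl

  conj-ε : ∀ t → conj t ε ≈ ε
  conj-ε = solve 1 (λ t → t ⁻ ⊙ ι ⊙ t ⊜ ι) refl

  conj-conj⁻¹ : ∀ t g → conj t (conj (t ⁻¹) g) ≈ g
  conj-conj⁻¹ = solve 2 (λ t g → t ⁻ ⊙ (t ⁻ ⁻ ⊙ g ⊙ t ⁻) ⊙ t ⊜ g) refl

  conj-injective : ∀ t {g h} → conj t g ≈ conj t h → g ≈ h
  conj-injective t p = ∙-cancelˡ _ _ _ (∙-cancelʳ _ _ _ p)

  conj-fixed : ∀ {t g} → g ⟷ t → conj t g ≈ g
  conj-fixed {t} {g} p = begin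
    t ⁻¹ ∙ g ∙ t   ≈⟨ assoc _ _ _ ⟩
    t ⁻¹ ∙ (g ∙ t) ≈⟨ ∙-congˡ p ⟩
    t ⁻¹ ∙ (t ∙ g) ≈⟨ solve 2 (λ t g → t ⁻ ⊙ (t ⊙ g) ⊜ g) refl t g ⟩
    g              ∎

  conj-isSubgroup : ∀ {p} {Q : Carrier → Set p} t → IsSubgroup Q → IsSubgroup (λ g → Q (conj t g))
  conj-isSubgroup t sub = record
    { ε∈  = ≈∈ sub (sym (conj-ε t)) (ε∈ sub)
    ; ∙∈  = λ p q → ≈∈ sub (sym (conj-∙ t _ _)) (∙∈ sub p q)
    ; ⁻¹∈ = λ p → ≈∈ sub (sym (conj-⁻¹ t _)) (⁻¹∈ sub p)
    ; ≈∈  = λ e → ≈∈ sub (conj-cong t e)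
    }

  commutator-⟷ : ∀ {g h} → g ⟷ h → [ g , h ] ≈ ε
  commutator-⟷ {g} {h} p = begin
    g ⁻¹ ∙ h ⁻¹ ∙ g ∙ h   ≈⟨ assoc _ _ _ ⟩
    g ⁻¹ ∙ h ⁻¹ ∙ (g ∙ h) ≈⟨ ∙-congˡ p ⟩
    g ⁻¹ ∙ h ⁻¹ ∙ (h ∙ g) ≈⟨ solve 2 (λ g h → g ⁻ ⊙ h ⁻ ⊙ (h ⊙ g) ⊜ ι) refl g h ⟩
    ε                     ∎

  commutator-cong : ∀ {g g′ h h′} → g ≈ g′ → h ≈ h′ → [ g , h ] ≈ [ g′ , h′ ]
  commutator-cong p q = ∙-cong (∙-cong (∙-cong (⁻¹-cong p) (⁻¹-cong q)) p) q

  -- A group is abelian modulo a normalised subgroup once its generators commute modulo it, by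
  -- [st, h] = [s, h]ᵗ[t, h] and its analogue for t⁻¹. Both directions of conjugation are assumed,
  -- since mapping `N` into itself does not imply mapping it onto itself.
  module CommutatorClosure {p} {P : Pred} {N : Carrier → Set p} (sub : IsSubgroup N)
    (normal  : ∀ {t g} → P t → N g → N (conj t g))
    (normal⁻ : ∀ {t g} → P t → N g → N (conj (t ⁻¹) g)) where

    private
      conj-normal  : ∀ {t g} → ⟨ P ⟩ t → N g → N (conj t g)
      conj-normal⁻ : ∀ {t g} → ⟨ P ⟩ t → N g → N (conj (t ⁻¹) g)
      conj-normal (gen x) n = normal x n
      conj-normal unit n = ≈∈ sub (solve 1 (λ g → g ⊜ ι ⁻ ⊙ g ⊙ ι) refl _) n
      conj-normal (mul {s} {t} x y) n =
        ≈∈ sub (solve 3 (λ s t g → t ⁻ ⊙ (s ⁻ ⊙ g ⊙ s) ⊙ t ⊜ (s ⊙ t) ⁻ ⊙ g ⊙ (s ⊙ t)) refl s t _)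
               (conj-normal y (conj-normal x n))
      conj-normal (inv x) n = conj-normal⁻ x n
      conj-normal (resp e x) n = ≈∈ sub (∙-cong (∙-congʳ (⁻¹-cong e)) e) (conj-normal x n)
      conj-normal⁻ (gen x) n = normal⁻ x n
      conj-normal⁻ unit n = ≈∈ sub (solve 1 (λ g → g ⊜ ι ⁻ ⁻ ⊙ g ⊙ ι ⁻) refl _) n
      conj-normal⁻ (mul {s} {t} x y) n =
        ≈∈ sub (solve 3 (λ s t g → s ⁻ ⁻ ⊙ (t ⁻ ⁻ ⊙ g ⊙ t ⁻) ⊙ s ⁻ ⊜ (s ⊙ t) ⁻ ⁻ ⊙ g ⊙ (s ⊙ t) ⁻) refl s t _)
               (conj-normal⁻ x (conj-normal⁻ y n))
      conj-normal⁻ (inv {t} x) n =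
        ≈∈ sub (solve 2 (λ t g → t ⁻ ⊙ g ⊙ t ⊜ t ⁻ ⁻ ⁻ ⊙ g ⊙ t ⁻ ⁻) refl t _) (conj-normal x n)
      conj-normal⁻ (resp e x) n =
        ≈∈ sub (∙-cong (∙-congʳ (⁻¹-cong (⁻¹-cong e))) (⁻¹-cong e)) (conj-normal⁻ x n)

      commutatorˡ : ∀ {h} → (∀ {t} → P t → N [ t , h ]) → ∀ {g} → ⟨ P ⟩ g → N [ g , h ]
      commutatorˡ on (gen x) = on x
      commutatorˡ on unit = ≈∈ sub (solve 1 (λ h → ι ⊜ ι ⁻ ⊙ h ⁻ ⊙ ι ⊙ h) refl _) (ε∈ sub)
      commutatorˡ {h} on (mul {s} {t} x y) =
        ≈∈ sub (solve 3 (λ s t h → (t ⁻ ⊙ (s ⁻ ⊙ h ⁻ ⊙ s ⊙ h) ⊙ t) ⊙ (t ⁻ ⊙ h ⁻ ⊙ t ⊙ h)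
                                 ⊜ (s ⊙ t) ⁻ ⊙ h ⁻ ⊙ (s ⊙ t) ⊙ h) refl s t h)
               (∙∈ sub (conj-normal y (commutatorˡ on x)) (commutatorˡ on y))
      commutatorˡ {h} on (inv {t} x) =
        ≈∈ sub (solve 2 (λ t h → t ⁻ ⁻ ⊙ (t ⁻ ⊙ h ⁻ ⊙ t ⊙ h) ⁻ ⊙ t ⁻
                               ⊜ t ⁻ ⁻ ⊙ h ⁻ ⊙ t ⁻ ⊙ h) refl t h)
               (conj-normal⁻ x (⁻¹∈ sub (commutatorˡ on x)))
      commutatorˡ on (resp e x) = ≈∈ sub (commutator-cong e refl) (commutatorˡ on x)

      flip : ∀ {g h} → N [ g , h ] → N [ h , g ]
      flip {g} {h} n =
        ≈∈ sub (solve 2 (λ g h → (g ⁻ ⊙ h ⁻ ⊙ g ⊙ h) ⁻ ⊜ h ⁻ ⊙ g ⁻ ⊙ h ⊙ g) refl g h) (⁻¹∈ sub n)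

    commutator∈ : (∀ {s t} → P s → P t → N [ s , t ]) →
                  ∀ {g h} → ⟨ P ⟩ g → ⟨ P ⟩ h → N [ g , h ]
    commutator∈ on g∈ h∈ = commutatorˡ (λ p → flip (commutatorˡ (λ q → on q p) h∈)) g∈

  derived⊆ : ∀ {p} {H : Pred} {Q : Carrier → Set p} → IsSubgroup Q →
             (∀ {g h} → H g → H h → Q [ g , h ]) → ∀ {g} → γ H 1 g → Q g
  derived⊆ sub on = ⟨⟩-least sub λ { (_ , _ , x∈ , y∈ , e) → ≈∈ sub (sym e) (on x∈ y∈) }

  -- The preimages of A under iterated conjugation with t form an increasing chain, so their union
  -- N is abelian; unlike A, it is normalised by t in both directions.
  module Ascending {A : Pred} (A-sub : IsSubgroup A) (A-abelian : Abelian A)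
    (t : Carrier) (A-conj : ∀ {g} → A g → A (conj t g)) where

    private
      conjⁿ : ℕ → Carrier → Carrier
      conjⁿ zero    g = g
      conjⁿ (suc n) g = conjⁿ n (conj t g)

      conjⁿ-isSubgroup : ∀ n → IsSubgroup (λ g → A (conjⁿ n g))
      conjⁿ-isSubgroup zero    = A-sub
      conjⁿ-isSubgroup (suc n) = conj-isSubgroup t (conjⁿ-isSubgroup n)

      conjⁿ-conj : ∀ n {g} → A (conjⁿ n g) → A (conjⁿ n (conj t g))
      conjⁿ-conj zero    = A-conj
      conjⁿ-conj (suc n) = conjⁿ-conj n

      conjⁿ-+ʳ : ∀ m n {g} → A (conjⁿ n g) → A (conjⁿ (m + n) g)
      conjⁿ-+ʳ zero    n p = p
      conjⁿ-+ʳ (suc m) n p = conjⁿ-conj (m + n) (conjⁿ-+ʳ m n p)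

      conjⁿ-+ˡ : ∀ m n {g} → A (conjⁿ m g) → A (conjⁿ (m + n) g)
      conjⁿ-+ˡ m n {g} p = ≡.subst (λ k → A (conjⁿ k g)) (ℕ.+-comm n m) (conjⁿ-+ʳ n m p)

      conjⁿ-⟷ : ∀ n {g h} → A (conjⁿ n g) → A (conjⁿ n h) → g ⟷ h
      conjⁿ-⟷ zero    = A-abelian
      conjⁿ-⟷ (suc n) {g} {h} p q = conj-injective t (begin
        conj t (g ∙ h)      ≈⟨ conj-∙ t g h ⟩
        conj t g ∙ conj t h ≈⟨ conjⁿ-⟷ n p q ⟩
        conj t h ∙ conj t g ≈⟨ conj-∙ t h g ⟨
        conj t (h ∙ g)      ∎)

    N : Pred
    N g = Σ ℕ λ n → A (conjⁿ n g)

    N-isSubgroup : IsSubgroup N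
    N-isSubgroup = record
      { ε∈  = 0 , ε∈ A-sub
      ; ∙∈  = λ { (m , p) (n , q) →
                m + n , ∙∈ (conjⁿ-isSubgroup (m + n)) (conjⁿ-+ˡ m n p) (conjⁿ-+ʳ m n q) }
      ; ⁻¹∈ = λ { (m , p) → m , ⁻¹∈ (conjⁿ-isSubgroup m) p }
      ; ≈∈  = λ { e (m , p) → m , ≈∈ (conjⁿ-isSubgroup m) e p }
      }

    N-abelian : ∀ {g h} → N g → N h → g ⟷ h
    N-abelian (m , p) (n , q) = conjⁿ-⟷ (m + n) (conjⁿ-+ˡ m n p) (conjⁿ-+ʳ m n q)

    N-conj : ∀ {g} → N g → N (conj t g)
    N-conj (n , p) = n , conjⁿ-conj n p

    N-conj⁻¹ : ∀ {g} → N g → N (conj (t ⁻¹) g)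
    N-conj⁻¹ {g} (n , p) = suc n , ≈∈ (conjⁿ-isSubgroup n) (sym (conj-conj⁻¹ t g)) p

    metabelian : ∀ {P H : Pred} → (∀ {g} → P g → A g ⊎ g ≈ t) → (∀ {g} → H g → ⟨ P ⟩ g) →
                 Metabelian H
    metabelian {P} {H} P⊆ H⊆ p q = N-abelian (γ⊆N p) (γ⊆N q)
      where
      P-normal : ∀ {s g} → P s → N g → N (conj s g)
      P-normal x n with P⊆ x
      ... | inj₁ a = ∙∈ N-isSubgroup (∙∈ N-isSubgroup (0 , ⁻¹∈ A-sub a) n) (0 , a)
      ... | inj₂ e = ≈∈ N-isSubgroup (sym (∙-cong (∙-congʳ (⁻¹-cong e)) e)) (N-conj n)

      P-normal⁻ : ∀ {s g} → P s → N g → N (conj (s ⁻¹) g)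
      P-normal⁻ x n with P⊆ x
      ... | inj₁ a = ∙∈ N-isSubgroup (∙∈ N-isSubgroup (0 , ⁻¹∈ A-sub (⁻¹∈ A-sub a)) n) (0 , ⁻¹∈ A-sub a)
      ... | inj₂ e = ≈∈ N-isSubgroup (sym (∙-cong (∙-congʳ (⁻¹-cong (⁻¹-cong e))) (⁻¹-cong e))) (N-conj⁻¹ n)

      P-commutator : ∀ {s s′} → P s → P s′ → N [ s , s′ ]
      P-commutator {s} {s′} x x′ with P⊆ x | P⊆ x′
      ... | inj₁ a | _ =
        ≈∈ N-isSubgroup (solve 2 (λ s s′ → s ⁻ ⊙ (s′ ⁻ ⊙ s ⊙ s′) ⊜ s ⁻ ⊙ s′ ⁻ ⊙ s ⊙ s′) refl s s′)
          (∙∈ N-isSubgroup (0 , ⁻¹∈ A-sub a) (P-normal x′ (0 , a)))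
      ... | inj₂ _ | inj₁ a =
        ≈∈ N-isSubgroup (solve 2 (λ s s′ → (s ⁻ ⊙ s′ ⁻ ⊙ s) ⊙ s′ ⊜ s ⁻ ⊙ s′ ⁻ ⊙ s ⊙ s′) refl s s′)
          (∙∈ N-isSubgroup (P-normal x (0 , ⁻¹∈ A-sub a)) (0 , a))
      ... | inj₂ e | inj₂ e′ = ≈∈ N-isSubgroup
        (sym (commutator-⟷ (trans (∙-cong e e′) (sym (∙-cong e′ e))))) (ε∈ N-isSubgroup)

      γ⊆N : ∀ {g} → γ H 1 g → N g
      γ⊆N = derived⊆ N-isSubgroup λ g∈ h∈ →
        CommutatorClosure.commutator∈ N-isSubgroup P-normal P-normal⁻ P-commutator (H⊆ g∈) (H⊆ h∈)

  ⟨_,,_⟩ : Carrier → Carrier → Pred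
  ⟨ a ,, b ⟩ = ⟨ Mem (a ∷ b ∷ []) ⟩

  genˡ : ∀ {a b} → ⟨ a ,, b ⟩ a
  genˡ = gen (here refl)

  genʳ : ∀ {a b} → ⟨ a ,, b ⟩ b
  genʳ = gen (there (here refl))

  ⟨,⟩-least : ∀ {p} {Q : Carrier → Set p} {a b} → IsSubgroup Q → Q a → Q b →
              ∀ {g} → ⟨ a ,, b ⟩ g → Q g
  ⟨,⟩-least sub qa qb = ⟨⟩-least sub λ
    { (here e)         → ≈∈ sub (sym e) qa
    ; (there (here e)) → ≈∈ sub (sym e) qb }

  ⟨_,,_,,_⟩ : Carrier → Carrier → Carrier → Pred
  ⟨ a ,, b ,, t ⟩ = ⟨ Mem (a ∷ b ∷ t ∷ []) ⟩

  gen₁ : ∀ {a b t} → ⟨ a ,, b ,, t ⟩ a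
  gen₁ = gen (here refl)

  gen₂ : ∀ {a b t} → ⟨ a ,, b ,, t ⟩ b
  gen₂ = gen (there (here refl))

  gen₃ : ∀ {a b t} → ⟨ a ,, b ,, t ⟩ t
  gen₃ = gen (there (there (here refl)))

  ⟨,,⟩-least : ∀ {p} {Q : Carrier → Set p} {a b t} → IsSubgroup Q → Q a → Q b → Q t →
               ∀ {g} → ⟨ a ,, b ,, t ⟩ g → Q g
  ⟨,,⟩-least sub qa qb qt = ⟨⟩-least sub λ
    { (here e)                 → ≈∈ sub (sym e) qa
    ; (there (here e))         → ≈∈ sub (sym e) qb
    ; (there (there (here e))) → ≈∈ sub (sym e) qt }

  -- Conjugation with `t` need not be onto: with a = b this includes aᵗ = a². Such a cyclic base is
  -- expressed by taking the same generator twice.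
  record Split (a b t : Carrier) : Set (c ⊔ ℓ) where
    field
      commute : a ⟷ b
      conj-a  : ⟨ a ,, b ⟩ (conj t a)
      conj-b  : ⟨ a ,, b ⟩ (conj t b)

    abelian : ∀ {g h} → ⟨ a ,, b ⟩ g → ⟨ a ,, b ⟩ h → g ⟷ h
    abelian p q = ⟨,⟩-least (centralizer-isSubgroup _)
      (⟷-sym (⟨,⟩-least (centralizer-isSubgroup _) refl (⟷-sym commute) q))
      (⟷-sym (⟨,⟩-least (centralizer-isSubgroup _) commute refl q)) p

    conj∈ : ∀ {g} → ⟨ a ,, b ⟩ g → ⟨ a ,, b ⟩ (conj t g)
    conj∈ = ⟨,⟩-least (conj-isSubgroup t ⟨⟩-isSubgroup) conj-a conj-b

    generators : ∀ {g} → Mem (a ∷ b ∷ t ∷ []) g → ⟨ a ,, b ⟩ g ⊎ g ≈ t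
    generators (here e)                 = inj₁ (resp (sym e) genˡ)
    generators (there (here e))         = inj₁ (resp (sym e) genʳ)
    generators (there (there (here e))) = inj₂ e

    metabelian : ∀ {H : Pred} → (∀ {g} → H g → ⟨ a ,, b ,, t ⟩ g) → Metabelian H
    metabelian = Ascending.metabelian ⟨⟩-isSubgroup abelian t conj∈ generators

-- Nilpotent groups

module Nilpotency {c ℓ} (G : Group c ℓ) where
  open Group G
  open GroupNotions G
  open Subgroups G
  open GroupProperties G using (ε⁻¹≈ε)
  open GroupSolver G using (solve; _⊜_; _⊙_; _⁻; ι)
  open SetoidReasoning setoid
  open IsSubgroup

  infixr 8 _^ⁿ_ _^_

  _^ⁿ_ : Carrier → ℕ → Carrier
  g ^ⁿ zero  = ε
  g ^ⁿ suc n = g ∙ g ^ⁿ n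

  _^_ : Carrier → ℤ → Carrier
  g ^ (+ n)    = g ^ⁿ n
  g ^ -[1+ n ] = (g ^ⁿ suc n) ⁻¹

  ^ⁿ-∈ : ∀ {p} {Q : Carrier → Set p} → IsSubgroup Q → ∀ {g} → Q g → ∀ n → Q (g ^ⁿ n)
  ^ⁿ-∈ sub q zero    = ε∈ sub
  ^ⁿ-∈ sub q (suc n) = ∙∈ sub q (^ⁿ-∈ sub q n)

  ^-∈ : ∀ {p} {Q : Carrier → Set p} → IsSubgroup Q → ∀ {g} → Q g → ∀ i → Q (g ^ i)
  ^-∈ sub q (+ n)    = ^ⁿ-∈ sub q n
  ^-∈ sub q -[1+ n ] = ⁻¹∈ sub (^ⁿ-∈ sub q (suc n))

  ^ⁿ-⟷ : ∀ g n → g ^ⁿ n ⟷ g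
  ^ⁿ-⟷ g = ^ⁿ-∈ (centralizer-isSubgroup g) refl

  ^-suc : ∀ g i → g ^ (ℤ.suc i) ≈ g ∙ g ^ i
  ^-suc g (+ n)           = refl
  ^-suc g -[1+ zero ]     = solve 1 (λ g → ι ⊜ g ⊙ (g ⊙ ι) ⁻) refl g
  ^-suc g -[1+ (suc n) ]  = begin
    (g ∙ h) ⁻¹       ≈⟨ solve 2 (λ g h → (g ⊙ h) ⁻ ⊜ g ⊙ (g ⊙ h ⊙ g) ⁻) refl g h ⟩
    g ∙ (g ∙ h ∙ g) ⁻¹ ≈⟨ ∙-congˡ (⁻¹-cong (trans (assoc g h g) (∙-congˡ (^ⁿ-⟷ g n)))) ⟩
    g ∙ (g ∙ (g ∙ h)) ⁻¹ ∎
    where h = g ^ⁿ n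

  ^-pred : ∀ g i → g ^ (ℤ.pred i) ≈ g ⁻¹ ∙ g ^ i
  ^-pred g i = begin
    g ^ ℤ.pred i              ≈⟨ solve 2 (λ g h → h ⊜ g ⁻ ⊙ (g ⊙ h)) refl g _ ⟩
    g ⁻¹ ∙ (g ∙ g ^ ℤ.pred i) ≈⟨ ∙-congˡ (^-suc g (ℤ.pred i)) ⟨
    g ⁻¹ ∙ g ^ ℤ.suc (ℤ.pred i) ≡⟨ ≡.cong (λ j → g ⁻¹ ∙ g ^ j) (ℤ.suc-pred i) ⟩
    g ⁻¹ ∙ g ^ i              ∎

  ^-+ : ∀ g i j → g ^ (i ℤ.+ j) ≈ g ^ i ∙ g ^ j
  ^-+ g (+ zero) j = trans (reflexive (≡.cong (g ^_) (ℤ.+-identityˡ j))) (sym (identityˡ _))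
  ^-+ g (+ suc n) j = begin
    g ^ (+ suc n ℤ.+ j)        ≡⟨ ≡.cong (g ^_) (ℤ.suc-+ n j) ⟩
    g ^ (ℤ.suc (+ n ℤ.+ j))    ≈⟨ ^-suc g (+ n ℤ.+ j) ⟩
    g ∙ g ^ (+ n ℤ.+ j)        ≈⟨ ∙-congˡ (^-+ g (+ n) j) ⟩
    g ∙ (g ^ⁿ n ∙ g ^ j)       ≈⟨ assoc _ _ _ ⟨
    g ∙ g ^ⁿ n ∙ g ^ j         ∎
  ^-+ g -[1+ zero ] j = trans (^-pred g j) (∙-congʳ (⁻¹-cong (sym (identityʳ g))))
  ^-+ g -[1+ suc n ] j = begin
    g ^ (-[1+ suc n ] ℤ.+ j)         ≡⟨ ≡.cong (g ^_) (ℤ.pred-+ -[1+ n ] j) ⟩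
    g ^ (ℤ.pred (-[1+ n ] ℤ.+ j))    ≈⟨ ^-pred g (-[1+ n ] ℤ.+ j) ⟩
    g ⁻¹ ∙ g ^ (-[1+ n ] ℤ.+ j)      ≈⟨ ∙-congˡ (^-+ g -[1+ n ] j) ⟩
    g ⁻¹ ∙ (g ^ -[1+ n ] ∙ g ^ j)    ≈⟨ assoc _ _ _ ⟨
    g ⁻¹ ∙ g ^ -[1+ n ] ∙ g ^ j      ≈⟨ ∙-congʳ (^-pred g -[1+ n ]) ⟨
    g ^ -[1+ suc n ] ∙ g ^ j         ∎

  ε-sub : IsSubgroup (_≈ ε)
  ε-sub = record
    { ε∈  = refl
    ; ∙∈  = λ p q → trans (∙-cong p q) (identityˡ ε)
    ; ⁻¹∈ = λ p → trans (⁻¹-cong p) ε⁻¹≈ε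
    ; ≈∈  = λ e p → trans (sym e) p
    }

  Vector : Set
  Vector = ℤ × ℤ

  _⊕_ : Vector → Vector → Vector
  (i , j) ⊕ (k , l) = i ℤ.+ k , j ℤ.+ l

  _·_ : ℤ → Vector → Vector
  m · (i , j) = m ℤ.* i , m ℤ.* j

  module LinearMap (p q r s : ℤ) where
    open +-*-Solver using (_:=_; _:+_; _:*_; _:-_; con) renaming (solve to solveℤ)

    -- Vectors are rows: below, (p, q) and (r, s) are coordinates of [a, t] and [b, t], so that `M`
    -- lifts g ↦ [g, t] to ℤ².
    M : Vector → Vector
    M (i , j) = i ℤ.* p ℤ.+ j ℤ.* r , i ℤ.* q ℤ.+ j ℤ.* s

    Mⁿ : ℕ → Vector → Vector
    Mⁿ zero    u = u
    Mⁿ (suc n) u = M (Mⁿ n u)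

    τ d : ℤ
    τ = p ℤ.+ s
    d = p ℤ.* s ℤ.- q ℤ.* r

    cayley-hamilton : ∀ u → d · u ≡ (τ · M u) ⊕ (-1ℤ · M (M u))
    cayley-hamilton (i , j) = ≡.cong₂ _,_
      (solveℤ 6 (λ i j p q r s →
        (p :* s :- q :* r) :* i :=
        (p :+ s) :* (i :* p :+ j :* r)
          :+ con -1ℤ :* ((i :* p :+ j :* r) :* p :+ (i :* q :+ j :* s) :* r)) ≡.refl i j p q r s)
      (solveℤ 6 (λ i j p q r s →
        (p :* s :- q :* r) :* j :=
        (p :+ s) :* (i :* q :+ j :* s)
          :+ con -1ℤ :* ((i :* p :+ j :* r) :* q :+ (i :* q :+ j :* s) :* s)) ≡.refl i j p q r s)

    cayley-hamilton′ : ∀ u → M (M u) ≡ (τ · M u) ⊕ (-1ℤ · (d · u))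
    cayley-hamilton′ (i , j) = ≡.cong₂ _,_
      (solveℤ 6 (λ i j p q r s →
        (i :* p :+ j :* r) :* p :+ (i :* q :+ j :* s) :* r :=
        (p :+ s) :* (i :* p :+ j :* r) :+ con -1ℤ :* ((p :* s :- q :* r) :* i)) ≡.refl i j p q r s)
      (solveℤ 6 (λ i j p q r s →
        (i :* p :+ j :* r) :* q :+ (i :* q :+ j :* s) :* s :=
        (p :+ s) :* (i :* q :+ j :* s) :+ con -1ℤ :* ((p :* s :- q :* r) :* j)) ≡.refl i j p q r s)

  module _ (torsion-free : ∀ {g} n → g ^ⁿ suc n ≈ ε → g ≈ ε)
           {a b t : Carrier} (split : Split a b t) where
    open Split split

    ⟦_⟧ : Vector → Carrier
    ⟦ i , j ⟧ = a ^ i ∙ b ^ j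

    private
      A = ⟨ a ,, b ⟩
      A-sub = ⟨⟩-isSubgroup {Mem (a ∷ b ∷ [])}

    ⟦⟧-⊕ : ∀ u v → ⟦ u ⊕ v ⟧ ≈ ⟦ u ⟧ ∙ ⟦ v ⟧
    ⟦⟧-⊕ (i , j) (k , l) = begin
      a ^ (i ℤ.+ k) ∙ b ^ (j ℤ.+ l)           ≈⟨ ∙-cong (^-+ a i k) (^-+ b j l) ⟩
      (a ^ i ∙ a ^ k) ∙ (b ^ j ∙ b ^ l)       ≈⟨ assoc _ _ _ ⟩
      a ^ i ∙ (a ^ k ∙ (b ^ j ∙ b ^ l))       ≈⟨ ∙-congˡ (sym (assoc _ _ _)) ⟩
      a ^ i ∙ (a ^ k ∙ b ^ j ∙ b ^ l)         ≈⟨ ∙-congˡ (∙-congʳ (abelian (^-∈ A-sub genˡ k) (^-∈ A-sub genʳ j))) ⟩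
      a ^ i ∙ (b ^ j ∙ a ^ k ∙ b ^ l)         ≈⟨ ∙-congˡ (assoc _ _ _) ⟩
      a ^ i ∙ (b ^ j ∙ (a ^ k ∙ b ^ l))       ≈⟨ assoc _ _ _ ⟨
      a ^ i ∙ b ^ j ∙ (a ^ k ∙ b ^ l)         ∎

    ⟦⟧-0 : ⟦ 0ℤ , 0ℤ ⟧ ≈ ε
    ⟦⟧-0 = identityˡ ε

    ⟦⟧-neg : ∀ u → ⟦ -1ℤ · u ⟧ ≈ ⟦ u ⟧ ⁻¹
    ⟦⟧-neg u@(i , j) = begin
      ⟦ -1ℤ · u ⟧                     ≈⟨ solve 2 (λ g h → h ⊜ g ⁻ ⊙ (g ⊙ h)) refl ⟦ u ⟧ _ ⟩
      ⟦ u ⟧ ⁻¹ ∙ (⟦ u ⟧ ∙ ⟦ -1ℤ · u ⟧) ≈⟨ ∙-congˡ (⟦⟧-⊕ u (-1ℤ · u)) ⟨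
      ⟦ u ⟧ ⁻¹ ∙ ⟦ u ⊕ (-1ℤ · u) ⟧    ≡⟨ ≡.cong (λ v → ⟦ u ⟧ ⁻¹ ∙ ⟦ v ⟧) (≡.cong₂ _,_ (cancel i) (cancel j)) ⟩
      ⟦ u ⟧ ⁻¹ ∙ ⟦ 0ℤ , 0ℤ ⟧          ≈⟨ trans (∙-congˡ ⟦⟧-0) (identityʳ _) ⟩
      ⟦ u ⟧ ⁻¹                        ∎
      where
      open +-*-Solver using (_:=_; _:+_; _:*_; con) renaming (solve to solveℤ)
      cancel : ∀ i → i ℤ.+ -1ℤ ℤ.* i ≡ 0ℤ
      cancel = solveℤ 1 (λ i → i :+ con -1ℤ :* i := con 0ℤ) ≡.refl

    ⟦⟧-· : ∀ n u → ⟦ (+ n) · u ⟧ ≈ ⟦ u ⟧ ^ⁿ n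
    ⟦⟧-· zero    (i , j) = trans (reflexive (≡.cong ⟦_⟧ (≡.cong₂ _,_ (ℤ.*-zeroˡ i) (ℤ.*-zeroˡ j)))) ⟦⟧-0
    ⟦⟧-· (suc n) u@(i , j) = begin
      ⟦ (+ suc n) · u ⟧        ≡⟨ ≡.cong ⟦_⟧ (≡.cong₂ _,_ (ℤ.suc-* (+ n) i) (ℤ.suc-* (+ n) j)) ⟩
      ⟦ u ⊕ ((+ n) · u) ⟧      ≈⟨ ⟦⟧-⊕ u ((+ n) · u) ⟩
      ⟦ u ⟧ ∙ ⟦ (+ n) · u ⟧    ≈⟨ ∙-congˡ (⟦⟧-· n u) ⟩
      ⟦ u ⟧ ∙ ⟦ u ⟧ ^ⁿ n       ∎

    ⟦⟧-kernel : ∀ m u → ⟦ u ⟧ ≈ ε → ⟦ m · u ⟧ ≈ ε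
    ⟦⟧-kernel m u p = sym (trivial m)
      where
      trivial : ∀ m → ε ≈ ⟦ m · u ⟧
      trivial (+ n) = sym (trans (⟦⟧-· n u) (^ⁿ-∈ ε-sub p n))
      trivial -[1+ n ] = sym (begin
        ⟦ -[1+ n ] · u ⟧          ≡⟨ ≡.cong ⟦_⟧ (≡.cong₂ _,_ (neg (proj₁ u)) (neg (proj₂ u))) ⟩
        ⟦ -1ℤ · ((+ suc n) · u) ⟧ ≈⟨ ⟦⟧-neg ((+ suc n) · u) ⟩
        ⟦ (+ suc n) · u ⟧ ⁻¹      ≈⟨ ⁻¹-cong (trans (⟦⟧-· (suc n) u) (^ⁿ-∈ ε-sub p (suc n))) ⟩
        ε ⁻¹                      ≈⟨ ε⁻¹≈ε ⟩
        ε ∎)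
        where
        neg : ∀ i → -[1+ n ] ℤ.* i ≡ -1ℤ ℤ.* ((+ suc n) ℤ.* i)
        neg i = ≡.trans (≡.cong (ℤ._* i) (≡.sym (ℤ.-1*i≡-i (+ suc n)))) (ℤ.*-assoc -1ℤ (+ suc n) i)

    ⟦⟧-cancel : ∀ m u → ¬ m ≡ 0ℤ → ⟦ m · u ⟧ ≈ ε → ⟦ u ⟧ ≈ ε
    ⟦⟧-cancel (+ zero) u m≢0 p = ⊥-elim (m≢0 ≡.refl)
    ⟦⟧-cancel (+ suc n) u m≢0 p = torsion-free n (trans (sym (⟦⟧-· (suc n) u)) p)
    ⟦⟧-cancel -[1+ n ] u m≢0 p = ⟦⟧-cancel (+ suc n) u (λ ()) (begin
      ⟦ (+ suc n) · u ⟧             ≡⟨ ≡.cong ⟦_⟧ (≡.cong₂ _,_ (neg (proj₁ u)) (neg (proj₂ u))) ⟩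
      ⟦ -1ℤ · (-[1+ n ] · u) ⟧      ≈⟨ ⟦⟧-kernel -1ℤ (-[1+ n ] · u) p ⟩
      ε ∎)
      where
      neg : ∀ i → (+ suc n) ℤ.* i ≡ -1ℤ ℤ.* (-[1+ n ] ℤ.* i)
      neg i = ≡.trans (≡.cong (ℤ._* i) (≡.sym (ℤ.-1*i≡-i -[1+ n ]))) (ℤ.*-assoc -1ℤ -[1+ n ] i)

    ∈⇒⟦⟧ : ∀ {g} → A g → Σ Vector λ u → g ≈ ⟦ u ⟧
    ∈⇒⟦⟧ = ⟨,⟩-least sub ((1ℤ , 0ℤ) , solve 1 (λ a → a ⊜ a ⊙ ι ⊙ ι) refl a)
                        ((0ℤ , 1ℤ) , solve 1 (λ b → b ⊜ ι ⊙ (b ⊙ ι)) refl b)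
      where
      sub : IsSubgroup (λ g → Σ Vector λ u → g ≈ ⟦ u ⟧)
      sub = record
        { ε∈  = (0ℤ , 0ℤ) , sym ⟦⟧-0
        ; ∙∈  = λ { (u , p) (v , q) → u ⊕ v , trans (∙-cong p q) (sym (⟦⟧-⊕ u v)) }
        ; ⁻¹∈ = λ { (u , p) → -1ℤ · u , trans (⁻¹-cong p) (sym (⟦⟧-neg u)) }
        ; ≈∈  = λ { e (u , p) → u , trans (sym e) p }
        }

    N : Carrier → Carrier
    N g = [ g , t ]

    N-expand : ∀ g → N g ≈ g ⁻¹ ∙ conj t g
    N-expand g = solve 2 (λ g t → g ⁻ ⊙ t ⁻ ⊙ g ⊙ t ⊜ g ⁻ ⊙ (t ⁻ ⊙ g ⊙ t)) refl g t

    N-∈ : ∀ {g} → A g → A (N g)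
    N-∈ p = resp (sym (N-expand _)) (mul (inv p) (conj∈ p))

    N-∙ : ∀ {g h} → A g → A h → N (g ∙ h) ≈ N g ∙ N h
    N-∙ {g} {h} p q = begin
      N (g ∙ h) ≈⟨ solve 3 (λ g h t → (g ⊙ h) ⁻ ⊙ t ⁻ ⊙ (g ⊙ h) ⊙ t
                                    ⊜ h ⁻ ⊙ (g ⁻ ⊙ t ⁻ ⊙ g ⊙ t) ⊙ (h ⊙ (h ⁻ ⊙ t ⁻ ⊙ h ⊙ t))) refl g h t ⟩
      h ⁻¹ ∙ N g ∙ (h ∙ N h) ≈⟨ ∙-congʳ (abelian (inv q) (N-∈ p)) ⟩
      N g ∙ h ⁻¹ ∙ (h ∙ N h) ≈⟨ solve 3 (λ x h y → x ⊙ h ⁻ ⊙ (h ⊙ y) ⊜ x ⊙ y) refl (N g) h (N h) ⟩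
      N g ∙ N h ∎

    N-cong : ∀ {g h} → g ≈ h → N g ≈ N h
    N-cong e = commutator-cong e refl

    N-ε : N ε ≈ ε
    N-ε = solve 1 (λ t → ι ⁻ ⊙ t ⁻ ⊙ ι ⊙ t ⊜ ι) refl t

    N-⁻¹ : ∀ {g} → A g → N (g ⁻¹) ≈ N g ⁻¹
    N-⁻¹ {g} p = begin
      N (g ⁻¹)                   ≈⟨ solve 2 (λ x y → y ⊜ x ⁻ ⊙ (x ⊙ y)) refl (N g) _ ⟩
      N g ⁻¹ ∙ (N g ∙ N (g ⁻¹))  ≈⟨ ∙-congˡ (N-∙ p (inv p)) ⟨
      N g ⁻¹ ∙ N (g ∙ g ⁻¹)      ≈⟨ ∙-congˡ (trans (N-cong (inverseʳ g)) N-ε) ⟩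
      N g ⁻¹ ∙ ε                 ≈⟨ identityʳ _ ⟩
      N g ⁻¹                     ∎

    private
      Na = ∈⇒⟦⟧ (N-∈ genˡ)
      Nb = ∈⇒⟦⟧ (N-∈ genʳ)
      p = proj₁ (proj₁ Na)
      q = proj₂ (proj₁ Na)
      r = proj₁ (proj₁ Nb)
      s = proj₂ (proj₁ Nb)

    open LinearMap p q r s

    N-⟦⟧ : ∀ u → N ⟦ u ⟧ ≈ ⟦ M u ⟧
    N-⟦⟧ (i , j) = begin
      N (a ^ i ∙ b ^ j)                  ≈⟨ N-∙ (^-∈ A-sub genˡ i) (^-∈ A-sub genʳ j) ⟩
      N (a ^ i) ∙ N (b ^ j)              ≈⟨ ∙-cong (N-^ genˡ (proj₂ Na) i) (N-^ genʳ (proj₂ Nb) j) ⟩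
      ⟦ i · (p , q) ⟧ ∙ ⟦ j · (r , s) ⟧  ≈⟨ ⟦⟧-⊕ (i · (p , q)) (j · (r , s)) ⟨
      ⟦ M (i , j) ⟧                      ∎
      where
      N-^ⁿ : ∀ {g u} → A g → N g ≈ ⟦ u ⟧ → ∀ n → N (g ^ⁿ n) ≈ ⟦ (+ n) · u ⟧
      N-^ⁿ {g} {u} x e n = trans (go n) (sym (⟦⟧-· n u))
        where
        go : ∀ n → N (g ^ⁿ n) ≈ ⟦ u ⟧ ^ⁿ n
        go zero    = N-ε
        go (suc n) = trans (N-∙ x (^ⁿ-∈ A-sub x n)) (∙-cong e (go n))
      N-^ : ∀ {g u} → A g → N g ≈ ⟦ u ⟧ → ∀ i → N (g ^ i) ≈ ⟦ i · u ⟧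
      N-^ x e (+ n) = N-^ⁿ x e n
      N-^ {g} {u} x e -[1+ n ] = begin
        N (g ^ -[1+ n ])          ≈⟨ N-⁻¹ (^ⁿ-∈ A-sub x (suc n)) ⟩
        N (g ^ⁿ suc n) ⁻¹         ≈⟨ ⁻¹-cong (N-^ⁿ {u = u} x e (suc n)) ⟩
        ⟦ (+ suc n) · u ⟧ ⁻¹      ≈⟨ ⟦⟧-neg ((+ suc n) · u) ⟨
        ⟦ -1ℤ · ((+ suc n) · u) ⟧ ≡⟨ ≡.cong ⟦_⟧ (≡.cong₂ _,_ (neg (proj₁ u)) (neg (proj₂ u))) ⟩
        ⟦ -[1+ n ] · u ⟧          ∎
        where
        neg : ∀ i → -1ℤ ℤ.* ((+ suc n) ℤ.* i) ≡ -[1+ n ] ℤ.* i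
        neg i = ≡.trans (≡.sym (ℤ.*-assoc -1ℤ (+ suc n) i)) (≡.cong (ℤ._* i) (ℤ.-1*i≡-i (+ suc n)))

    private
      kernel-M : ∀ u → ⟦ u ⟧ ≈ ε → ⟦ M u ⟧ ≈ ε
      kernel-M u e = trans (sym (N-⟦⟧ u)) (trans (N-cong e) N-ε)

      kernel-⊕ : ∀ u v → ⟦ u ⟧ ≈ ε → ⟦ v ⟧ ≈ ε → ⟦ u ⊕ v ⟧ ≈ ε
      kernel-⊕ u v e e′ = trans (⟦⟧-⊕ u v) (trans (∙-cong e e′) (identityˡ ε))

      kernel-d : ∀ u → ⟦ M u ⟧ ≈ ε → ⟦ d · u ⟧ ≈ ε
      kernel-d u e = trans (reflexive (≡.cong ⟦_⟧ (cayley-hamilton u)))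
        (kernel-⊕ (τ · M u) (-1ℤ · M (M u)) (⟦⟧-kernel τ (M u) e)
          (⟦⟧-kernel -1ℤ (M (M u)) (kernel-M (M u) e)))

      kernel-τ : d ≡ 0ℤ → ∀ u → ⟦ M (M u) ⟧ ≈ ⟦ τ · M u ⟧
      kernel-τ d≡0 u = begin
        ⟦ M (M u) ⟧                        ≡⟨ ≡.cong ⟦_⟧ (cayley-hamilton′ u) ⟩
        ⟦ (τ · M u) ⊕ (-1ℤ · (d · u)) ⟧    ≈⟨ ⟦⟧-⊕ (τ · M u) (-1ℤ · (d · u)) ⟩
        ⟦ τ · M u ⟧ ∙ ⟦ -1ℤ · (d · u) ⟧    ≡⟨ ≡.cong (λ z → ⟦ τ · M u ⟧ ∙ ⟦ -1ℤ · (z · u) ⟧) d≡0 ⟩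
        ⟦ τ · M u ⟧ ∙ ⟦ -1ℤ · (0ℤ · u) ⟧   ≈⟨ ∙-congˡ (⟦⟧-kernel -1ℤ (0ℤ · u) (⟦⟧-· 0 u)) ⟩
        ⟦ τ · M u ⟧ ∙ ε                    ≈⟨ identityʳ _ ⟩
        ⟦ τ · M u ⟧                        ∎

      -- The generators may be dependent, so `M` is determined only modulo the kernel of `⟦_⟧` and
      -- need not be a nilpotent matrix. That kernel is pure because the group is torsion-free.
      -- Modulo it, a nonzero determinant `d` can be cancelled, which lowers the exponent; if d = 0
      -- then M² = τM, and either `τ` can be cancelled or M² vanishes at once.
      descend : Dec (d ≡ 0ℤ) → Dec (τ ≡ 0ℤ) →
                ∀ n u → ⟦ Mⁿ (suc (suc n)) u ⟧ ≈ ε → ⟦ M (M u) ⟧ ≈ ε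
      descend _ _ zero u e = e
      descend (no d≢0) τ? (suc n) u e = descend (no d≢0) τ? n u
        (⟦⟧-cancel d (Mⁿ (suc (suc n)) u) d≢0 (kernel-d (Mⁿ (suc (suc n)) u) e))
      descend (yes d≡0) (no τ≢0) (suc n) u e = descend (yes d≡0) (no τ≢0) n u
        (⟦⟧-cancel τ (Mⁿ (suc (suc n)) u) τ≢0 (trans (sym (kernel-τ d≡0 (Mⁿ (suc n) u))) e))
      descend (yes d≡0) (yes τ≡0) (suc n) u e = trans (kernel-τ d≡0 u)
        (trans (reflexive (≡.cong (λ z → ⟦ z · M u ⟧) τ≡0)) (⟦⟧-· 0 (M u)))

      γ-Mⁿ : ∀ n u → γ Whole n ⟦ Mⁿ n u ⟧
      γ-Mⁿ zero    u = tt
      γ-Mⁿ (suc n) u = gen (_ , t , γ-Mⁿ n u , tt , sym (N-⟦⟧ (Mⁿ n u)))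

    -- N is a nilpotent endomorphism of a torsion-free abelian group of rank at most 2.
    N-N-trivial : Nilpotent Whole → ∀ {g} → A g → N (N g) ≈ ε
    N-N-trivial (k , trivial) {g} g∈ with ∈⇒⟦⟧ g∈
    ... | u , e = begin
      N (N g)       ≈⟨ N-cong (N-cong e) ⟩
      N (N ⟦ u ⟧)   ≈⟨ N-cong (N-⟦⟧ u) ⟩
      N ⟦ M u ⟧     ≈⟨ N-⟦⟧ (M u) ⟩
      -- The series gives triviality at exponent `k`; two further applications of `M` reach the form
      -- k + 2 that `descend` expects, even for k = 0.
      ⟦ M (M u) ⟧   ≈⟨ descend (d ℤ.≟ 0ℤ) (τ ℤ.≟ 0ℤ) k u (kernel-M (Mⁿ (suc k) u) (kernel-M (Mⁿ k u) (trivial (γ-Mⁿ k u)))) ⟩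
      ε             ∎

    -- The kernel of `N` in the abelian group ⟨a, b⟩, hence central in ⟨a, b, t⟩. Since N² is
    -- trivial, it contains the image of `N` and thereby all commutators.
    Z : Pred
    Z g = A g × g ⟷ t

    class≤2 : Nilpotent Whole → ∀ {H : Pred} → (∀ {g} → H g → ⟨ a ,, b ,, t ⟩ g) →
              NilpotentOfClassAtMost 2 H
    class≤2 nilpotent {H} H⊆ = γ₂-trivial
      where
      Z-sub : IsSubgroup Z
      Z-sub = record
        { ε∈  = unit , ε∈ (centralizer-isSubgroup t)
        ; ∙∈  = λ { (x , y) (x′ , y′) → mul x x′ , ∙∈ (centralizer-isSubgroup t) y y′ }
        ; ⁻¹∈ = λ { (x , y) → inv x , ⁻¹∈ (centralizer-isSubgroup t) y }
        ; ≈∈  = λ { e (x , y) → resp e x , ≈∈ (centralizer-isSubgroup t) e y }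
        }

      Z-central-gen : ∀ {z s} → Z z → Mem (a ∷ b ∷ t ∷ []) s → z ⟷ s
      Z-central-gen (x , y) m with generators m
      ... | inj₁ s∈ = abelian x s∈
      ... | inj₂ e  = trans (∙-congˡ e) (trans y (∙-congʳ (sym e)))

      Z-central : ∀ {z h} → Z z → ⟨ a ,, b ,, t ⟩ h → z ⟷ h
      Z-central z∈ h∈ = ⟷-sym (⟨⟩-⟷ (λ m → ⟷-sym (Z-central-gen z∈ m)) h∈)

      Z-conj : ∀ {s g} → Mem (a ∷ b ∷ t ∷ []) s → Z g → Z (conj s g)
      Z-conj m z∈ = ≈∈ Z-sub (sym (conj-fixed (Z-central-gen z∈ m))) z∈

      Z-conj⁻ : ∀ {s g} → Mem (a ∷ b ∷ t ∷ []) s → Z g → Z (conj (s ⁻¹) g)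
      Z-conj⁻ m z∈ = ≈∈ Z-sub (sym (conj-fixed (Z-central z∈ (inv (gen m))))) z∈

      N-Z : ∀ {g} → A g → Z (N g)
      N-Z {g} g∈ = N-∈ g∈ , (begin
        N g ∙ t                          ≈⟨ solve 2 (λ x t → x ⊙ t ⊜ t ⊙ x ⊙ (x ⁻ ⊙ t ⁻ ⊙ x ⊙ t)) refl (N g) t ⟩
        t ∙ N g ∙ N (N g)                ≈⟨ ∙-congˡ (N-N-trivial nilpotent g∈) ⟩
        t ∙ N g ∙ ε                      ≈⟨ identityʳ _ ⟩
        t ∙ N g                          ∎)

      Z-commutator : ∀ {s s′} → Mem (a ∷ b ∷ t ∷ []) s → Mem (a ∷ b ∷ t ∷ []) s′ → Z [ s , s′ ]
      Z-commutator {s} {s′} m m′ with generators m | generators m′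
      ... | inj₁ x | inj₁ x′ = ≈∈ Z-sub (sym (commutator-⟷ (abelian x x′))) (ε∈ Z-sub)
      ... | inj₁ x | inj₂ e  = ≈∈ Z-sub (commutator-cong refl (sym e)) (N-Z x)
      ... | inj₂ e | inj₁ x′ = ≈∈ Z-sub
        (trans (solve 2 (λ s t → (s ⁻ ⊙ t ⁻ ⊙ s ⊙ t) ⁻ ⊜ t ⁻ ⊙ s ⁻ ⊙ t ⊙ s) refl s′ t)
               (commutator-cong (sym e) refl)) (⁻¹∈ Z-sub (N-Z x′))
      ... | inj₂ e | inj₂ e′ = ≈∈ Z-sub
        (sym (commutator-⟷ (trans (∙-cong e e′) (sym (∙-cong e′ e))))) (ε∈ Z-sub)

      γ⊆Z : ∀ {g} → γ H 1 g → Z g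
      γ⊆Z = derived⊆ Z-sub λ g∈ h∈ →
        CommutatorClosure.commutator∈ Z-sub Z-conj Z-conj⁻ Z-commutator (H⊆ g∈) (H⊆ h∈)

      γ₂-trivial : ∀ {g} → γ H 2 g → g ≈ ε
      γ₂-trivial = ⟨⟩-least ε-sub λ { (_ , _ , x∈ , y∈ , e) → trans e (commutator-⟷ (Z-central (γ⊆Z x∈) (H⊆ y∈))) }

-- Ordered groups

-- Reversing products exchanges XZ and ZX but keeps the order, so the same increasing sequence can
-- be used in both groups.
opposite : ∀ {c ℓ ℓ₂} → OrderedGroup c ℓ ℓ₂ → OrderedGroup c ℓ ℓ₂
opposite G = record
  { group        = Op.group group
  ; _≤_          = _≤_
  ; isTotalOrder = isTotalOrder
  ; compatible   = λ x y a≤b →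
      IsTotalOrder.trans isTotalOrder (≤-reflexive (sym (assoc y _ x)))
        (IsTotalOrder.trans isTotalOrder (compatible y x a≤b) (≤-reflexive (assoc y _ x)))
  }
  where
  open OrderedGroup G
  ≤-reflexive = IsTotalOrder.reflexive isTotalOrder

module OrderTheory {c ℓ ℓ₂} (G : OrderedGroup c ℓ ℓ₂) where
  open OrderedGroup G renaming (_≤_ to infix 4 _≤_)
  open GroupNotions group
  open Subgroups group
  open Nilpotency group using (_^ⁿ_)
  open GroupProperties group using (∙-cancelˡ; ∙-cancelʳ)
  open GroupSolver group using (solve; _⊜_; _⊙_; _⁻)
  open IsTotalOrder isTotalOrder public using (total; antisym; isPartialOrder)
    renaming (trans to ≤-trans; reflexive to ≤-reflexive; refl to ≤-refl)

  poset : Poset c ℓ ℓ₂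
  poset = record { isPartialOrder = isPartialOrder }

  open ToStrict _≈_ _≤_ public using () renaming (_<_ to infix 4 _<_)
  open PosetReasoning poset public

  private module < = ToStrict _≈_ _≤_
  open IsPartialOrder isPartialOrder using (≤-respˡ-≈; ≤-respʳ-≈)

  <-trans : ∀ {a b d} → a < b → b < d → a < d
  <-trans = <.<-trans isPartialOrder

  <-≤-trans : ∀ {a b d} → a < b → b ≤ d → a < d
  <-≤-trans = <.<-≤-trans sym ≤-trans antisym ≤-respʳ-≈

  ≤-<-trans : ∀ {a b d} → a ≤ b → b < d → a < d
  ≤-<-trans = <.≤-<-trans ≤-trans antisym ≤-respˡ-≈

  <-irrefl : ∀ {a b} → a ≈ b → a < b → ⊥
  <-irrefl p (_ , q) = q p

  <⇒≤ : ∀ {a b} → a < b → a ≤ b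
  <⇒≤ = proj₁

  <⇒≱ : ∀ {a b} → a < b → b ≤ a → ⊥
  <⇒≱ a<b b≤a = <-irrefl refl (<-≤-trans a<b b≤a)

  ∙-monoˡ-≤ : ∀ g {a b} → a ≤ b → a ∙ g ≤ b ∙ g
  ∙-monoˡ-≤ g p = ≤-trans (≤-reflexive (sym (∙-congʳ (identityˡ _))))
    (≤-trans (compatible ε g p) (≤-reflexive (∙-congʳ (identityˡ _))))

  ∙-monoʳ-≤ : ∀ g {a b} → a ≤ b → g ∙ a ≤ g ∙ b
  ∙-monoʳ-≤ g p = ≤-trans (≤-reflexive (sym (identityʳ _)))
    (≤-trans (compatible g ε p) (≤-reflexive (identityʳ _)))

  ∙-monoˡ-< : ∀ g {a b} → a < b → a ∙ g < b ∙ g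
  ∙-monoˡ-< g (p , q) = ∙-monoˡ-≤ g p , λ e → q (∙-cancelʳ g _ _ e)

  ∙-monoʳ-< : ∀ g {a b} → a < b → g ∙ a < g ∙ b
  ∙-monoʳ-< g (p , q) = ∙-monoʳ-≤ g p , λ e → q (∙-cancelˡ g _ _ e)

  ∙-mono-≤ : ∀ {a b d f} → a ≤ b → d ≤ f → a ∙ d ≤ b ∙ f
  ∙-mono-≤ p q = ≤-trans (∙-monoˡ-≤ _ p) (∙-monoʳ-≤ _ q)

  ∙-mono-<-≤ : ∀ {a b d f} → a < b → d ≤ f → a ∙ d < b ∙ f
  ∙-mono-<-≤ p q = <-≤-trans (∙-monoˡ-< _ p) (∙-monoʳ-≤ _ q)

  ∙-mono-≤-< : ∀ {a b d f} → a ≤ b → d < f → a ∙ d < b ∙ f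
  ∙-mono-≤-< p q = ≤-<-trans (∙-monoˡ-≤ _ p) (∙-monoʳ-< _ q)

  ∙-mono-< : ∀ {a b d f} → a < b → d < f → a ∙ d < b ∙ f
  ∙-mono-< p q = ∙-mono-<-≤ p (<⇒≤ q)

  Distinct : List Carrier → Set (c ⊔ ℓ)
  Distinct = AllPairs (λ g h → ¬ g ≈ h)

  square-injective : ∀ {g h} → g ∙ g ≈ h ∙ h → g ≈ h
  square-injective {g} {h} e with total g h
  ... | inj₁ g≤h = ∙-cancelˡ g _ _ (antisym (∙-monoʳ-≤ g g≤h)
          (≤-trans (∙-monoˡ-≤ h g≤h) (≤-reflexive (sym e))))
  ... | inj₂ h≤g = sym (∙-cancelˡ h _ _ (antisym (∙-monoʳ-≤ h h≤g)
          (≤-trans (∙-monoˡ-≤ g h≤g) (≤-reflexive e))))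

  -- The conjugate of `g` by `h` has the same square as `g`, and square roots are unique in an
  -- ordered group.
  square-⟷ : ∀ {g h} → g ∙ g ⟷ h → g ⟷ h
  square-⟷ {g} {h} e = begin-equality
    g ∙ h              ≈⟨ solve 2 (λ g h → g ⊙ h ⊜ h ⊙ (h ⁻ ⊙ g ⊙ h)) refl g h ⟩
    h ∙ conj h g       ≈⟨ ∙-congˡ (square-injective (trans (sym (conj-∙ h g g)) (conj-fixed e))) ⟩
    h ∙ g              ∎

  conj-mono-< : ∀ t {g h} → g < h → conj t g < conj t h
  conj-mono-< t p = ∙-monoˡ-< t (∙-monoʳ-< (t ⁻¹) p)

  torsion-free : ∀ {g} n → g ^ⁿ suc n ≈ ε → g ≈ ε
  torsion-free {g} n e with total g ε
  ... | inj₁ g≤ε = antisym g≤ε (begin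
          ε            ≈⟨ e ⟨
          g ∙ g ^ⁿ n   ≤⟨ ∙-monoʳ-≤ g (power n) ⟩
          g ∙ ε        ≈⟨ identityʳ g ⟩
          g            ∎)
    where
    power : ∀ n → g ^ⁿ n ≤ ε
    power zero    = ≤-refl
    power (suc n) = ≤-trans (∙-mono-≤ g≤ε (power n)) (≤-reflexive (identityˡ ε))
  ... | inj₂ ε≤g = antisym (begin
          g            ≈⟨ identityʳ g ⟨
          g ∙ ε        ≤⟨ ∙-monoʳ-≤ g (power n) ⟩
          g ∙ g ^ⁿ n   ≈⟨ e ⟩
          ε            ∎) ε≤g
    where
    power : ∀ n → ε ≤ g ^ⁿ n
    power zero    = ≤-refl
    power (suc n) = ≤-trans (≤-reflexive (sym (identityˡ ε))) (∙-mono-≤ ε≤g (power n))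

Increasing : ∀ {c ℓ ℓ₂} (G : OrderedGroup c ℓ ℓ₂) → (ℕ → OrderedGroup.Carrier G) → Set (ℓ ⊔ ℓ₂)
Increasing G x = ∀ i → x i < x (suc i)
  where open OrderTheory G

-- Deleting the largest element

descending : ∀ {ℓ} (P : ℕ → Set ℓ) m →
             (∀ j → j ℕ.≤ m → (∀ k → j ℕ.< k → k ℕ.≤ m → P k) → P j) →
             ∀ j → j ℕ.≤ m → P j
descending P m step j j≤m = go m j j≤m (ℕ.m≤n+m m j)
  where
  go : ∀ fuel j → j ℕ.≤ m → m ℕ.≤ j + fuel → P j
  go zero j j≤m m≤ = step j j≤m λ k j<k k≤m →
    ⊥-elim (ℕ.<⇒≱ j<k (ℕ.≤-trans k≤m (≡.subst (m ℕ.≤_) (ℕ.+-identityʳ j) m≤)))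
  go (suc f) j j≤m m≤ = step j j≤m λ k j<k k≤m →
    go f k k≤m (ℕ.≤-trans m≤ (≡.subst (ℕ._≤ k + f) (≡.sym (ℕ.+-suc j f)) (ℕ.+-monoˡ-≤ f j<k)))

module Sequence {c ℓ ℓ₂} (G : OrderedGroup c ℓ ℓ₂)
  (x : ℕ → OrderedGroup.Carrier G)
  (x-step : Increasing G x) where

  open OrderedGroup G renaming (_≤_ to infix 4 _≤_)
  open OrderTheory G
  open GroupNotions group
  open Subgroups group
  open IsSubgroup
  open GroupSolver group using (solve; _⊜_; _⊙_; _⁻)
  open import Algebra.Properties.Group group using (∙-cancelˡ; ∙-cancelʳ)

  x-< : ∀ {i j} → i ℕ.< j → x i < x j
  x-< {i} {suc j} (s≤s i≤j) with ℕ.m≤n⇒m<n∨m≡n i≤j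
  ... | inj₁ i<j    = <-trans (x-< i<j) (x-step j)
  ... | inj₂ ≡.refl = x-step i

  x-≤ : ∀ {i j} → i ℕ.≤ j → x i ≤ x j
  x-≤ i≤j with ℕ.m≤n⇒m<n∨m≡n i≤j
  ... | inj₁ i<j    = <⇒≤ (x-< i<j)
  ... | inj₂ ≡.refl = ≤-refl

  x-injective : ∀ {i j} → x i ≈ x j → i ≡ j
  x-injective {i} {j} p with ℕ.<-cmp i j
  ... | tri< i<j _ _ = ⊥-elim (<-irrefl p (x-< i<j))
  ... | tri≈ _ i≡j _ = i≡j
  ... | tri> _ _ j<i = ⊥-elim (<-irrefl (sym p) (x-< j<i))

  -- The square of S_k = {x₀ < … < x_{k−1}}.
  Old : ℕ → Carrier → Set ℓ
  Old k u = Σ ℕ λ a → Σ ℕ λ b → a ℕ.< k × b ℕ.< k × u ≈ x a ∙ x b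

  -- If the larger of xⱼX and Xxⱼ is old, where X = x_k, then both of its factors exceed xⱼ.
  Above : ℕ → ℕ → Carrier → Set ℓ
  Above j k u = Σ ℕ λ a → Σ ℕ λ b → (j ℕ.< a × a ℕ.< k) × (j ℕ.< b × b ℕ.< k) × u ≈ x a ∙ x b

  Old-≤ : ∀ {k u} → Old (suc k) u → u ≤ x k ∙ x k
  Old-≤ (_ , _ , s≤s a≤ , s≤s b≤ , e) = ≤-trans (≤-reflexive e) (∙-mono-≤ (x-≤ a≤) (x-≤ b≤))

  largerˡ : ∀ {j k} → x k ∙ x j ≤ x j ∙ x k → Old k (x j ∙ x k) → Above j k (x j ∙ x k)
  largerˡ {j} {k} le (a , b , a<k , b<k , e) =
    a , b , (ℕ.≰⇒> a≰j , a<k) , (ℕ.≰⇒> b≰j , b<k) , e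
    where
    a≰j : ¬ a ℕ.≤ j
    a≰j a≤j = <-irrefl (sym e) (∙-mono-≤-< (x-≤ a≤j) (x-< b<k))
    b≰j : ¬ b ℕ.≤ j
    b≰j b≤j = <-irrefl (sym e) (<-≤-trans (∙-mono-<-≤ (x-< a<k) (x-≤ b≤j)) le)

  largerʳ : ∀ {j k} → x j ∙ x k ≤ x k ∙ x j → Old k (x k ∙ x j) → Above j k (x k ∙ x j)
  largerʳ {j} {k} le (a , b , a<k , b<k , e) =
    a , b , (ℕ.≰⇒> a≰j , a<k) , (ℕ.≰⇒> b≰j , b<k) , e
    where
    a≰j : ¬ a ℕ.≤ j
    a≰j a≤j = <-irrefl (sym e) (<-≤-trans (∙-mono-≤-< (x-≤ a≤j) (x-< b<k)) le)
    b≰j : ¬ b ℕ.≤ j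
    b≰j b≤j = <-irrefl (sym e) (∙-mono-<-≤ (x-< a<k) (x-≤ b≤j))

  module _ {p} {Q : Carrier → Set p} (sub : IsSubgroup Q) where

    cancelˡ-∈ : ∀ {g h} → Q g → Q (g ∙ h) → Q h
    cancelˡ-∈ {g} {h} q r =
      ≈∈ sub (solve 2 (λ g h → g ⁻ ⊙ (g ⊙ h) ⊜ h) refl g h) (∙∈ sub (⁻¹∈ sub q) r)

    cancelʳ-∈ : ∀ {g h} → Q h → Q (g ∙ h) → Q g
    cancelʳ-∈ {g} {h} q r =
      ≈∈ sub (solve 2 (λ g h → g ⊙ h ⊙ h ⁻ ⊜ g) refl g h) (∙∈ sub r (⁻¹∈ sub q))

    Above-∈ : ∀ {j k u} → (∀ a → j ℕ.< a → a ℕ.< k → Q (x a)) → Above j k u → Q u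
    Above-∈ on (a , b , (j<a , a<k) , (j<b , b<k) , e) =
      ≈∈ sub (sym e) (∙∈ sub (on a j<a a<k) (on b j<b b<k))

  record Structure (k : ℕ) : Set (c ⊔ ℓ) where
    field
      {a b t}   : Carrier
      split     : Split a b t
      generated : ∀ j → j ℕ.< k → ⟨ a ,, b ,, t ⟩ (x j)

  -- The two types of sets x₀ < … < Y < X whose square loses at most three elements with X: besides
  -- X², XY and YX there is room for one more value v only if XY = YX.
  record PeelA (p : ℕ) : Set ℓ where
    X = x (suc p)
    Y = x p
    field
      noncommuting : ¬ X ⟷ Y
      left  : ∀ j → j ℕ.< p → Old (suc p) (x j ∙ X) ⊎ x j ∙ X ≈ X ∙ Y
      right : ∀ j → j ℕ.< p → Old (suc p) (X ∙ x j) ⊎ X ∙ x j ≈ Y ∙ X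

  record PeelB (p : ℕ) : Set (c ⊔ ℓ) where
    X = x (suc p)
    Y = x p
    field
      commuting : X ⟷ Y
      v         : Carrier
      left  : ∀ j → j ℕ.< p → Old (suc p) (x j ∙ X) ⊎ x j ∙ X ≈ v
      right : ∀ j → j ℕ.< p → Old (suc p) (X ∙ x j) ⊎ X ∙ x j ≈ v

  generated-by-top : ∀ {p q} {Q : Carrier → Set q} → IsSubgroup Q → Q (x (suc p)) → Q (x p) →
    (∀ j → j ℕ.< p → Old (suc p) (x j ∙ x (suc p)) ⊎ Q (x j ∙ x (suc p))) →
    (∀ j → j ℕ.< p → Old (suc p) (x (suc p) ∙ x j) ⊎ Q (x (suc p) ∙ x j)) →
    ∀ j → j ℕ.≤ suc p → Q (x j)
  generated-by-top {p} {_} {Q} sub QX QY left right = descending (λ j → Q (x j)) (suc p) step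
    where
    step : ∀ j → j ℕ.≤ suc p → (∀ k → j ℕ.< k → k ℕ.≤ suc p → Q (x k)) → Q (x j)
    step j j≤ ih with ℕ.m≤n⇒m<n∨m≡n j≤
    ... | inj₂ ≡.refl = QX
    ... | inj₁ (s≤s j≤p) with ℕ.m≤n⇒m<n∨m≡n j≤p
    ...   | inj₂ ≡.refl = QY
    ...   | inj₁ j<p with total (x (suc p) ∙ x j) (x j ∙ x (suc p))
    ...     | inj₁ le = cancelʳ-∈ sub QX ([ (λ old → Above-∈ sub above (largerˡ le old)) , (λ q → q) ]′ (left j j<p))
      where
      above : ∀ a → j ℕ.< a → a ℕ.< suc p → Q (x a)
      above a j<a a< = ih a j<a (ℕ.<⇒≤ a<)
    ...     | inj₂ le = cancelˡ-∈ sub QX ([ (λ old → Above-∈ sub above (largerʳ le old)) , (λ q → q) ]′ (right j j<p))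
      where
      above : ∀ a → j ℕ.< a → a ℕ.< suc p → Q (x a)
      above a j<a a< = ih a j<a (ℕ.<⇒≤ a<)

  PeelA-generated : ∀ {p q} → PeelA p → {Q : Carrier → Set q} → IsSubgroup Q →
                    Q (x (suc p)) → Q (x p) → ∀ j → j ℕ.≤ suc p → Q (x j)
  PeelA-generated peel sub QX QY = generated-by-top sub QX QY
    (λ j j<p → map₂ (λ e → ≈∈ sub (sym e) (∙∈ sub QX QY)) (left j j<p))
    (λ j j<p → map₂ (λ e → ≈∈ sub (sym e) (∙∈ sub QY QX)) (right j j<p))
    where open PeelA peel

  CommAbove : ℕ → ℕ → Set ℓ
  CommAbove i m = ∀ a b → i ℕ.< a → a ℕ.≤ m → i ℕ.< b → b ℕ.≤ m → x a ⟷ x b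

  -- The largest index i such that t = xᵢ does not commute with everything above it.
  module PeelB-Analysis {p} (peel : PeelB p) {i} (i<p : i ℕ.< p) (above : CommAbove i (suc p))
    {l} (i<l : i ℕ.< l) (l≤ : l ℕ.≤ suc p) (noncommuting : ¬ x i ⟷ x l) where

    open PeelB peel

    t : Carrier
    t = x i

    A : Pred
    A = ⟨ X ,, Y ⟩

    private
      Cl : IsSubgroup (_⟷ x l)
      Cl = centralizer-isSubgroup (x l)

      above-Cl : ∀ a → i ℕ.< a → a ℕ.≤ suc p → x a ⟷ x l
      above-Cl a i<a a≤ = above a l i<a a≤ i<l l≤

      X-Cl : X ⟷ x l
      X-Cl = above-Cl (suc p) (ℕ.m≤n⇒m≤1+n i<p) ℕ.≤-refl

      ≢t : ∀ {j} → ¬ j ≡ i → x j ≈ t → ⊥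
      ≢t j≢i e = j≢i (x-injective e)

    -- Otherwise this larger product would be a product of elements above `t`. These all commute
    -- with x_l, and so does X; hence `t` would commute with x_l as well.
    vˡ : X ∙ t ≤ t ∙ X → t ∙ X ≈ v
    vˡ le with left i i<p
    ... | inj₂ e   = e
    ... | inj₁ old = ⊥-elim (noncommuting (cancelʳ-∈ Cl X-Cl
            (Above-∈ Cl (λ a i<a a< → above-Cl a i<a (ℕ.<⇒≤ a<)) (largerˡ le old))))

    vʳ : t ∙ X ≤ X ∙ t → X ∙ t ≈ v
    vʳ le with right i i<p
    ... | inj₂ e   = e
    ... | inj₁ old = ⊥-elim (noncommuting (cancelˡ-∈ Cl X-Cl
            (Above-∈ Cl (λ a i<a a< → above-Cl a i<a (ℕ.<⇒≤ a<)) (largerʳ le old))))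

    -- The exceptional value `v` is already taken by a product of `t` with X. An x_j above `t`
    -- commutes with X, so if its product with X were `v`, cancelling X would give x_j = t. The
    -- product is therefore old, with both factors above x_j.
    above∈A : ∀ j → i ℕ.< j → j ℕ.≤ suc p → A (x j)
    above∈A j i<j j≤ = descending (λ j → i ℕ.< j → A (x j)) (suc p) step j j≤ i<j
      where
      step : ∀ j → j ℕ.≤ suc p → (∀ k → j ℕ.< k → k ℕ.≤ suc p → i ℕ.< k → A (x k)) →
             i ℕ.< j → A (x j)
      step j j≤ ih i<j with ℕ.m≤n⇒m<n∨m≡n j≤
      ... | inj₂ ≡.refl = genˡ
      ... | inj₁ (s≤s j≤p) with ℕ.m≤n⇒m<n∨m≡n j≤p
      ...   | inj₂ ≡.refl = genʳ
      ...   | inj₁ j<p = cancelʳ-∈ ⟨⟩-isSubgroup genˡ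
          (Above-∈ ⟨⟩-isSubgroup (λ a j<a a< → ih a j<a (ℕ.<⇒≤ a<) (ℕ.<-trans i<j j<a))
            (largerˡ (≤-reflexive (sym comm)) old))
        where
        comm : x j ⟷ X
        comm = above j (suc p) i<j j≤ (ℕ.m≤n⇒m≤1+n i<p) ℕ.≤-refl
        not-v : x j ∙ X ≈ v → ⊥
        not-v e with total (X ∙ t) (t ∙ X)
        ... | inj₁ le = ≢t (λ j≡i → ℕ.<⇒≢ i<j (≡.sym j≡i)) (∙-cancelʳ X _ _ (trans e (sym (vˡ le))))
        ... | inj₂ le = ≢t (λ j≡i → ℕ.<⇒≢ i<j (≡.sym j≡i)) (∙-cancelˡ X _ _ (trans (sym comm) (trans e (sym (vʳ le)))))
        old : Old (suc p) (x j ∙ X)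
        old with left j j<p
        ... | inj₁ o = o
        ... | inj₂ e = ⊥-elim (not-v e)

    -- Below `t` the larger product of x_j with X may equal `v`. On the side on which `t` attains
    -- `v` this would force x_j = t; on the other side it expresses x_j through X and `t`.
    generated : ∀ j → j ℕ.≤ suc p → ⟨ X ,, Y ,, t ⟩ (x j)
    generated = descending (λ j → ⟨ X ,, Y ,, t ⟩ (x j)) (suc p) step
      where
      sub : IsSubgroup ⟨ X ,, Y ,, t ⟩
      sub = ⟨⟩-isSubgroup
      step : ∀ j → j ℕ.≤ suc p → (∀ k → j ℕ.< k → k ℕ.≤ suc p → ⟨ X ,, Y ,, t ⟩ (x k)) →
             ⟨ X ,, Y ,, t ⟩ (x j)
      step j j≤ ih with ℕ.<-cmp i j
      ... | tri< i<j _ _ = ⟨,⟩-least ⟨⟩-isSubgroup gen₁ gen₂ (above∈A j i<j j≤)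
      ... | tri≈ _ ≡.refl _ = gen₃
      ... | tri> _ j≢i′ j<i with total (X ∙ x j) (x j ∙ X) | total (X ∙ t) (t ∙ X)
      ...   | inj₁ le | tot with left j (ℕ.<-trans j<i i<p)
      ...     | inj₁ old = cancelʳ-∈ sub gen₁
                  (Above-∈ sub (λ a j<a a< → ih a j<a (ℕ.<⇒≤ a<)) (largerˡ le old))
      ...     | inj₂ e with tot
      ...       | inj₁ le′ = ⊥-elim (≢t (λ j≡i → j≢i′ (≡.sym j≡i)) (∙-cancelʳ X _ _ (trans e (sym (vˡ le′)))))
      ...       | inj₂ le′ = cancelʳ-∈ sub gen₁ (resp (trans (vʳ le′) (sym e)) (mul gen₁ gen₃))
      step j j≤ ih | tri> _ j≢i′ j<i | inj₂ le | tot with right j (ℕ.<-trans j<i i<p)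
      ...     | inj₁ old = cancelˡ-∈ sub gen₁
                  (Above-∈ sub (λ a j<a a< → ih a j<a (ℕ.<⇒≤ a<)) (largerʳ le old))
      ...     | inj₂ e with tot
      ...       | inj₁ le′ = cancelˡ-∈ sub gen₁ (resp (trans (vˡ le′) (sym e)) (mul gen₃ gen₁))
      ...       | inj₂ le′ = ⊥-elim (≢t (λ j≡i → j≢i′ (≡.sym j≡i)) (∙-cancelˡ X _ _ (trans e (sym (vʳ le′)))))

    module _ (Xt<tX : X ∙ t < t ∙ X) where

      private
        -- Elements only slightly below `t` lie in the coset tA. Such an x_a has x_aX = x_c x_d with
        -- c, d > a. Size forces x_d above `t`, and x_c cannot be above `t` too, for then x_a would
        -- commute with X. So x_a = x_c x_d X⁻¹, and x_c is in the coset by induction.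
        coset : ∀ a → a ℕ.≤ i → X ∙ t ≤ x a ∙ X → A (t ⁻¹ ∙ x a)
        coset = descending (λ a → X ∙ t ≤ x a ∙ X → A (t ⁻¹ ∙ x a)) i step
          where
          step : ∀ a → a ℕ.≤ i → (∀ k → a ℕ.< k → k ℕ.≤ i → X ∙ t ≤ x k ∙ X → A (t ⁻¹ ∙ x k)) →
                 X ∙ t ≤ x a ∙ X → A (t ⁻¹ ∙ x a)
          step a a≤i ih le with ℕ.m≤n⇒m<n∨m≡n a≤i
          ... | inj₂ ≡.refl = resp (sym (inverseˡ t)) unit
          ... | inj₁ a<i with left a (ℕ.<-trans a<i i<p)
          ...   | inj₂ e = ⊥-elim (≢t (ℕ.<⇒≢ a<i) (∙-cancelʳ X _ _ (trans e (sym (vˡ (<⇒≤ Xt<tX))))))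
          ...   | inj₁ old = conclude (largerˡ (<⇒≤ Xa<aX) old)
            where
            Xa<aX : X ∙ x a < x a ∙ X
            Xa<aX = <-≤-trans (∙-monoʳ-< X (x-< a<i)) le
            conclude : Above a (suc p) (x a ∙ X) → A (t ⁻¹ ∙ x a)
            conclude (c′ , d , (a<c , c<) , (a<d , d<) , e) with d ℕ.≤? i
            ... | yes d≤i = ⊥-elim (<⇒≱ (begin-strict
                    x a ∙ X    ≈⟨ e ⟩
                    x c′ ∙ x d ≤⟨ ∙-monoʳ-≤ _ (x-≤ d≤i) ⟩
                    x c′ ∙ t   <⟨ ∙-monoˡ-< t (x-< c<) ⟩
                    X ∙ t      ∎) le)
            ... | no d≰i with c′ ℕ.≤? i
            ...   | no c≰i = ⊥-elim (<-irrefl (sym (cancelʳ-∈ (centralizer-isSubgroup X) refl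
                      (≈∈ (centralizer-isSubgroup X) (sym e) (∙∈ (centralizer-isSubgroup X)
                        (above c′ (suc p) (ℕ.≰⇒> c≰i) (ℕ.<⇒≤ c<) (ℕ.m≤n⇒m≤1+n i<p) ℕ.≤-refl)
                        (above d (suc p) (ℕ.≰⇒> d≰i) (ℕ.<⇒≤ d<) (ℕ.m≤n⇒m≤1+n i<p) ℕ.≤-refl)))))
                      Xa<aX)
            ...   | yes c≤i = resp (begin-equality
                      t ⁻¹ ∙ x c′ ∙ x d ∙ X ⁻¹     ≈⟨ solve 4 (λ t c d X → t ⁻ ⊙ c ⊙ d ⊙ X ⁻ ⊜ t ⁻ ⊙ (c ⊙ d) ⊙ X ⁻) refl t (x c′) (x d) X ⟩
                      t ⁻¹ ∙ (x c′ ∙ x d) ∙ X ⁻¹   ≈⟨ ∙-congʳ (∙-congˡ e) ⟨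
                      t ⁻¹ ∙ (x a ∙ X) ∙ X ⁻¹      ≈⟨ solve 3 (λ t a X → t ⁻ ⊙ (a ⊙ X) ⊙ X ⁻ ⊜ t ⁻ ⊙ a) refl t (x a) X ⟩
                      t ⁻¹ ∙ x a ∎)
                    (mul (mul (ih c′ a<c c≤i (≤-trans le (∙-monoˡ-≤ X (x-≤ (ℕ.<⇒≤ a<c)))))
                              (above∈A d (ℕ.≰⇒> d≰i) (ℕ.<⇒≤ d<))) (inv genˡ))

      -- Since tX = v, the smaller product Xt is old, say x_a x_b. Size puts x_b above `t`; then x_a
      -- is at most `t`, since otherwise `t` would commute with x_l. Hence x_a is in the coset tA.
      -- The inequality serves to compare the directions in which `t` moves X and Y.
      conj-∈A : A (conj t X) × X ∙ t ≤ t ∙ Y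
      conj-∈A with right i i<p
      ... | inj₂ e = ⊥-elim (<-irrefl (trans e (sym (vˡ (<⇒≤ Xt<tX)))) Xt<tX)
      ... | inj₁ (a , b , a< , b< , e) = conclude
        where
        i<b : i ℕ.< b
        i<b = ℕ.≰⇒> λ b≤i → <-irrefl (sym e) (∙-mono-<-≤ (x-< a<) (x-≤ b≤i))
        a≤i : a ℕ.≤ i
        a≤i = ℕ.≮⇒≥ λ i<a → noncommuting (cancelˡ-∈ Cl X-Cl
          (≈∈ Cl (sym e) (∙∈ Cl (above-Cl a i<a (ℕ.<⇒≤ a<)) (above-Cl b i<b (ℕ.<⇒≤ b<)))))
        conclude : A (conj t X) × X ∙ t ≤ t ∙ Y
        conclude =
          resp (begin-equality
            t ⁻¹ ∙ x a ∙ x b     ≈⟨ assoc _ _ _ ⟩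
            t ⁻¹ ∙ (x a ∙ x b)   ≈⟨ ∙-congˡ e ⟨
            t ⁻¹ ∙ (X ∙ t)       ≈⟨ assoc _ _ _ ⟨
            conj t X             ∎)
          (mul (coset a a≤i (begin
                  X ∙ t      ≈⟨ e ⟩
                  x a ∙ x b  ≤⟨ ∙-monoʳ-≤ (x a) (x-≤ (ℕ.<⇒≤ b<)) ⟩
                  x a ∙ X    ∎))
               (above∈A b i<b (ℕ.<⇒≤ b<)))
          , (begin
            X ∙ t     ≈⟨ e ⟩
            x a ∙ x b ≤⟨ ∙-mono-≤ (x-≤ a≤i) (x-≤ (ℕ.≤-pred b<)) ⟩
            t ∙ Y     ∎)

-- Relations between the four largest elements

module WordEquations {c ℓ} (G : Group c ℓ) where
  open Group G
  open GroupSolver G using (solve; _⊜_; _⊙_; _⁻)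

  -- x > y > z > w stand for the four largest elements.

  infixr 5 _⟨≈⟩_

  _⟨≈⟩_ : ∀ {g h k} → g ≈ h → h ≈ k → g ≈ k
  _⟨≈⟩_ = trans

  -- Each possible value of wy or yw eliminates w, so that wx or xw becomes a word in x, y, z. The
  -- later lemmas equate this word with zy, yz or yy, the only values that `>Z²` leaves for it.
  wy≈zz⇒wx : ∀ {w x y z} → w ∙ y ≈ z ∙ z →
    w ∙ x ≈ z ∙ z ∙ (y ⁻¹ ∙ x)
  wy≈zz⇒wx {w} {x} {y} {z} p =
    solve 4 (λ w x y z → w ⊙ x ⊜ w ⊙ y ⊙ (y ⁻ ⊙ x)) refl w x y z
    ⟨≈⟩ ∙-congʳ p

  wy≈yz⇒wx : ∀ {w x y z} → w ∙ y ≈ y ∙ z →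
    w ∙ x ≈ y ∙ z ∙ (y ⁻¹ ∙ x)
  wy≈yz⇒wx {w} {x} {y} {z} p =
    solve 4 (λ w x y z → w ⊙ x ⊜ w ⊙ y ⊙ (y ⁻ ⊙ x)) refl w x y z
    ⟨≈⟩ ∙-congʳ p

  yw≈zz⇒xw : ∀ {w x y z} → y ∙ w ≈ z ∙ z →
    x ∙ w ≈ x ∙ y ⁻¹ ∙ (z ∙ z)
  yw≈zz⇒xw {w} {x} {y} {z} p =
    solve 4 (λ w x y z → x ⊙ w ⊜ x ⊙ y ⁻ ⊙ (y ⊙ w)) refl w x y z
    ⟨≈⟩ ∙-congˡ p

  zzy⁻x≈zy⇒z : ∀ {x y z} → z ∙ z ∙ (y ⁻¹ ∙ x) ≈ z ∙ y →
    z ≈ y ∙ x ⁻¹ ∙ y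
  zzy⁻x≈zy⇒z {x} {y} {z} p =
    solve 3 (λ x y z → z ⊜ z ⁻ ⊙ (z ⊙ z ⊙ (y ⁻ ⊙ x)) ⊙ (x ⁻ ⊙ y)) refl x y z
    ⟨≈⟩ ∙-congʳ (∙-congˡ p)
    ⟨≈⟩ solve 3 (λ x y z → z ⁻ ⊙ (z ⊙ y) ⊙ (x ⁻ ⊙ y) ⊜ y ⊙ x ⁻ ⊙ y) refl x y z

  zzy⁻x≈yz⇒z : ∀ {x y z} → z ∙ z ∙ (y ⁻¹ ∙ x) ≈ y ∙ z →
    z ≈ z ⁻¹ ∙ y ∙ z ∙ x ⁻¹ ∙ y
  zzy⁻x≈yz⇒z {x} {y} {z} p =
    solve 3 (λ x y z → z ⊜ z ⁻ ⊙ (z ⊙ z ⊙ (y ⁻ ⊙ x)) ⊙ (x ⁻ ⊙ y)) refl x y z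
    ⟨≈⟩ ∙-congʳ (∙-congˡ p)
    ⟨≈⟩ solve 3 (λ x y z → z ⁻ ⊙ (y ⊙ z) ⊙ (x ⁻ ⊙ y) ⊜ z ⁻ ⊙ y ⊙ z ⊙ x ⁻ ⊙ y) refl x y z

  zzy⁻x≈yy⇒zz : ∀ {x y z} → z ∙ z ∙ (y ⁻¹ ∙ x) ≈ y ∙ y →
    z ∙ z ≈ y ∙ y ∙ x ⁻¹ ∙ y
  zzy⁻x≈yy⇒zz {x} {y} {z} p =
    solve 3 (λ x y z → z ⊙ z ⊜ z ⊙ z ⊙ (y ⁻ ⊙ x) ⊙ (x ⁻ ⊙ y)) refl x y z
    ⟨≈⟩ ∙-congʳ p
    ⟨≈⟩ solve 3 (λ x y z → y ⊙ y ⊙ (x ⁻ ⊙ y) ⊜ y ⊙ y ⊙ x ⁻ ⊙ y) refl x y z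

  yzy⁻x≈yy⇒z : ∀ {x y z} → y ∙ z ∙ (y ⁻¹ ∙ x) ≈ y ∙ y →
    z ≈ y ∙ x ⁻¹ ∙ y
  yzy⁻x≈yy⇒z {x} {y} {z} p =
    solve 3 (λ x y z → z ⊜ y ⁻ ⊙ (y ⊙ z ⊙ (y ⁻ ⊙ x)) ⊙ (x ⁻ ⊙ y)) refl x y z
    ⟨≈⟩ ∙-congʳ (∙-congˡ p)
    ⟨≈⟩ solve 3 (λ x y z → y ⁻ ⊙ (y ⊙ y) ⊙ (x ⁻ ⊙ y) ⊜ y ⊙ x ⁻ ⊙ y) refl x y z

  yzy⁻x≈zy⇒conj : ∀ {x y z} → y ∙ z ∙ (y ⁻¹ ∙ x) ≈ z ∙ y →
    z ⁻¹ ∙ y ∙ z ≈ y ∙ x ⁻¹ ∙ y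
  yzy⁻x≈zy⇒conj {x} {y} {z} p =
    solve 3 (λ x y z → z ⁻ ⊙ y ⊙ z ⊜ z ⁻ ⊙ (y ⊙ z ⊙ (y ⁻ ⊙ x)) ⊙ (x ⁻ ⊙ y)) refl x y z
    ⟨≈⟩ ∙-congʳ (∙-congˡ p)
    ⟨≈⟩ solve 3 (λ x y z → z ⁻ ⊙ (z ⊙ y) ⊙ (x ⁻ ⊙ y) ⊜ y ⊙ x ⁻ ⊙ y) refl x y z

  xy⁻zz≈yz⇒z : ∀ {x y z} → x ∙ y ⁻¹ ∙ (z ∙ z) ≈ y ∙ z →
    z ≈ y ∙ x ⁻¹ ∙ y
  xy⁻zz≈yz⇒z {x} {y} {z} p =
    solve 3 (λ x y z → z ⊜ y ⊙ x ⁻ ⊙ (x ⊙ y ⁻ ⊙ (z ⊙ z)) ⊙ z ⁻) refl x y z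
    ⟨≈⟩ ∙-congʳ (∙-congˡ p)
    ⟨≈⟩ solve 3 (λ x y z → y ⊙ x ⁻ ⊙ (y ⊙ z) ⊙ z ⁻ ⊜ y ⊙ x ⁻ ⊙ y) refl x y z

  xy⁻zz≈yy⇒zz : ∀ {x y z} → x ∙ y ⁻¹ ∙ (z ∙ z) ≈ y ∙ y →
    z ∙ z ≈ y ∙ x ⁻¹ ∙ y ∙ y
  xy⁻zz≈yy⇒zz {x} {y} {z} p =
    solve 3 (λ x y z → z ⊙ z ⊜ y ⊙ x ⁻ ⊙ (x ⊙ y ⁻ ⊙ (z ⊙ z))) refl x y z
    ⟨≈⟩ ∙-congˡ p
    ⟨≈⟩ solve 3 (λ x y z → y ⊙ x ⁻ ⊙ (y ⊙ y) ⊜ y ⊙ x ⁻ ⊙ y ⊙ y) refl x y z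

  -- Only the squares of zy and yz come out equal; uniqueness of square roots then makes y and z
  -- commute.
  near-central₁ : ∀ {x y z} → x ∙ z ≈ z ∙ x → x ∙ y ≈ y ∙ x → z ∙ z ∙ (y ⁻¹ ∙ x) ≈ y ∙ z →
    z ∙ y ∙ (z ∙ y) ≈ y ∙ z ∙ (y ∙ z)
  near-central₁ {x} {y} {z} p q r =
    solve 3 (λ x y z → z ⊙ y ⊙ (z ⊙ y) ⊜ z ⊙ y ⊙ z ⊙ x ⁻ ⊙ (x ⊙ y)) refl x y z
    ⟨≈⟩ ∙-congˡ q
    ⟨≈⟩ solve 3 (λ x y z → z ⊙ y ⊙ z ⊙ x ⁻ ⊙ (y ⊙ x) ⊜ z ⊙ (y ⊙ z) ⊙ (x ⁻ ⊙ y ⊙ x)) refl x y z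
    ⟨≈⟩ ∙-congʳ (∙-congˡ (sym r))
    ⟨≈⟩ solve 3 (λ x y z → z ⊙ (z ⊙ z ⊙ (y ⁻ ⊙ x)) ⊙ (x ⁻ ⊙ y ⊙ x) ⊜ z ⊙ z ⊙ (z ⊙ x)) refl x y z
    ⟨≈⟩ ∙-congˡ (sym p)
    ⟨≈⟩ solve 3 (λ x y z → z ⊙ z ⊙ (x ⊙ z) ⊜ z ⊙ z ⊙ (y ⁻ ⊙ x) ⊙ (x ⁻ ⊙ y ⊙ x ⊙ z)) refl x y z
    ⟨≈⟩ ∙-congʳ r
    ⟨≈⟩ solve 3 (λ x y z → y ⊙ z ⊙ (x ⁻ ⊙ y ⊙ x ⊙ z) ⊜ y ⊙ z ⊙ x ⁻ ⊙ (y ⊙ x) ⊙ z) refl x y z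
    ⟨≈⟩ ∙-congʳ (∙-congˡ (sym q))
    ⟨≈⟩ solve 3 (λ x y z → y ⊙ z ⊙ x ⁻ ⊙ (x ⊙ y) ⊙ z ⊜ y ⊙ z ⊙ (y ⊙ z)) refl x y z

  near-central₂ : ∀ {x y z} → x ∙ z ≈ z ∙ x → x ∙ y ≈ y ∙ x → x ∙ y ⁻¹ ∙ (z ∙ z) ≈ z ∙ y →
    z ∙ y ∙ (z ∙ y) ≈ y ∙ z ∙ (y ∙ z)
  near-central₂ {x} {y} {z} p q r =
    solve 3 (λ x y z → z ⊙ y ⊙ (z ⊙ y) ⊜ z ⊙ (y ⊙ x) ⊙ (x ⁻ ⊙ z ⊙ y)) refl x y z
    ⟨≈⟩ ∙-congʳ (∙-congˡ (sym q))
    ⟨≈⟩ solve 3 (λ x y z → z ⊙ (x ⊙ y) ⊙ (x ⁻ ⊙ z ⊙ y) ⊜ z ⊙ x ⊙ y ⊙ x ⁻ ⊙ (z ⊙ y)) refl x y z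
    ⟨≈⟩ ∙-congˡ (sym r)
    ⟨≈⟩ solve 3 (λ x y z → z ⊙ x ⊙ y ⊙ x ⁻ ⊙ (x ⊙ y ⁻ ⊙ (z ⊙ z)) ⊜ z ⊙ x ⊙ z ⁻ ⊙ y ⊙ x ⁻ ⊙ (x ⊙ y ⁻ ⊙ (z ⊙ z)) ⊙ z) refl x y z
    ⟨≈⟩ ∙-congʳ (∙-congˡ r)
    ⟨≈⟩ solve 3 (λ x y z → z ⊙ x ⊙ z ⁻ ⊙ y ⊙ x ⁻ ⊙ (z ⊙ y) ⊙ z ⊜ z ⊙ x ⊙ (z ⁻ ⊙ y ⊙ x ⁻ ⊙ z ⊙ y ⊙ z)) refl x y z
    ⟨≈⟩ ∙-congʳ (sym p)
    ⟨≈⟩ solve 3 (λ x y z → x ⊙ z ⊙ (z ⁻ ⊙ y ⊙ x ⁻ ⊙ z ⊙ y ⊙ z) ⊜ x ⊙ y ⊙ (x ⁻ ⊙ z ⊙ y ⊙ z)) refl x y z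
    ⟨≈⟩ ∙-congʳ q
    ⟨≈⟩ solve 3 (λ x y z → y ⊙ x ⊙ (x ⁻ ⊙ z ⊙ y ⊙ z) ⊜ y ⊙ z ⊙ (y ⊙ z)) refl x y z

  near-shift₁ : ∀ {x y z} → x ∙ z ≈ z ∙ y → x ∙ y ⁻¹ ∙ (z ∙ z) ≈ z ∙ y →
    z ≈ y
  near-shift₁ {x} {y} {z} p q =
    solve 3 (λ x y z → z ⊜ z ⊙ x ⁻ ⊙ (z ⊙ y) ⊙ (y ⁻ ⊙ z ⁻ ⊙ x)) refl x y z
    ⟨≈⟩ ∙-congʳ (∙-congˡ (sym p))
    ⟨≈⟩ solve 3 (λ x y z → z ⊙ x ⁻ ⊙ (x ⊙ z) ⊙ (y ⁻ ⊙ z ⁻ ⊙ x) ⊜ y ⊙ x ⁻ ⊙ (x ⊙ y ⁻ ⊙ (z ⊙ z)) ⊙ (y ⁻ ⊙ z ⁻ ⊙ x)) refl x y z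
    ⟨≈⟩ ∙-congʳ (∙-congˡ q)
    ⟨≈⟩ solve 3 (λ x y z → y ⊙ x ⁻ ⊙ (z ⊙ y) ⊙ (y ⁻ ⊙ z ⁻ ⊙ x) ⊜ y) refl x y z

  -- Conjugation with z takes x to y, hence the commuting pair x, y to the pair y, z⁻¹yz.
  near-shift₂ : ∀ {x y z} → x ∙ z ≈ z ∙ y → x ∙ y ≈ y ∙ x →
    z ⁻¹ ∙ y ∙ z ∙ y ≈ y ∙ (z ⁻¹ ∙ y ∙ z)
  near-shift₂ {x} {y} {z} p q =
    solve 3 (λ x y z → z ⁻ ⊙ y ⊙ z ⊙ y ⊜ z ⁻ ⊙ y ⊙ (z ⊙ y)) refl x y z
    ⟨≈⟩ ∙-congˡ (sym p)
    ⟨≈⟩ solve 3 (λ x y z → z ⁻ ⊙ y ⊙ (x ⊙ z) ⊜ z ⁻ ⊙ (x ⊙ z) ⊙ (z ⁻ ⊙ x ⁻ ⊙ y ⊙ x ⊙ z)) refl x y z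
    ⟨≈⟩ ∙-congʳ (∙-congˡ p)
    ⟨≈⟩ solve 3 (λ x y z → z ⁻ ⊙ (z ⊙ y) ⊙ (z ⁻ ⊙ x ⁻ ⊙ y ⊙ x ⊙ z) ⊜ y ⊙ z ⁻ ⊙ x ⁻ ⊙ (y ⊙ x) ⊙ z) refl x y z
    ⟨≈⟩ ∙-congʳ (∙-congˡ (sym q))
    ⟨≈⟩ solve 3 (λ x y z → y ⊙ z ⁻ ⊙ x ⁻ ⊙ (x ⊙ y) ⊙ z ⊜ y ⊙ (z ⁻ ⊙ y ⊙ z)) refl x y z

  -- The Baumslag-Solitar relation aᵗ = a² for a = x⁻¹y and t = x⁻¹.
  BS-conj : ∀ {x y z} → z ∙ x ≈ x ∙ y → x ∙ z ≈ z ∙ y →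
    x ⁻¹ ⁻¹ ∙ (x ⁻¹ ∙ y) ∙ x ⁻¹ ≈ x ⁻¹ ∙ y ∙ (x ⁻¹ ∙ y)
  BS-conj {x} {y} {z} p q =
    solve 3 (λ x y z → x ⁻ ⁻ ⊙ (x ⁻ ⊙ y) ⊙ x ⁻ ⊜ x ⁻ ⊙ (x ⊙ y) ⊙ x ⁻) refl x y z
    ⟨≈⟩ ∙-congʳ (∙-congˡ (sym p))
    ⟨≈⟩ solve 3 (λ x y z → x ⁻ ⊙ (z ⊙ x) ⊙ x ⁻ ⊜ x ⁻ ⊙ x ⁻ ⊙ (x ⊙ z)) refl x y z
    ⟨≈⟩ ∙-congˡ q
    ⟨≈⟩ solve 3 (λ x y z → x ⁻ ⊙ x ⁻ ⊙ (z ⊙ y) ⊜ x ⁻ ⊙ x ⁻ ⊙ (z ⊙ x) ⊙ (x ⁻ ⊙ y)) refl x y z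
    ⟨≈⟩ ∙-congʳ (∙-congˡ p)
    ⟨≈⟩ solve 3 (λ x y z → x ⁻ ⊙ x ⁻ ⊙ (x ⊙ y) ⊙ (x ⁻ ⊙ y) ⊜ x ⁻ ⊙ y ⊙ (x ⁻ ⊙ y)) refl x y z

  -- With a = yz⁻¹, b = xz⁻¹ and t = z⁻¹, this and the next lemma are the Fibonacci action aᵗ = b,
  -- bᵗ = ab.
  F-conj₁ : ∀ {x y z} → z ∙ x ≈ y ∙ y → x ∙ z ≈ z ∙ y →
    z ⁻¹ ⁻¹ ∙ (y ∙ z ⁻¹) ∙ z ⁻¹ ≈ x ∙ z ⁻¹
  F-conj₁ {x} {y} {z} p q =
    solve 3 (λ x y z → z ⁻ ⁻ ⊙ (y ⊙ z ⁻) ⊙ z ⁻ ⊜ z ⊙ y ⊙ (z ⁻ ⊙ z ⁻)) refl x y z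
    ⟨≈⟩ ∙-congʳ (sym q)
    ⟨≈⟩ solve 3 (λ x y z → x ⊙ z ⊙ (z ⁻ ⊙ z ⁻) ⊜ x ⊙ z ⁻) refl x y z

  F-conj₂ : ∀ {x y z} → z ∙ x ≈ y ∙ y → x ∙ z ≈ z ∙ y →
    z ⁻¹ ⁻¹ ∙ (x ∙ z ⁻¹) ∙ z ⁻¹ ≈ y ∙ z ⁻¹ ∙ (x ∙ z ⁻¹)
  F-conj₂ {x} {y} {z} p q =
    solve 3 (λ x y z → z ⁻ ⁻ ⊙ (x ⊙ z ⁻) ⊙ z ⁻ ⊜ z ⊙ x ⊙ y ⁻ ⊙ z ⁻ ⊙ (z ⊙ y) ⊙ (z ⁻ ⊙ z ⁻)) refl x y z
    ⟨≈⟩ ∙-congʳ (∙-congˡ (sym q))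
    ⟨≈⟩ solve 3 (λ x y z → z ⊙ x ⊙ y ⁻ ⊙ z ⁻ ⊙ (x ⊙ z) ⊙ (z ⁻ ⊙ z ⁻) ⊜ z ⊙ x ⊙ (y ⁻ ⊙ z ⁻ ⊙ x ⊙ z ⁻)) refl x y z
    ⟨≈⟩ ∙-congʳ p
    ⟨≈⟩ solve 3 (λ x y z → y ⊙ y ⊙ (y ⁻ ⊙ z ⁻ ⊙ x ⊙ z ⁻) ⊜ y ⊙ z ⁻ ⊙ (x ⊙ z ⁻)) refl x y z

  F-zzy⁻x≈zy : ∀ {x y z} → z ∙ x ≈ y ∙ y → x ∙ z ≈ z ∙ y → z ∙ z ∙ (y ⁻¹ ∙ x) ≈ z ∙ y →
    z ∙ y ≈ y ∙ z
  F-zzy⁻x≈zy {x} {y} {z} p q r =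
    solve 3 (λ x y z → z ⊙ y ⊜ z ⊙ y ⊙ z ⁻ ⊙ z ⁻ ⊙ (z ⊙ y) ⊙ (y ⁻ ⊙ z)) refl x y z
    ⟨≈⟩ ∙-congʳ (∙-congˡ (sym r))
    ⟨≈⟩ solve 3 (λ x y z → z ⊙ y ⊙ z ⁻ ⊙ z ⁻ ⊙ (z ⊙ z ⊙ (y ⁻ ⊙ x)) ⊙ (y ⁻ ⊙ z) ⊜ z ⊙ x ⊙ (y ⁻ ⊙ z)) refl x y z
    ⟨≈⟩ ∙-congʳ p
    ⟨≈⟩ solve 3 (λ x y z → y ⊙ y ⊙ (y ⁻ ⊙ z) ⊜ y ⊙ z) refl x y z

  F-zzy⁻x≈yz : ∀ {x y z} → z ∙ x ≈ y ∙ y → x ∙ z ≈ z ∙ y → z ∙ z ∙ (y ⁻¹ ∙ x) ≈ y ∙ z →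
    y ∙ z ⁻¹ ∙ (x ∙ z ⁻¹) ≈ x ∙ z ⁻¹ ∙ (y ∙ z ⁻¹)
  F-zzy⁻x≈yz {x} {y} {z} p q r =
    solve 3 (λ x y z → y ⊙ z ⁻ ⊙ (x ⊙ z ⁻) ⊜ y ⊙ z ⁻ ⊙ z ⁻ ⊙ (z ⊙ x) ⊙ z ⁻) refl x y z
    ⟨≈⟩ ∙-congʳ (∙-congˡ p)
    ⟨≈⟩ solve 3 (λ x y z → y ⊙ z ⁻ ⊙ z ⁻ ⊙ (y ⊙ y) ⊙ z ⁻ ⊜ y ⊙ z ⁻ ⊙ z ⁻ ⊙ (y ⊙ z) ⊙ (z ⁻ ⊙ y ⊙ z ⁻)) refl x y z
    ⟨≈⟩ ∙-congʳ (∙-congˡ (sym r))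
    ⟨≈⟩ solve 3 (λ x y z → y ⊙ z ⁻ ⊙ z ⁻ ⊙ (z ⊙ z ⊙ (y ⁻ ⊙ x)) ⊙ (z ⁻ ⊙ y ⊙ z ⁻) ⊜ x ⊙ z ⁻ ⊙ (y ⊙ z ⁻)) refl x y z

  F-yzy⁻x≈zy : ∀ {x y z} → z ∙ x ≈ y ∙ y → x ∙ z ≈ z ∙ y → y ∙ z ∙ (y ⁻¹ ∙ x) ≈ z ∙ y →
    y ∙ z ⁻¹ ∙ (x ∙ z ⁻¹) ≈ x ∙ z ⁻¹ ∙ (y ∙ z ⁻¹)
  F-yzy⁻x≈zy {x} {y} {z} p q r =
    solve 3 (λ x y z → y ⊙ z ⁻ ⊙ (x ⊙ z ⁻) ⊜ y ⊙ z ⁻ ⊙ y ⁻ ⊙ (z ⊙ y) ⊙ (y ⁻ ⊙ z ⁻ ⊙ y ⊙ x ⊙ z ⁻)) refl x y z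
    ⟨≈⟩ ∙-congʳ (∙-congˡ (sym r))
    ⟨≈⟩ solve 3 (λ x y z → y ⊙ z ⁻ ⊙ y ⁻ ⊙ (y ⊙ z ⊙ (y ⁻ ⊙ x)) ⊙ (y ⁻ ⊙ z ⁻ ⊙ y ⊙ x ⊙ z ⁻) ⊜ x ⊙ y ⁻ ⊙ z ⁻ ⊙ (y ⊙ y) ⊙ (y ⁻ ⊙ x ⊙ z ⁻)) refl x y z
    ⟨≈⟩ ∙-congʳ (∙-congˡ (sym p))
    ⟨≈⟩ solve 3 (λ x y z → x ⊙ y ⁻ ⊙ z ⁻ ⊙ (z ⊙ x) ⊙ (y ⁻ ⊙ x ⊙ z ⁻) ⊜ x ⊙ z ⁻ ⊙ y ⁻ ⊙ (y ⊙ z ⊙ (y ⁻ ⊙ x)) ⊙ (y ⁻ ⊙ x ⊙ z ⁻)) refl x y z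
    ⟨≈⟩ ∙-congʳ (∙-congˡ r)
    ⟨≈⟩ solve 3 (λ x y z → x ⊙ z ⁻ ⊙ y ⁻ ⊙ (z ⊙ y) ⊙ (y ⁻ ⊙ x ⊙ z ⁻) ⊜ x ⊙ z ⁻ ⊙ y ⁻ ⊙ (z ⊙ x) ⊙ z ⁻) refl x y z
    ⟨≈⟩ ∙-congʳ (∙-congˡ p)
    ⟨≈⟩ solve 3 (λ x y z → x ⊙ z ⁻ ⊙ y ⁻ ⊙ (y ⊙ y) ⊙ z ⁻ ⊜ x ⊙ z ⁻ ⊙ (y ⊙ z ⁻)) refl x y z

  F-xy⁻zz≈yz : ∀ {x y z} → z ∙ x ≈ y ∙ y → x ∙ z ≈ z ∙ y → x ∙ y ⁻¹ ∙ (z ∙ z) ≈ y ∙ z →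
    z ∙ y ≈ y ∙ z
  F-xy⁻zz≈yz {x} {y} {z} p q r =
    solve 3 (λ x y z → z ⊙ y ⊜ z ⊙ (y ⊙ z) ⊙ z ⁻) refl x y z
    ⟨≈⟩ ∙-congʳ (∙-congˡ (sym r))
    ⟨≈⟩ solve 3 (λ x y z → z ⊙ (x ⊙ y ⁻ ⊙ (z ⊙ z)) ⊙ z ⁻ ⊜ z ⊙ x ⊙ (y ⁻ ⊙ z)) refl x y z
    ⟨≈⟩ ∙-congʳ p
    ⟨≈⟩ solve 3 (λ x y z → y ⊙ y ⊙ (y ⁻ ⊙ z) ⊜ y ⊙ z) refl x y z

  -- Again the Fibonacci action, now with a = yx⁻¹, b = zx⁻¹ and t = x⁻¹.
  F′-conj₁ : ∀ {x y z} → z ∙ x ≈ x ∙ y → x ∙ z ≈ y ∙ y →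
    x ⁻¹ ⁻¹ ∙ (y ∙ x ⁻¹) ∙ x ⁻¹ ≈ z ∙ x ⁻¹
  F′-conj₁ {x} {y} {z} p q =
    solve 3 (λ x y z → x ⁻ ⁻ ⊙ (y ⊙ x ⁻) ⊙ x ⁻ ⊜ x ⊙ y ⊙ (x ⁻ ⊙ x ⁻)) refl x y z
    ⟨≈⟩ ∙-congʳ (sym p)
    ⟨≈⟩ solve 3 (λ x y z → z ⊙ x ⊙ (x ⁻ ⊙ x ⁻) ⊜ z ⊙ x ⁻) refl x y z

  F′-conj₂ : ∀ {x y z} → z ∙ x ≈ x ∙ y → x ∙ z ≈ y ∙ y →
    x ⁻¹ ⁻¹ ∙ (z ∙ x ⁻¹) ∙ x ⁻¹ ≈ y ∙ x ⁻¹ ∙ (z ∙ x ⁻¹)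
  F′-conj₂ {x} {y} {z} p q =
    solve 3 (λ x y z → x ⁻ ⁻ ⊙ (z ⊙ x ⁻) ⊙ x ⁻ ⊜ x ⊙ z ⊙ y ⁻ ⊙ x ⁻ ⊙ (x ⊙ y) ⊙ (x ⁻ ⊙ x ⁻)) refl x y z
    ⟨≈⟩ ∙-congʳ (∙-congˡ (sym p))
    ⟨≈⟩ solve 3 (λ x y z → x ⊙ z ⊙ y ⁻ ⊙ x ⁻ ⊙ (z ⊙ x) ⊙ (x ⁻ ⊙ x ⁻) ⊜ x ⊙ z ⊙ (y ⁻ ⊙ x ⁻ ⊙ z ⊙ x ⁻)) refl x y z
    ⟨≈⟩ ∙-congʳ q
    ⟨≈⟩ solve 3 (λ x y z → y ⊙ y ⊙ (y ⁻ ⊙ x ⁻ ⊙ z ⊙ x ⁻) ⊜ y ⊙ x ⁻ ⊙ (z ⊙ x ⁻)) refl x y z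

  F′-zzy⁻x≈zy : ∀ {x y z} → z ∙ x ≈ x ∙ y → x ∙ z ≈ y ∙ y → z ∙ z ∙ (y ⁻¹ ∙ x) ≈ z ∙ y →
    y ∙ x ⁻¹ ∙ (z ∙ x ⁻¹) ≈ z ∙ x ⁻¹ ∙ (y ∙ x ⁻¹)
  F′-zzy⁻x≈zy {x} {y} {z} p q r =
    solve 3 (λ x y z → y ⊙ x ⁻ ⊙ (z ⊙ x ⁻) ⊜ y ⊙ x ⁻ ⊙ z ⁻ ⊙ (z ⊙ z ⊙ (y ⁻ ⊙ x)) ⊙ (x ⁻ ⊙ y ⊙ x ⁻)) refl x y z
    ⟨≈⟩ ∙-congʳ (∙-congˡ r)
    ⟨≈⟩ solve 3 (λ x y z → y ⊙ x ⁻ ⊙ z ⁻ ⊙ (z ⊙ y) ⊙ (x ⁻ ⊙ y ⊙ x ⁻) ⊜ z ⁻ ⊙ (z ⊙ y) ⊙ (x ⁻ ⊙ y ⊙ x ⁻ ⊙ y ⊙ x ⁻)) refl x y z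
    ⟨≈⟩ ∙-congʳ (∙-congˡ (sym r))
    ⟨≈⟩ solve 3 (λ x y z → z ⁻ ⊙ (z ⊙ z ⊙ (y ⁻ ⊙ x)) ⊙ (x ⁻ ⊙ y ⊙ x ⁻ ⊙ y ⊙ x ⁻) ⊜ z ⊙ x ⁻ ⊙ (y ⊙ x ⁻)) refl x y z

  F′-zzy⁻x≈yz : ∀ {x y z} → z ∙ x ≈ x ∙ y → x ∙ z ≈ y ∙ y → z ∙ z ∙ (y ⁻¹ ∙ x) ≈ y ∙ z →
    y ∙ y ≈ x ∙ x
  F′-zzy⁻x≈yz {x} {y} {z} p q r =
    solve 3 (λ x y z → y ⊙ y ⊜ y ⊙ (y ⊙ z) ⊙ z ⁻) refl x y z
    ⟨≈⟩ ∙-congʳ (∙-congˡ (sym r))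
    ⟨≈⟩ solve 3 (λ x y z → y ⊙ (z ⊙ z ⊙ (y ⁻ ⊙ x)) ⊙ z ⁻ ⊜ y ⊙ z ⊙ x ⁻ ⊙ (x ⊙ z) ⊙ (y ⁻ ⊙ x ⊙ z ⁻)) refl x y z
    ⟨≈⟩ ∙-congʳ (∙-congˡ q)
    ⟨≈⟩ solve 3 (λ x y z → y ⊙ z ⊙ x ⁻ ⊙ (y ⊙ y) ⊙ (y ⁻ ⊙ x ⊙ z ⁻) ⊜ y ⊙ z ⊙ (x ⁻ ⊙ y ⊙ x ⊙ z ⁻)) refl x y z
    ⟨≈⟩ ∙-congʳ (sym r)
    ⟨≈⟩ solve 3 (λ x y z → z ⊙ z ⊙ (y ⁻ ⊙ x) ⊙ (x ⁻ ⊙ y ⊙ x ⊙ z ⁻) ⊜ z ⊙ (z ⊙ x) ⊙ z ⁻) refl x y z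
    ⟨≈⟩ ∙-congʳ (∙-congˡ p)
    ⟨≈⟩ solve 3 (λ x y z → z ⊙ (x ⊙ y) ⊙ z ⁻ ⊜ z ⊙ x ⊙ (y ⊙ z ⁻)) refl x y z
    ⟨≈⟩ ∙-congʳ p
    ⟨≈⟩ solve 3 (λ x y z → x ⊙ y ⊙ (y ⊙ z ⁻) ⊜ x ⊙ (y ⊙ y) ⊙ z ⁻) refl x y z
    ⟨≈⟩ ∙-congʳ (∙-congˡ (sym q))
    ⟨≈⟩ solve 3 (λ x y z → x ⊙ (x ⊙ z) ⊙ z ⁻ ⊜ x ⊙ x) refl x y z

  F′-zzy⁻x≈yy : ∀ {x y z} → z ∙ x ≈ x ∙ y → x ∙ z ≈ y ∙ y → z ∙ z ∙ (y ⁻¹ ∙ x) ≈ y ∙ y →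
    y ∙ x ⁻¹ ∙ (z ∙ x ⁻¹) ≈ z ∙ x ⁻¹ ∙ (y ∙ x ⁻¹)
  F′-zzy⁻x≈yy {x} {y} {z} p q r =
    solve 3 (λ x y z → y ⊙ x ⁻ ⊙ (z ⊙ x ⁻) ⊜ x ⁻ ⊙ (x ⊙ y) ⊙ (x ⁻ ⊙ z ⊙ x ⁻)) refl x y z
    ⟨≈⟩ ∙-congʳ (∙-congˡ (sym p))
    ⟨≈⟩ solve 3 (λ x y z → x ⁻ ⊙ (z ⊙ x) ⊙ (x ⁻ ⊙ z ⊙ x ⁻) ⊜ x ⁻ ⊙ (y ⊙ y) ⊙ (y ⁻ ⊙ y ⁻ ⊙ z ⊙ z ⊙ x ⁻)) refl x y z
    ⟨≈⟩ ∙-congʳ (∙-congˡ (sym q))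
    ⟨≈⟩ solve 3 (λ x y z → x ⁻ ⊙ (x ⊙ z) ⊙ (y ⁻ ⊙ y ⁻ ⊙ z ⊙ z ⊙ x ⁻) ⊜ z ⊙ y ⁻ ⊙ y ⁻ ⊙ (z ⊙ z ⊙ (y ⁻ ⊙ x)) ⊙ (x ⁻ ⊙ y ⊙ x ⁻)) refl x y z
    ⟨≈⟩ ∙-congʳ (∙-congˡ r)
    ⟨≈⟩ solve 3 (λ x y z → z ⊙ y ⁻ ⊙ y ⁻ ⊙ (y ⊙ y) ⊙ (x ⁻ ⊙ y ⊙ x ⁻) ⊜ z ⊙ x ⁻ ⊙ (y ⊙ x ⁻)) refl x y z

  F′-yzy⁻x≈zy : ∀ {x y z} → z ∙ x ≈ x ∙ y → x ∙ z ≈ y ∙ y → y ∙ z ∙ (y ⁻¹ ∙ x) ≈ z ∙ y →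
    y ∙ x ⁻¹ ∙ (y ∙ x ⁻¹) ≈ z ∙ x ⁻¹ ∙ (z ∙ x ⁻¹)
  F′-yzy⁻x≈zy {x} {y} {z} p q r =
    solve 3 (λ x y z → y ⊙ x ⁻ ⊙ (y ⊙ x ⁻) ⊜ y ⊙ x ⁻ ⊙ (y ⊙ y) ⊙ (y ⁻ ⊙ x ⁻)) refl x y z
    ⟨≈⟩ ∙-congʳ (∙-congˡ (sym q))
    ⟨≈⟩ solve 3 (λ x y z → y ⊙ x ⁻ ⊙ (x ⊙ z) ⊙ (y ⁻ ⊙ x ⁻) ⊜ y ⊙ z ⊙ (y ⁻ ⊙ x) ⊙ (x ⁻ ⊙ x ⁻)) refl x y z
    ⟨≈⟩ ∙-congʳ r
    ⟨≈⟩ solve 3 (λ x y z → z ⊙ y ⊙ (x ⁻ ⊙ x ⁻) ⊜ z ⊙ x ⁻ ⊙ (x ⊙ y) ⊙ (x ⁻ ⊙ x ⁻)) refl x y z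
    ⟨≈⟩ ∙-congʳ (∙-congˡ (sym p))
    ⟨≈⟩ solve 3 (λ x y z → z ⊙ x ⁻ ⊙ (z ⊙ x) ⊙ (x ⁻ ⊙ x ⁻) ⊜ z ⊙ x ⁻ ⊙ (z ⊙ x ⁻)) refl x y z

  F′-yzy⁻x≈yy : ∀ {x y z} → z ∙ x ≈ x ∙ y → x ∙ z ≈ y ∙ y → y ∙ z ∙ (y ⁻¹ ∙ x) ≈ y ∙ y →
    z ∙ y ≈ y ∙ z
  F′-yzy⁻x≈yy {x} {y} {z} p q r =
    solve 3 (λ x y z → z ⊙ y ⊜ z ⊙ y ⁻ ⊙ (y ⊙ y)) refl x y z
    ⟨≈⟩ ∙-congˡ (sym q)
    ⟨≈⟩ solve 3 (λ x y z → z ⊙ y ⁻ ⊙ (x ⊙ z) ⊜ y ⁻ ⊙ (y ⊙ z ⊙ (y ⁻ ⊙ x)) ⊙ z) refl x y z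
    ⟨≈⟩ ∙-congʳ (∙-congˡ r)
    ⟨≈⟩ solve 3 (λ x y z → y ⁻ ⊙ (y ⊙ y) ⊙ z ⊜ y ⊙ z) refl x y z

  F′-xy⁻zz≈zy : ∀ {x y z} → z ∙ x ≈ x ∙ y → x ∙ z ≈ y ∙ y → x ∙ y ⁻¹ ∙ (z ∙ z) ≈ z ∙ y →
    y ∙ x ⁻¹ ∙ (z ∙ x ⁻¹) ≈ z ∙ x ⁻¹ ∙ (y ∙ x ⁻¹)
  F′-xy⁻zz≈zy {x} {y} {z} p q r =
    solve 3 (λ x y z → y ⊙ x ⁻ ⊙ (z ⊙ x ⁻) ⊜ y ⊙ x ⁻ ⊙ z ⊙ y ⁻ ⊙ (x ⊙ z) ⊙ (z ⁻ ⊙ x ⁻ ⊙ y ⊙ x ⁻)) refl x y z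
    ⟨≈⟩ ∙-congʳ (∙-congˡ q)
    ⟨≈⟩ solve 3 (λ x y z → y ⊙ x ⁻ ⊙ z ⊙ y ⁻ ⊙ (y ⊙ y) ⊙ (z ⁻ ⊙ x ⁻ ⊙ y ⊙ x ⁻) ⊜ y ⊙ x ⁻ ⊙ (z ⊙ y) ⊙ (z ⁻ ⊙ x ⁻ ⊙ y ⊙ x ⁻)) refl x y z
    ⟨≈⟩ ∙-congʳ (∙-congˡ (sym r))
    ⟨≈⟩ solve 3 (λ x y z → y ⊙ x ⁻ ⊙ (x ⊙ y ⁻ ⊙ (z ⊙ z)) ⊙ (z ⁻ ⊙ x ⁻ ⊙ y ⊙ x ⁻) ⊜ z ⊙ x ⁻ ⊙ (y ⊙ x ⁻)) refl x y z

  F′-xy⁻zz≈yz : ∀ {x y z} → z ∙ x ≈ x ∙ y → x ∙ z ≈ y ∙ y → x ∙ y ⁻¹ ∙ (z ∙ z) ≈ y ∙ z →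
    y ∙ x ⁻¹ ∙ (z ∙ x ⁻¹) ≈ z ∙ x ⁻¹ ∙ (y ∙ x ⁻¹)
  F′-xy⁻zz≈yz {x} {y} {z} p q r =
    solve 3 (λ x y z → y ⊙ x ⁻ ⊙ (z ⊙ x ⁻) ⊜ y ⊙ x ⁻ ⊙ y ⊙ x ⁻ ⊙ (x ⊙ y ⁻ ⊙ (z ⊙ z)) ⊙ (z ⁻ ⊙ x ⁻)) refl x y z
    ⟨≈⟩ ∙-congʳ (∙-congˡ r)
    ⟨≈⟩ solve 3 (λ x y z → y ⊙ x ⁻ ⊙ y ⊙ x ⁻ ⊙ (y ⊙ z) ⊙ (z ⁻ ⊙ x ⁻) ⊜ y ⊙ x ⁻ ⊙ (y ⊙ z) ⊙ (z ⁻ ⊙ x ⁻ ⊙ y ⊙ x ⁻)) refl x y z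
    ⟨≈⟩ ∙-congʳ (∙-congˡ (sym r))
    ⟨≈⟩ solve 3 (λ x y z → y ⊙ x ⁻ ⊙ (x ⊙ y ⁻ ⊙ (z ⊙ z)) ⊙ (z ⁻ ⊙ x ⁻ ⊙ y ⊙ x ⁻) ⊜ z ⊙ x ⁻ ⊙ (y ⊙ x ⁻)) refl x y z

-- The four largest elements

module FourLargest {c ℓ ℓ₂} (G : OrderedGroup c ℓ ℓ₂)
  (x : ℕ → OrderedGroup.Carrier G)
  (x-step : Increasing G x) (r : ℕ) where

  open OrderedGroup G renaming (_≤_ to infix 4 _≤_)
  open OrderTheory G
  open GroupNotions group
  open Subgroups group
  open IsSubgroup
  open Sequence G x x-step
  open WordEquations group
  open GroupSolver group using (solve; _⊜_; _⊙_; _⁻)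
  open import Algebra.Properties.Group group using (∙-cancelʳ)

  W = x r
  Z = x (1 + r)
  Y = x (2 + r)
  X = x (3 + r)

  W<Z : W < Z
  W<Z = x-step r
  Z<Y : Z < Y
  Z<Y = x-step (1 + r)
  Y<X : Y < X
  Y<X = x-step (2 + r)
  Z<X : Z < X
  Z<X = <-trans Z<Y Y<X

  private
    r<1+r : r ℕ.< 1 + r
    r<1+r = ℕ.≤-refl
    r<2+r : r ℕ.< 2 + r
    r<2+r = ℕ.m≤n⇒m≤1+n ℕ.≤-refl

  -- By `PeelA`, a product of Y with an element below Z is YZ, ZY or a product of elements up to Z,
  -- and the latter are at most Z².
  >Z² : PeelA (1 + r) → ∀ {u} → Old (3 + r) u → Z ∙ Z < u →
        u ≈ Z ∙ Y ⊎ u ≈ Y ∙ Z ⊎ u ≈ Y ∙ Y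
  >Z² peel {u} (a , b , s≤s a≤ , s≤s b≤ , e) lt
    with ℕ.m≤n⇒m<n∨m≡n a≤ | ℕ.m≤n⇒m<n∨m≡n b≤
  ... | inj₂ ≡.refl | inj₂ ≡.refl = inj₂ (inj₂ e)
  ... | inj₁ a<     | inj₁ b<     = ⊥-elim (<⇒≱ lt (Old-≤ (a , b , a< , b< , e)))
  ... | inj₂ ≡.refl | inj₁ (s≤s b≤′) with ℕ.m≤n⇒m<n∨m≡n b≤′
  ...   | inj₂ ≡.refl = inj₂ (inj₁ e)
  ...   | inj₁ b<′ with PeelA.right peel b b<′
  ...     | inj₁ old = ⊥-elim (<⇒≱ lt (≤-trans (≤-reflexive e) (Old-≤ old)))
  ...     | inj₂ e′  = inj₁ (trans e e′)
  >Z² peel {u} (a , b , s≤s a≤ , s≤s b≤ , e) lt | inj₁ (s≤s a≤′) | inj₂ ≡.refl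
        with ℕ.m≤n⇒m<n∨m≡n a≤′
  ...   | inj₂ ≡.refl = inj₁ e
  ...   | inj₁ a<′ with PeelA.left peel a a<′
  ...     | inj₁ old = ⊥-elim (<⇒≱ lt (≤-trans (≤-reflexive e) (Old-≤ old)))
  ...     | inj₂ e′  = inj₂ (inj₁ (trans e e′))

  Above-unique : ∀ {j u} → Above j (2 + j) u → u ≈ x (1 + j) ∙ x (1 + j)
  Above-unique {j} (a , b , (j<a , s≤s a≤) , (j<b , s≤s b≤) , e)
    with ℕ.≤-antisym j<a a≤ | ℕ.≤-antisym j<b b≤
  ... | ≡.refl | ≡.refl = e

  data Position : Set ℓ where
    wy≈zz : W ∙ Y ≈ Z ∙ Z → Position
    wy≈yz : W ∙ Y ≈ Y ∙ Z → Position
    yw≈zz : Y ∙ W ≈ Z ∙ Z → Position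

  -- The larger of WY and YW, if old, has both factors strictly between W and Y, so it is Z².
  -- Otherwise `PeelA` gives WY = YZ or YW = ZY, and the latter fails because YW < YZ < ZY.
  position : PeelA (1 + r) → Y ∙ Z < Z ∙ Y → Position
  position peel yz<zy with total (Y ∙ W) (W ∙ Y)
  ... | inj₁ le with PeelA.left peel r r<1+r
  ...   | inj₁ old = wy≈zz (Above-unique (largerˡ le old))
  ...   | inj₂ e   = wy≈yz e
  position peel yz<zy | inj₂ le with PeelA.right peel r r<1+r
  ...   | inj₁ old = yw≈zz (Above-unique (largerʳ le old))
  ...   | inj₂ e   = ⊥-elim (<-irrefl e (<-trans (∙-monoʳ-< Y W<Z) yz<zy))

  zz< : Z ∙ Z < Z ∙ Z ∙ (Y ⁻¹ ∙ X)
  zz< = begin-strict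
    Z ∙ Z              ≈⟨ solve 2 (λ y z → z ⊙ z ⊜ z ⊙ z ⊙ (y ⁻ ⊙ y)) refl Y Z ⟩
    Z ∙ Z ∙ (Y ⁻¹ ∙ Y) <⟨ ∙-monoʳ-< (Z ∙ Z) (∙-monoʳ-< (Y ⁻¹) Y<X) ⟩
    Z ∙ Z ∙ (Y ⁻¹ ∙ X) ∎

  yz< : Y ∙ Z < Y ∙ Z ∙ (Y ⁻¹ ∙ X)
  yz< = begin-strict
    Y ∙ Z              ≈⟨ solve 2 (λ y z → y ⊙ z ⊜ y ⊙ z ⊙ (y ⁻ ⊙ y)) refl Y Z ⟩
    Y ∙ Z ∙ (Y ⁻¹ ∙ Y) <⟨ ∙-monoʳ-< (Y ∙ Z) (∙-monoʳ-< (Y ⁻¹) Y<X) ⟩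
    Y ∙ Z ∙ (Y ⁻¹ ∙ X) ∎

  <zz : Z ∙ Z < X ∙ Y ⁻¹ ∙ (Z ∙ Z)
  <zz = begin-strict
    Z ∙ Z              ≈⟨ solve 2 (λ y z → z ⊙ z ⊜ y ⊙ y ⁻ ⊙ (z ⊙ z)) refl Y Z ⟩
    Y ∙ Y ⁻¹ ∙ (Z ∙ Z) <⟨ ∙-monoˡ-< (Z ∙ Z) (∙-monoˡ-< (Y ⁻¹) Y<X) ⟩
    X ∙ Y ⁻¹ ∙ (Z ∙ Z) ∎

  module Near (XY : X ⟷ Y) (yz<zy : Y ∙ Z < Z ∙ Y) (XZ : X ∙ Z ≈ Z ∙ Y ⊎ X ⟷ Z)
    (peel : PeelA (1 + r)) (WX-old : Old (3 + r) (W ∙ X)) (XW-old : Old (3 + r) (X ∙ W)) where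

    private
      Cl : IsSubgroup (_⟷ Y)
      Cl = centralizer-isSubgroup Y

      Z-Y : Z ⟷ Y → ⊥
      Z-Y e = <-irrefl (sym e) yz<zy

      Z²-Y : Z ∙ Z ⟷ Y → ⊥
      Z²-Y e = Z-Y (square-⟷ e)

      YX⁻¹Y : Y ∙ X ⁻¹ ∙ Y ⟷ Y
      YX⁻¹Y = ∙∈ Cl (∙∈ Cl refl (⁻¹∈ Cl XY)) refl

      commutes : ∀ {g h} → g ≈ h → h ⟷ Y → g ⟷ Y
      commutes e = ≈∈ Cl (sym e)

      classify : ∀ {u v} → Old (3 + r) u → u ≈ v → Z ∙ Z < v → v ≈ Z ∙ Y ⊎ v ≈ Y ∙ Z ⊎ v ≈ Y ∙ Y
      classify (a , b , a< , b< , e) e′ = >Z² peel (a , b , a< , b< , trans (sym e′) e)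

      contradict₁ : Z ∙ Z ∙ (Y ⁻¹ ∙ X) ≈ Y ∙ Z → ⊥
      contradict₁ e =
        [ (λ shift → Z-Y (commutes (zzy⁻x≈yz⇒z e)
                           (∙∈ Cl (∙∈ Cl (near-shift₂ shift XY) (⁻¹∈ Cl XY)) refl)))
        , (λ central → <-irrefl (sym (square-injective (near-central₁ central XY e))) yz<zy) ]′ XZ

      contradict₂ : X ∙ Y ⁻¹ ∙ (Z ∙ Z) ≈ Z ∙ Y → ⊥
      contradict₂ e =
        [ (λ shift → <-irrefl (near-shift₁ shift e) Z<Y)
        , (λ central → <-irrefl (sym (square-injective (near-central₂ central XY e))) yz<zy) ]′ XZ

    -- There are three positions of W, each with three values for WX or XW. In eight of the nine
    -- cases Z or Z² commutes with Y, or (ZY)² = (YZ)², or a strict inequality fails. What survives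
    -- is WY = YZ with WX = ZY.
    conj-Y : conj Z Y ≈ Y ∙ X ⁻¹ ∙ Y
    conj-Y with position peel yz<zy
    ... | wy≈zz e with classify WX-old (wy≈zz⇒wx e) zz<
    ...   | inj₁ f        = ⊥-elim (Z-Y (commutes (zzy⁻x≈zy⇒z f) YX⁻¹Y))
    ...   | inj₂ (inj₁ f) = ⊥-elim (contradict₁ f)
    ...   | inj₂ (inj₂ f) = ⊥-elim (Z²-Y (commutes (zzy⁻x≈yy⇒zz f)
              (∙∈ Cl (∙∈ Cl (∙∈ Cl refl refl) (⁻¹∈ Cl XY)) refl)))
    conj-Y | wy≈yz e with classify WX-old (wy≈yz⇒wx e) (<-trans (∙-monoˡ-< Z Z<Y) yz<)
    ...   | inj₁ f        = yzy⁻x≈zy⇒conj f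
    ...   | inj₂ (inj₁ f) = ⊥-elim (<-irrefl (sym f) yz<)
    ...   | inj₂ (inj₂ f) = ⊥-elim (Z-Y (commutes (yzy⁻x≈yy⇒z f) YX⁻¹Y))
    conj-Y | yw≈zz e with classify XW-old (yw≈zz⇒xw e) <zz
    ...   | inj₁ f        = ⊥-elim (contradict₂ f)
    ...   | inj₂ (inj₁ f) = ⊥-elim (Z-Y (commutes (xy⁻zz≈yz⇒z f) YX⁻¹Y))
    ...   | inj₂ (inj₂ f) = ⊥-elim (Z²-Y (commutes (xy⁻zz≈yy⇒zz f) (∙∈ Cl YX⁻¹Y refl)))

    split : Split X Y Z
    split = record
      { commute = XY
      ; conj-a  = conj-X XZ
      ; conj-b  = resp (sym conj-Y) (mul (mul genʳ (inv genˡ)) genʳ)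
      }
      where
      conj-X : X ∙ Z ≈ Z ∙ Y ⊎ X ⟷ Z → ⟨ X ,, Y ⟩ (conj Z X)
      conj-X (inj₁ shift) = resp (begin-equality
        Y                ≈⟨ solve 2 (λ y z → y ⊜ z ⁻ ⊙ (z ⊙ y)) refl Y Z ⟩
        Z ⁻¹ ∙ (Z ∙ Y)   ≈⟨ ∙-congˡ shift ⟨
        Z ⁻¹ ∙ (X ∙ Z)   ≈⟨ assoc _ _ _ ⟨
        conj Z X         ∎) genʳ
      conj-X (inj₂ central) = resp (sym (conj-fixed central)) genˡ

  module TypeA (peel : PeelA (2 + r)) (XZ≤ZX : X ∙ Z ≤ Z ∙ X) where

    X-Y : ¬ X ⟷ Y
    X-Y = PeelA.noncommuting peel

    ZX≈ : Z ∙ X ≈ Y ∙ Y ⊎ Z ∙ X ≈ X ∙ Y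
    ZX≈ with PeelA.left peel (1 + r) ℕ.≤-refl
    ... | inj₁ old = inj₁ (Above-unique (largerˡ XZ≤ZX old))
    ... | inj₂ e   = inj₂ e

    ZX≤XY : Z ∙ X ≤ X ∙ Y
    ZX≤XY with ZX≈
    ... | inj₁ e = ≤-trans (≤-reflexive e) (∙-monoˡ-≤ Y (<⇒≤ Y<X))
    ... | inj₂ e = ≤-reflexive e

    XZ-old : Old (3 + r) (X ∙ Z)
    XZ-old with PeelA.right peel (1 + r) ℕ.≤-refl
    ... | inj₁ old = old
    ... | inj₂ e   = ⊥-elim (<⇒≱ (∙-monoˡ-< X Z<Y) (≤-trans (≤-reflexive (sym e)) XZ≤ZX))

    WX-old : Old (3 + r) (W ∙ X)
    WX-old with PeelA.left peel r r<2+r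
    ... | inj₁ old = old
    ... | inj₂ e   = ⊥-elim (<-irrefl e (<-≤-trans (∙-monoˡ-< X W<Z) ZX≤XY))

    XW-old : Old (3 + r) (X ∙ W)
    XW-old with PeelA.right peel r r<2+r
    ... | inj₁ old = old
    ... | inj₂ e   = ⊥-elim (<-irrefl e (<-trans (∙-monoʳ-< X W<Z)
                       (≤-<-trans XZ≤ZX (∙-monoˡ-< X Z<Y))))

    str : ∀ {a b t} → Split a b t → ⟨ a ,, b ,, t ⟩ X → ⟨ a ,, b ,, t ⟩ Y → Structure (4 + r)
    str split X∈ Y∈ = record
      { split     = split
      ; generated = λ { j (s≤s j≤) → PeelA-generated peel ⟨⟩-isSubgroup X∈ Y∈ j j≤ } }

    module _ (peel′ : PeelA (1 + r)) where

      private
        Y-Z : Z ∙ Y ≈ Y ∙ Z → ⊥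
        Y-Z e = PeelA.noncommuting peel′ (sym e)

        classify : ∀ {u v} → Old (3 + r) u → u ≈ v → Z ∙ Z < v → v ≈ Z ∙ Y ⊎ v ≈ Y ∙ Z ⊎ v ≈ Y ∙ Y
        classify (a , b , a< , b< , e) e′ = >Z² peel′ (a , b , a< , b< , trans (sym e′) e)

        case-BS : Z ∙ X ≈ X ∙ Y → X ∙ Z ≈ Z ∙ Y → Structure (4 + r)
        case-BS p q = str {X ⁻¹ ∙ Y} {X ⁻¹ ∙ Y} {X ⁻¹}
          (record { commute = refl
                  ; conj-a = resp (sym (BS-conj p q)) (mul genˡ genˡ)
                  ; conj-b = resp (sym (BS-conj p q)) (mul genˡ genˡ) })
          X∈ (resp (solve 2 (λ x y → x ⊙ (x ⁻ ⊙ y) ⊜ y) refl X Y) (mul X∈ gen₁))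
          where
          X∈ : ⟨ X ⁻¹ ∙ Y ,, X ⁻¹ ∙ Y ,, X ⁻¹ ⟩ X
          X∈ = resp (solve 1 (λ x → x ⁻ ⁻ ⊜ x) refl X) (inv gen₃)

        case-F : Z ∙ X ≈ Y ∙ Y → X ∙ Z ≈ Z ∙ Y → Structure (4 + r)
        case-F p q = str (record { commute = ab ; conj-a = resp (sym (F-conj₁ p q)) genʳ
                                 ; conj-b = resp (sym (F-conj₂ p q)) (mul genˡ genʳ) })
            (resp (solve 2 (λ x z → x ⊙ z ⁻ ⊙ z ⁻ ⁻ ⊜ x) refl X Z) (mul gen₂ (inv gen₃)))
            (resp (solve 2 (λ x z → x ⊙ z ⁻ ⊙ z ⁻ ⁻ ⊜ x) refl Y Z) (mul gen₁ (inv gen₃)))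
          where
          yz<zy : Y ∙ Z < Z ∙ Y
          yz<zy = <-≤-trans (∙-monoˡ-< Z Y<X) (≤-reflexive q)
          WX<YY : W ∙ X < Y ∙ Y
          WX<YY = <-≤-trans (∙-monoˡ-< X W<Z) (≤-reflexive p)
          XW<ZY : X ∙ W < Z ∙ Y
          XW<ZY = <-≤-trans (∙-monoʳ-< X W<Z) (≤-reflexive q)
          -- The two relations between X, Y and Z alone present an extension of the free group on
          -- these two elements by an infinite cyclic group. That they commute must therefore come
          -- from the fourth element W.
          ab : Y ∙ Z ⁻¹ ⟷ X ∙ Z ⁻¹
          ab with position peel′ yz<zy
          ... | wy≈zz e with classify WX-old (wy≈zz⇒wx e) zz<
          ...   | inj₁ f        = ⊥-elim (Y-Z (F-zzy⁻x≈zy p q f))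
          ...   | inj₂ (inj₁ f) = F-zzy⁻x≈yz p q f
          ...   | inj₂ (inj₂ f) = ⊥-elim (<-irrefl (trans (wy≈zz⇒wx e) f) WX<YY)
          ab | wy≈yz e with classify WX-old (wy≈yz⇒wx e) (<-trans (∙-monoˡ-< Z Z<Y) yz<)
          ...   | inj₁ f        = F-yzy⁻x≈zy p q f
          ...   | inj₂ (inj₁ f) = ⊥-elim (<-irrefl (sym f) yz<)
          ...   | inj₂ (inj₂ f) = ⊥-elim (<-irrefl (trans (wy≈yz⇒wx e) f) WX<YY)
          ab | yw≈zz e with classify XW-old (yw≈zz⇒xw e) <zz
          ...   | inj₁ f        = ⊥-elim (<-irrefl (trans (yw≈zz⇒xw e) f) XW<ZY)
          ...   | inj₂ (inj₁ f) = ⊥-elim (Y-Z (F-xy⁻zz≈yz p q f))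
          ...   | inj₂ (inj₂ f) = ⊥-elim (<-irrefl (trans (yw≈zz⇒xw e) f)
                    (<-trans XW<ZY (∙-monoˡ-< Y Z<Y)))

        case-F′ : Z ∙ X ≈ X ∙ Y → X ∙ Z ≈ Y ∙ Y → Structure (4 + r)
        case-F′ p q = str (record { commute = ab ; conj-a = resp (sym (F′-conj₁ p q)) genʳ
                                  ; conj-b = resp (sym (F′-conj₂ p q)) (mul genˡ genʳ) })
            (resp (solve 1 (λ x → x ⁻ ⁻ ⊜ x) refl X) (inv gen₃))
            (resp (solve 2 (λ x y → y ⊙ x ⁻ ⊙ x ⁻ ⁻ ⊜ y) refl X Y) (mul gen₁ (inv gen₃)))
          where
          yz<zy : Y ∙ Z < Z ∙ Y
          -- From XY < YX and XZ = Y² one gets XYZ < YXZ = Y³ = XZY, and X is cancelled.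
          yz<zy = (begin
              Y ∙ Z                  ≈⟨ solve 3 (λ x y z → y ⊙ z ⊜ x ⁻ ⊙ (x ⊙ y ⊙ z)) refl X Y Z ⟩
              X ⁻¹ ∙ (X ∙ Y ∙ Z)     ≤⟨ ∙-monoʳ-≤ (X ⁻¹) (∙-monoˡ-≤ Z (<⇒≤ XY<YX)) ⟩
              X ⁻¹ ∙ (Y ∙ X ∙ Z)     ≈⟨ ∙-congˡ (begin-equality
                Y ∙ X ∙ Z     ≈⟨ assoc _ _ _ ⟩
                Y ∙ (X ∙ Z)   ≈⟨ ∙-congˡ q ⟩
                Y ∙ (Y ∙ Y)   ≈⟨ assoc _ _ _ ⟨
                Y ∙ Y ∙ Y     ≈⟨ ∙-congʳ q ⟨
                X ∙ Z ∙ Y     ∎) ⟩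
              X ⁻¹ ∙ (X ∙ Z ∙ Y)     ≈⟨ solve 3 (λ x y z → x ⁻ ⊙ (x ⊙ z ⊙ y) ⊜ z ⊙ y) refl X Y Z ⟩
              Z ∙ Y                  ∎) , λ e → Y-Z (sym e)
            where
            XY<YX : X ∙ Y < Y ∙ X
            XY<YX = ≤-<-trans (≤-reflexive (sym p)) (∙-monoˡ-< X Z<Y)
          XW<YY : X ∙ W < Y ∙ Y
          XW<YY = <-≤-trans (∙-monoʳ-< X W<Z) (≤-reflexive q)
          ab : Y ∙ X ⁻¹ ⟷ Z ∙ X ⁻¹
          ab with position peel′ yz<zy
          ... | wy≈zz e with classify WX-old (wy≈zz⇒wx e) zz<
          ...   | inj₁ f        = F′-zzy⁻x≈zy p q f
          ...   | inj₂ (inj₁ f) = ⊥-elim (<-irrefl (square-injective (F′-zzy⁻x≈yz p q f)) Y<X)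
          ...   | inj₂ (inj₂ f) = F′-zzy⁻x≈yy p q f
          ab | wy≈yz e with classify WX-old (wy≈yz⇒wx e) (<-trans (∙-monoˡ-< Z Z<Y) yz<)
          ...   | inj₁ f        = ⊥-elim (<-irrefl (sym (∙-cancelʳ _ _ _ (square-injective (F′-yzy⁻x≈zy p q f)))) Z<Y)
          ...   | inj₂ (inj₁ f) = ⊥-elim (<-irrefl (sym f) yz<)
          ...   | inj₂ (inj₂ f) = ⊥-elim (Y-Z (F′-yzy⁻x≈yy p q f))
          ab | yw≈zz e with classify XW-old (yw≈zz⇒xw e) <zz
          ...   | inj₁ f        = F′-xy⁻zz≈zy p q f
          ...   | inj₂ (inj₁ f) = F′-xy⁻zz≈yz p q f
          ...   | inj₂ (inj₂ f) = ⊥-elim (<-irrefl (trans (yw≈zz⇒xw e) f) XW<YY)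

      -- XZ is old and exceeds both Z² and YZ, so it is ZY or Y², while ZX is Y² or XY. If both are
      -- Y², then Y² commutes with X, and so does Y. The other three combinations are two Fibonacci
      -- cases and the Baumslag-Solitar case.
      peelAA : Structure (4 + r)
      peelAA with >Z² peel′ XZ-old (∙-monoˡ-< Z Z<X) | ZX≈
      ... | inj₁ q        | inj₁ p = case-F p q
      ... | inj₁ q        | inj₂ p = case-BS p q
      ... | inj₂ (inj₁ q) | _      = ⊥-elim (<-irrefl (sym q) (∙-monoˡ-< Z Y<X))
      ... | inj₂ (inj₂ q) | inj₂ p = case-F′ p q
      ... | inj₂ (inj₂ q) | inj₁ p = ⊥-elim (X-Y (sym (square-⟷ (begin-equality
              Y ∙ Y ∙ X     ≈⟨ ∙-congʳ q ⟨
              X ∙ Z ∙ X     ≈⟨ assoc _ _ _ ⟩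
              X ∙ (Z ∙ X)   ≈⟨ ∙-congˡ p ⟩
              X ∙ (Y ∙ Y)   ∎))))

    module _ (peel′ : PeelB (1 + r)) where

      private
        Cl : IsSubgroup (_⟷ Y)
        Cl = centralizer-isSubgroup Y

        Z-Y : Z ⟷ Y
        Z-Y = sym (PeelB.commuting peel′)

        X≈Y²Z⁻¹ : Z ∙ X ≈ Y ∙ Y → ⊥
        X≈Y²Z⁻¹ e = X-Y (cancelˡ-∈ Cl Z-Y (≈∈ Cl (sym e) (∙∈ Cl refl refl)))

        ZX≈XY : Z ∙ X ≈ X ∙ Y
        ZX≈XY with ZX≈
        ... | inj₁ e = ⊥-elim (X≈Y²Z⁻¹ e)
        ... | inj₂ e = e

        XY<YX : X ∙ Y < Y ∙ X
        XY<YX = ≤-<-trans (≤-reflexive (sym ZX≈XY)) (∙-monoˡ-< X Z<Y)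

        -- By size the second factor of the old product XZ is Y. The first is not Y, as X would then
        -- commute with Y, and not Z, as ZY = YZ would give X = Y. The resulting x_j contradicts
        -- `decreasing` by way of `violates`.
        violator : Σ ℕ λ j → j ℕ.≤ r × X ∙ Z ≈ x j ∙ Y
        violator with XZ-old
        ... | j , b , s≤s j≤ , s≤s b≤ , e with ℕ.m≤n⇒m<n∨m≡n b≤
        ...   | inj₁ (s≤s b≤′) = ⊥-elim (<-irrefl (sym e) (∙-mono-<-≤ (x-< (s≤s j≤)) (x-≤ b≤′)))
        ...   | inj₂ ≡.refl with ℕ.m≤n⇒m<n∨m≡n j≤
        ...     | inj₂ ≡.refl = ⊥-elim (X-Y (cancelʳ-∈ Cl Z-Y (≈∈ Cl (sym e) (∙∈ Cl refl refl))))
        ...     | inj₁ (s≤s j≤′) with ℕ.m≤n⇒m<n∨m≡n j≤′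
        ...       | inj₂ ≡.refl = ⊥-elim (<-irrefl (sym (∙-cancelʳ Z _ _ (trans e Z-Y))) Y<X)
        ...       | inj₁ (s≤s j≤r) = j , j≤r , e

        -- Because Z commutes with Y, multiplying XY < YX on the right by ZY⁻¹ gives the same
        -- comparison for g = XZY⁻¹.
        violates : ∀ {g} → X ∙ Z ≈ g ∙ Y → g ∙ Y < Y ∙ g
        violates {g} e = begin-strict
          g ∙ Y                  ≈⟨ e ⟨
          X ∙ Z                  ≈⟨ solve 3 (λ x y z → x ⊙ z ⊜ x ⊙ (z ⊙ y) ⊙ y ⁻) refl X Y Z ⟩
          X ∙ (Z ∙ Y) ∙ Y ⁻¹     ≈⟨ ∙-congʳ (∙-congˡ Z-Y) ⟩
          X ∙ (Y ∙ Z) ∙ Y ⁻¹     ≈⟨ ∙-congʳ (assoc _ _ _) ⟨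
          X ∙ Y ∙ Z ∙ Y ⁻¹       <⟨ ∙-monoˡ-< (Y ⁻¹) (∙-monoˡ-< Z XY<YX) ⟩
          Y ∙ X ∙ Z ∙ Y ⁻¹       ≈⟨ ∙-congʳ (assoc _ _ _) ⟩
          Y ∙ (X ∙ Z) ∙ Y ⁻¹     ≈⟨ ∙-congʳ (∙-congˡ e) ⟩
          Y ∙ (g ∙ Y) ∙ Y ⁻¹     ≈⟨ solve 2 (λ g y → y ⊙ (g ⊙ y) ⊙ y ⁻ ⊜ y ⊙ g) refl g Y ⟩
          Y ∙ g                  ∎

        conj-Z : conj X Z ≈ Y
        conj-Z = begin-equality
          X ⁻¹ ∙ Z ∙ X     ≈⟨ assoc _ _ _ ⟩
          X ⁻¹ ∙ (Z ∙ X)   ≈⟨ ∙-congˡ ZX≈XY ⟩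
          X ⁻¹ ∙ (X ∙ Y)   ≈⟨ solve 2 (λ x y → x ⁻ ⊙ (x ⊙ y) ⊜ y) refl X Y ⟩
          Y                ∎

        Y<conj-Y : Y < conj X Y
        Y<conj-Y = ≤-<-trans (≤-reflexive (sym conj-Z)) (conj-mono-< X Z<Y)

        increases : ∀ {a} → r ℕ.< a → a ℕ.< 3 + r → x a < conj X (x a) × x a ⟷ Y
        increases r<a (s≤s a≤) with ℕ.m≤n⇒m<n∨m≡n a≤
        ... | inj₂ ≡.refl = Y<conj-Y , refl
        ... | inj₁ (s≤s a≤′) with ℕ.≤-antisym r<a a≤′
        ...   | ≡.refl = <-≤-trans Z<Y (≤-reflexive (sym conj-Z)) , Z-Y

        -- Conjugation with X raises Z and Y strictly. If XW were the larger product, it would be a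
        -- product of factors Z and Y, and conjugation with X would raise it to WX.
        WX-product : Σ Carrier λ g → W ∙ X ≈ g × g ⟷ Y
        WX-product with total (X ∙ W) (W ∙ X)
        ... | inj₁ le with largerˡ le WX-old
        ...   | a , b , (r<a , a<) , (r<b , b<) , e = x a ∙ x b , e ,
                ∙∈ Cl (proj₂ (increases r<a a<)) (proj₂ (increases r<b b<))
        WX-product | inj₂ le with largerʳ le XW-old
        ...   | a , b , (r<a , a<) , (r<b , b<) , e = ⊥-elim (<⇒≱ (begin-strict
                X ∙ W                         ≈⟨ e ⟩
                x a ∙ x b                     <⟨ ∙-mono-< (proj₁ (increases r<a a<)) (proj₁ (increases r<b b<)) ⟩
                conj X (x a) ∙ conj X (x b)   ≈⟨ conj-∙ X (x a) (x b) ⟨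
                conj X (x a ∙ x b)            ≈⟨ conj-cong X e ⟨
                conj X (X ∙ W)                ≈⟨ solve 2 (λ w x → x ⁻ ⊙ (x ⊙ w) ⊙ x ⊜ w ⊙ x) refl W X ⟩
                W ∙ X                         ∎) le)

        YW<WY : Y ∙ W < W ∙ Y
        YW<WY with WX-product
        ... | g , e , g-Y = begin-strict
          Y ∙ W                        ≈⟨ solve 3 (λ w x y → y ⊙ w ⊜ y ⊙ (w ⊙ x) ⊙ x ⁻) refl W X Y ⟩
          Y ∙ (W ∙ X) ∙ X ⁻¹           ≈⟨ ∙-congʳ (∙-congˡ e) ⟩
          Y ∙ g ∙ X ⁻¹                 ≈⟨ ∙-congʳ g-Y ⟨
          g ∙ Y ∙ X ⁻¹                 ≈⟨ solve 3 (λ g x y → g ⊙ y ⊙ x ⁻ ⊜ g ⊙ x ⁻ ⊙ (x ⊙ y) ⊙ x ⁻) refl g X Y ⟩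
          g ∙ X ⁻¹ ∙ (X ∙ Y) ∙ X ⁻¹    <⟨ ∙-monoˡ-< (X ⁻¹) (∙-monoʳ-< (g ∙ X ⁻¹) XY<YX) ⟩
          g ∙ X ⁻¹ ∙ (Y ∙ X) ∙ X ⁻¹    ≈⟨ solve 3 (λ g x y → g ⊙ x ⁻ ⊙ (y ⊙ x) ⊙ x ⁻ ⊜ g ⊙ x ⁻ ⊙ y) refl g X Y ⟩
          g ∙ X ⁻¹ ∙ Y                 ≈⟨ ∙-congʳ (∙-congʳ e) ⟨
          W ∙ X ∙ X ⁻¹ ∙ Y             ≈⟨ solve 3 (λ w x y → w ⊙ x ⊙ x ⁻ ⊙ y ⊜ w ⊙ y) refl W X Y ⟩
          W ∙ Y                        ∎

        WY≈v : W ∙ Y ≈ PeelB.v peel′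
        WY≈v with PeelB.left peel′ r r<1+r
        ... | inj₂ e   = e
        ... | inj₁ old = ⊥-elim (<-irrefl (sym (cancelʳ-∈ Cl refl
                (≈∈ Cl (sym (Above-unique (largerˡ (<⇒≤ YW<WY) old))) (∙∈ Cl Z-Y Z-Y)))) YW<WY)

        -- Below W the value `v` = WY is too large for Yx_j. If Yx_j is the larger product, it is
        -- thus a product of two elements for which the inequality is known, so Y(Yx_j) ≤ (Yx_j)Y,
        -- and Y is cancelled.
        decreasing : ∀ j → j ℕ.≤ 1 + r → Y ∙ x j ≤ x j ∙ Y
        decreasing = descending (λ j → Y ∙ x j ≤ x j ∙ Y) (1 + r) step
          where
          step : ∀ j → j ℕ.≤ 1 + r → (∀ k → j ℕ.< k → k ℕ.≤ 1 + r → Y ∙ x k ≤ x k ∙ Y) →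
                 Y ∙ x j ≤ x j ∙ Y
          step j j≤ ih with ℕ.m≤n⇒m<n∨m≡n j≤
          ... | inj₂ ≡.refl = ≤-reflexive (sym Z-Y)
          ... | inj₁ j< with total (Y ∙ x j) (x j ∙ Y)
          ...   | inj₁ le = le
          ...   | inj₂ le with PeelB.right peel′ j j<
          step j j≤ ih | inj₁ (s≤s j≤r) | inj₂ le | inj₂ e with ℕ.m≤n⇒m<n∨m≡n j≤r
          ... | inj₂ ≡.refl = <⇒≤ YW<WY
          ... | inj₁ j<r    = ⊥-elim (<-irrefl (trans e (sym WY≈v)) (<-trans (∙-monoʳ-< Y (x-< j<r)) YW<WY))
          step j j≤ ih | inj₁ j< | inj₂ le | inj₁ old with largerʳ le old
          ... | a , b , (j<a , s≤s a≤) , (j<b , s≤s b≤) , e = begin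
            Y ∙ x j                      ≈⟨ solve 2 (λ g y → y ⊙ g ⊜ y ⁻ ⊙ (y ⊙ (y ⊙ g))) refl (x j) Y ⟩
            Y ⁻¹ ∙ (Y ∙ (Y ∙ x j))       ≈⟨ ∙-congˡ (∙-congˡ e) ⟩
            Y ⁻¹ ∙ (Y ∙ (x a ∙ x b))     ≈⟨ ∙-congˡ (assoc _ _ _) ⟨
            Y ⁻¹ ∙ (Y ∙ x a ∙ x b)       ≤⟨ ∙-monoʳ-≤ (Y ⁻¹) (∙-monoˡ-≤ (x b) (ih a j<a a≤)) ⟩
            Y ⁻¹ ∙ (x a ∙ Y ∙ x b)       ≈⟨ ∙-congˡ (assoc _ _ _) ⟩
            Y ⁻¹ ∙ (x a ∙ (Y ∙ x b))     ≤⟨ ∙-monoʳ-≤ (Y ⁻¹) (∙-monoʳ-≤ (x a) (ih b j<b b≤)) ⟩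
            Y ⁻¹ ∙ (x a ∙ (x b ∙ Y))     ≈⟨ ∙-congˡ (assoc _ _ _) ⟨
            Y ⁻¹ ∙ (x a ∙ x b ∙ Y)       ≈⟨ ∙-congˡ (∙-congʳ e) ⟨
            Y ⁻¹ ∙ (Y ∙ x j ∙ Y)         ≈⟨ solve 2 (λ g y → y ⁻ ⊙ (y ⊙ g ⊙ y) ⊜ g ⊙ y) refl (x j) Y ⟩
            x j ∙ Y                      ∎

      ¬peelAB : ⊥
      ¬peelAB with violator
      ... | j , j≤r , e = <⇒≱ (violates e) (decreasing j (ℕ.m≤n⇒m≤1+n j≤r))

-- Two successive small deletions

search : ∀ {a b} {P : ℕ → Set a} {Q : ℕ → Set b} n → (∀ j → j ℕ.< n → P j ⊎ Q j) →
         (Σ ℕ λ j → j ℕ.< n × P j) ⊎ (∀ j → j ℕ.< n → Q j)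
search zero    f = inj₂ λ _ ()
search (suc n) f with f n ℕ.≤-refl | search n (λ j j<n → f j (ℕ.m≤n⇒m≤1+n j<n))
... | inj₁ p | _                  = inj₁ (n , ℕ.≤-refl , p)
... | inj₂ _ | inj₁ (j , j<n , p) = inj₁ (j , ℕ.m≤n⇒m≤1+n j<n , p)
... | inj₂ q | inj₂ qs            = inj₂ λ { j (s≤s j≤n) → extend j (ℕ.m≤n⇒m<n∨m≡n j≤n) }
  where
  extend : ∀ j → j ℕ.< n ⊎ j ≡ n → _
  extend j (inj₁ j<n)    = qs j j<n
  extend j (inj₂ ≡.refl) = q

module Duality {c ℓ ℓ₂} (G : OrderedGroup c ℓ ℓ₂)
  (x : ℕ → OrderedGroup.Carrier G)
  (x-step : Increasing G x) where

  open OrderedGroup G renaming (_≤_ to infix 4 _≤_)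
  open GroupNotions group
  open Subgroups group
  open Sequence G x x-step
  open IsSubgroup
  open GroupSolver group using (solve; _⊜_; _⊙_; _⁻)

  private
    module Gᵒ = OrderedGroup (opposite G)
    module Sᵒ = Subgroups Gᵒ.group
    module Nᵒ = GroupNotions Gᵒ.group
    module Qᵒ = Sequence (opposite G) x x-step

  Oldᵒ : ∀ {k u} → Old k u → Qᵒ.Old k u
  Oldᵒ (a , b , a< , b< , e) = b , a , b< , a< , e

  PeelAᵒ : ∀ {p} → PeelA p → Qᵒ.PeelA p
  PeelAᵒ peel = record
    { noncommuting = λ e → noncommuting (sym e)
    ; left         = λ j j<p → map₁ Oldᵒ (right j j<p)
    ; right        = λ j j<p → map₁ Oldᵒ (left j j<p)
    } where open PeelA peel

  PeelBᵒ : ∀ {p} → PeelB p → Qᵒ.PeelB p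
  PeelBᵒ peel = record
    { commuting = sym commuting
    ; v         = v
    ; left      = λ j j<p → map₁ Oldᵒ (right j j<p)
    ; right     = λ j j<p → map₁ Oldᵒ (left j j<p)
    } where open PeelB peel

  CommAboveᵒ : ∀ {i m} → CommAbove i m → Qᵒ.CommAbove i m
  CommAboveᵒ above a b i<a a≤ i<b b≤ = sym (above a b i<a a≤ i<b b≤)

  ⟨⟩ᵒ : ∀ {P : Pred} {g} → Nᵒ.⟨ P ⟩ g → ⟨ P ⟩ g
  ⟨⟩ᵒ = Sᵒ.⟨⟩-least (record { ε∈ = unit ; ∙∈ = λ p q → mul q p ; ⁻¹∈ = inv ; ≈∈ = resp }) gen

  conjᵒ : ∀ t g → Sᵒ.conj t g ≈ conj (t ⁻¹) g
  conjᵒ = solve 2 (λ t g → t ⊙ (g ⊙ t ⁻) ⊜ t ⁻ ⁻ ⊙ g ⊙ t ⁻) refl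

  -- Conjugation by `t` in the opposite group is conjugation by t⁻¹ in the original one, so the
  -- third generator is inverted.
  Structureᵒ : ∀ {k} → Qᵒ.Structure k → Structure k
  Structureᵒ str = record
    { a = a ; b = b ; t = t ⁻¹
    ; split     = record
      { commute = sym (Sᵒ.Split.commute split)
      ; conj-a  = resp (conjᵒ t a) (⟨⟩ᵒ (Sᵒ.Split.conj-a split))
      ; conj-b  = resp (conjᵒ t b) (⟨⟩ᵒ (Sᵒ.Split.conj-b split))
      }
    ; generated = λ j j<k → ⟨,,⟩-least ⟨⟩-isSubgroup gen₁ gen₂
        (resp (solve 1 (λ t → t ⁻ ⁻ ⊜ t) refl t) (inv gen₃)) (⟨⟩ᵒ (generated j j<k))
    } where open Qᵒ.Structure str

module NearCase {c ℓ ℓ₂} (G : OrderedGroup c ℓ ℓ₂)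
  (x : ℕ → OrderedGroup.Carrier G)
  (x-step : Increasing G x) (r : ℕ) where

  open OrderedGroup G renaming (_≤_ to infix 4 _≤_)
  open OrderTheory G
  open GroupNotions group
  open Subgroups group
  open Sequence G x x-step
  open FourLargest G x x-step r

  module _ (peel : PeelB (2 + r)) (peel′ : PeelA (1 + r))
           (above : CommAbove (1 + r) (3 + r)) where

    private
      open module B = PeelB-Analysis peel ℕ.≤-refl above {2 + r} ℕ.≤-refl (ℕ.n≤1+n _)
        (λ e → PeelA.noncommuting peel′ (sym e)) using (vˡ; generated)

    -- Here the element called `t` above is Z and the exceptional value is ZX. It exceeds WX and XW,
    -- so both are old. If XZ < ZX, then XZ is old too, and among the values in `>Z²` only ZY
    -- remains: YZ is too small, and Y² would make Z commute with Y.
    nearCase : X ∙ Z < Z ∙ X ⊎ (X ⟷ Z × Y ∙ Z < Z ∙ Y) → Structure (4 + r)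
    nearCase orientation = record
      { split     = Near.split (PeelB.commuting peel) (proj₂ (shift orientation))
                      (proj₁ (shift orientation)) peel′ WX-old XW-old
      ; generated = λ { j (s≤s j≤) → generated j j≤ }
      }
      where
      XZ≤ZX : X ∙ Z ≤ Z ∙ X
      XZ≤ZX = [ <⇒≤ , (λ q → ≤-reflexive (proj₁ q)) ]′ orientation
      WX-old : Old (3 + r) (W ∙ X)
      WX-old with PeelB.left peel r (ℕ.m≤n⇒m≤1+n ℕ.≤-refl)
      ... | inj₁ old = old
      ... | inj₂ e   = ⊥-elim (<-irrefl (trans e (sym (vˡ XZ≤ZX))) (∙-monoˡ-< X W<Z))
      XW-old : Old (3 + r) (X ∙ W)
      XW-old with PeelB.right peel r (ℕ.m≤n⇒m≤1+n ℕ.≤-refl)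
      ... | inj₁ old = old
      ... | inj₂ e   = ⊥-elim (<-irrefl (trans e (sym (vˡ XZ≤ZX))) (<-≤-trans (∙-monoʳ-< X W<Z) XZ≤ZX))
      shift : X ∙ Z < Z ∙ X ⊎ (X ⟷ Z × Y ∙ Z < Z ∙ Y) → (X ∙ Z ≈ Z ∙ Y ⊎ X ⟷ Z) × Y ∙ Z < Z ∙ Y
      shift (inj₂ (central , yz<zy)) = inj₂ central , yz<zy
      shift (inj₁ lt) with PeelB.right peel (1 + r) ℕ.≤-refl
      ... | inj₂ e   = ⊥-elim (<-irrefl (trans e (sym (vˡ (<⇒≤ lt)))) lt)
      ... | inj₁ old with >Z² peel′ old (∙-monoˡ-< Z Z<X)
      ...   | inj₁ e        = inj₁ e , <-≤-trans (∙-monoˡ-< Z Y<X) (≤-reflexive e)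
      ...   | inj₂ (inj₁ e) = ⊥-elim (<-irrefl (sym e) (∙-monoˡ-< Z Y<X))
      ...   | inj₂ (inj₂ e) = ⊥-elim (PeelA.noncommuting peel′ (sym
                (cancelˡ-∈ (centralizer-isSubgroup Y) (PeelB.commuting peel)
                  (IsSubgroup.≈∈ (centralizer-isSubgroup Y) (sym e)
                    (IsSubgroup.∙∈ (centralizer-isSubgroup Y) refl refl)))))

module TwoPeels {c ℓ ℓ₂} (G : OrderedGroup c ℓ ℓ₂)
  (x : ℕ → OrderedGroup.Carrier G)
  (x-step : Increasing G x) where

  open OrderedGroup G renaming (_≤_ to infix 4 _≤_)
  open OrderTheory G
  open GroupNotions group
  open Subgroups group
  open Sequence G x x-step public
  open Duality G x x-step
  open GroupSolver group using (solve; _⊜_; _⁻)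

  Decidable : ℕ → Set ℓ
  Decidable k = ∀ {a b i j} → a ℕ.< k → b ℕ.< k → i ℕ.< k → j ℕ.< k → Dec (x a ∙ x b ≈ x i ∙ x j)

  AllCommute : ℕ → Set ℓ
  AllCommute k = ∀ a b → a ℕ.< k → b ℕ.< k → x a ⟷ x b

  compare : ∀ {g h} → Dec (g ≈ h) → g < h ⊎ g ≈ h ⊎ h < g
  compare (yes e) = inj₂ (inj₁ e)
  compare {g} {h} (no ¬e) with total g h
  ... | inj₁ le = inj₁ (le , ¬e)
  ... | inj₂ le = inj₂ (inj₂ (le , λ e → ¬e (sym e)))

  Noncommuting : ℕ → Set ℓ
  Noncommuting m = Σ ℕ λ i → Σ ℕ λ l → i ℕ.< l × l ℕ.≤ m × CommAbove i m × ¬ x i ⟷ x l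

  noncommuting? : ∀ m → Decidable (suc m) → AllCommute (suc m) ⊎ Noncommuting m
  noncommuting? m dec = go (suc m) ℕ.≤-refl λ a b i<a a≤m _ _ → ⊥-elim (ℕ.<⇒≱ i<a a≤m)
    where
    CommFrom : ℕ → Set ℓ
    CommFrom i = ∀ a b → i ℕ.≤ a → a ℕ.≤ m → i ℕ.≤ b → b ℕ.≤ m → x a ⟷ x b
    go : ∀ i → i ℕ.≤ suc m → CommFrom i → AllCommute (suc m) ⊎ Noncommuting m
    go zero    _     com = inj₁ λ { a b (s≤s a≤) (s≤s b≤) → com a b z≤n a≤ z≤n b≤ }
    go (suc i) i<1+m com with search {P = λ l → i ℕ.< l × ¬ x i ⟷ x l} {Q = λ l → i ℕ.< l → x i ⟷ x l}
                                (suc m) decide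
      where
      decide : ∀ l → l ℕ.< suc m → (i ℕ.< l × ¬ x i ⟷ x l) ⊎ (i ℕ.< l → x i ⟷ x l)
      decide l l< with i ℕ.<? l | dec i<1+m l< l< i<1+m
      ... | no ¬i<l | _     = inj₂ λ i<l → ⊥-elim (¬i<l i<l)
      ... | yes i<l | no ¬e = inj₁ (i<l , ¬e)
      ... | yes i<l | yes e = inj₂ λ _ → e
    ... | inj₁ (l , s≤s l≤ , i<l , ¬e) = inj₂ (i , l , i<l , l≤ , com , ¬e)
    ... | inj₂ comᵢ = go i (ℕ.<⇒≤ i<1+m) com′
      where
      com′ : CommFrom i
      com′ a b i≤a a≤m i≤b b≤m with ℕ.m≤n⇒m<n∨m≡n i≤a | ℕ.m≤n⇒m<n∨m≡n i≤b
      ... | inj₁ i<a    | inj₁ i<b    = com a b i<a a≤m i<b b≤m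
      ... | inj₂ ≡.refl | inj₁ i<b    = comᵢ b (s≤s b≤m) i<b
      ... | inj₁ i<a    | inj₂ ≡.refl = sym (comᵢ a (s≤s a≤m) i<a)
      ... | inj₂ ≡.refl | inj₂ ≡.refl = refl

  -- The effect of conjugation with `t` on `g`. In `down` the element t⁻¹gt, in `up` the element
  -- tgt⁻¹, lies in `A` and is at most the next smaller element `g⁺`. This last bound makes the
  -- moves of two consecutive elements comparable.
  data Moves (A : Pred) (t g g⁺ : Carrier) : Set (c ⊔ ℓ ⊔ ℓ₂) where
    fixed : g ⟷ t → Moves A t g g⁺
    down  : g ∙ t < t ∙ g → A (conj t g) → g ∙ t ≤ t ∙ g⁺ → Moves A t g g⁺
    up    : t ∙ g < g ∙ t → A (conj (t ⁻¹) g) → t ∙ g ≤ g⁺ ∙ t → Moves A t g g⁺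

  moves-X : ∀ {p} (peel : PeelB p) {i} (i<p : i ℕ.< p) (above : CommAbove i (suc p))
            {l} (i<l : i ℕ.< l) (l≤ : l ℕ.≤ suc p) (noncommuting : ¬ x i ⟷ x l) →
            Decidable (2 + p) → Moves ⟨ x (suc p) ,, x p ⟩ (x i) (x (suc p)) (x p)
  moves-X {p} peel {i} i<p above {l} i<l l≤ noncommuting dec
    with compare (dec {suc p} {i} {i} {suc p} ℕ.≤-refl i< i< ℕ.≤-refl)
    where
    i< : i ℕ.< 2 + p
    i< = ℕ.m≤n⇒m≤1+n (ℕ.m≤n⇒m≤1+n i<p)
  ... | inj₁ lt = let a , b = PeelB-Analysis.conj-∈A peel i<p above i<l l≤ noncommuting lt in down lt a b
  ... | inj₂ (inj₁ e)  = fixed e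
  ... | inj₂ (inj₂ gt) =
        let a , b = Sequence.PeelB-Analysis.conj-∈A (opposite G) x x-step (PeelBᵒ peel) i<p
                      (CommAboveᵒ above) i<l l≤ (λ e → noncommuting (sym e)) gt
        in up gt (resp (conjᵒ (x i) (x (suc p))) (⟨⟩ᵒ a)) b

  module _ (r : ℕ) (dec : Decidable (4 + r)) where
    open FourLargest G x x-step r using (X; Y; Z; Y<X)

    private
      0< : 3 + r ℕ.< 4 + r
      0< = ℕ.≤-refl
      1< : 2 + r ℕ.< 4 + r
      1< = ℕ.m≤n⇒m≤1+n ℕ.≤-refl
      2< : 1 + r ℕ.< 4 + r
      2< = ℕ.m≤n⇒m≤1+n (ℕ.m≤n⇒m≤1+n ℕ.≤-refl)

      dec′ : Decidable (3 + r)
      dec′ a b i j = dec (ℕ.m≤n⇒m≤1+n a) (ℕ.m≤n⇒m≤1+n b) (ℕ.m≤n⇒m≤1+n i) (ℕ.m≤n⇒m≤1+n j)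

    module _ (peel : PeelB (2 + r)) {i} (i<p : i ℕ.< 2 + r) (above : CommAbove i (3 + r))
             {l} (i<l : i ℕ.< l) (l≤ : l ℕ.≤ 3 + r) (noncommuting : ¬ x i ⟷ x l) where

      private
        open module B = PeelB-Analysis peel i<p above i<l l≤ noncommuting using (t; A; generated; above∈A)

        by-moves : Moves A t X Y → Moves A t Y Z → Structure (4 + r)
        by-moves mX mY = [ strᵗ , strᵗ⁻¹ ]′ (direction mX mY)
          where
          fixed⁺ : ∀ {g} → A g → g ⟷ t → A (conj t g)
          fixed⁺ a e = resp (sym (conj-fixed e)) a
          fixed⁻ : ∀ {g} → A g → g ⟷ t → A (conj (t ⁻¹) g)
          fixed⁻ a e = resp (sym (conj-fixed (sym (IsSubgroup.⁻¹∈ (centralizer-isSubgroup _) (sym e))))) a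

          direction : Moves A t X Y → Moves A t Y Z →
            (A (conj t X) × A (conj t Y)) ⊎ (A (conj (t ⁻¹) X) × A (conj (t ⁻¹) Y))
          direction (fixed e)      (fixed f)      = inj₁ (fixed⁺ genˡ e , fixed⁺ genʳ f)
          direction (fixed e)      (down _ b _)   = inj₁ (fixed⁺ genˡ e , b)
          direction (fixed e)      (up _ b _)     = inj₂ (fixed⁻ genˡ e , b)
          direction (down _ a _)   (fixed f)      = inj₁ (a , fixed⁺ genʳ f)
          direction (down _ a _)   (down _ b _)   = inj₁ (a , b)
          direction (up _ a _)     (fixed f)      = inj₂ (a , fixed⁻ genʳ f)
          direction (up _ a _)     (up _ b _)     = inj₂ (a , b)
          -- Xt ≤ tY < Yt contradicts Y < X, so X and Y move in the same direction and one power of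
          -- `t` serves both.
          direction (down _ _ le)  (up lt _ _)    = ⊥-elim (<⇒≱ (≤-<-trans le lt) (∙-monoˡ-≤ t (<⇒≤ Y<X)))
          direction (up _ _ le)    (down lt _ _)  = ⊥-elim (<⇒≱ (≤-<-trans le lt) (∙-monoʳ-≤ t (<⇒≤ Y<X)))

          strᵗ : A (conj t X) × A (conj t Y) → Structure (4 + r)
          strᵗ (a , b) = record
            { split     = record { commute = PeelB.commuting peel ; conj-a = a ; conj-b = b }
            ; generated = λ { j (s≤s j≤) → generated j j≤ } }

          strᵗ⁻¹ : A (conj (t ⁻¹) X) × A (conj (t ⁻¹) Y) → Structure (4 + r)
          strᵗ⁻¹ (a , b) = record
            { split     = record { commute = PeelB.commuting peel ; conj-a = a ; conj-b = b }
            ; generated = λ { j (s≤s j≤) → ⟨,,⟩-least ⟨⟩-isSubgroup gen₁ gen₂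
                (resp (solve 1 (λ t → t ⁻ ⁻ ⊜ t) refl t) (inv gen₃)) (generated j j≤) } }

        mX : Moves A t X Y
        mX = moves-X peel i<p above i<l l≤ noncommuting dec

        i<1+p : i ℕ.< 4 + r
        i<1+p = ℕ.m≤n⇒m≤1+n (ℕ.m≤n⇒m≤1+n i<p)

        weaken : ∀ {g g⁺} → Moves ⟨ Y ,, Z ⟩ t g g⁺ → i ℕ.< 1 + r → Moves A t g g⁺
        weaken {g} {g⁺} m i<1+r = go m
          where
          sub : ∀ {h} → ⟨ Y ,, Z ⟩ h → A h
          sub = ⟨,⟩-least ⟨⟩-isSubgroup genʳ (above∈A (1 + r) i<1+r (ℕ.≤-pred 2<))
          go : Moves ⟨ Y ,, Z ⟩ t g g⁺ → Moves A t g g⁺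
          go (fixed e)    = fixed e
          go (down p q s) = down p (sub q) s
          go (up p q s)   = up p (sub q) s

      nearᴮ : i ≡ 1 + r → PeelA (1 + r) → Structure (4 + r)
      nearᴮ ≡.refl peel′ with compare (dec 0< 2< 2< 0<)
      ... | inj₁ lt        = NearCase.nearCase G x x-step r peel peel′ above (inj₁ lt)
      ... | inj₂ (inj₂ gt) = Structureᵒ (NearCase.nearCase (opposite G) x x-step r (PeelBᵒ peel)
              (PeelAᵒ peel′) (CommAboveᵒ above) (inj₁ gt))
      ... | inj₂ (inj₁ e) with compare (dec 1< 2< 2< 1<)
      ...   | inj₁ lt        = NearCase.nearCase G x x-step r peel peel′ above (inj₂ (e , lt))
      ...   | inj₂ (inj₁ f)  = ⊥-elim (PeelA.noncommuting peel′ f)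
      ...   | inj₂ (inj₂ gt) = Structureᵒ (NearCase.nearCase (opposite G) x x-step r (PeelBᵒ peel)
              (PeelAᵒ peel′) (CommAboveᵒ above) (inj₂ (sym e , gt)))

      -- If Y does not commute with `t`, its move comes from the second deletion, provided that this
      -- has type B. If it has type A, then Y and Z do not commute; since everything above `t`
      -- commutes, `t` is Z.
      farᴮ : PeelA (1 + r) ⊎ PeelB (1 + r) → Structure (4 + r)
      farᴮ peel′ with dec 1< i<1+p i<1+p 1<
      ... | yes e = by-moves mX (fixed e)
      ... | no ¬e with ℕ.m≤n⇒m<n∨m≡n (ℕ.≤-pred i<p) | peel′
      ...   | inj₂ i≡    | inj₁ A′ = nearᴮ i≡ A′
      ...   | inj₂ ≡.refl | inj₂ B′ = ⊥-elim (¬e (PeelB.commuting B′))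
      ...   | inj₁ i<1+r | inj₁ A′ = ⊥-elim (PeelA.noncommuting A′
              (above (2 + r) (1 + r) i<p (ℕ.n≤1+n _) i<1+r (ℕ.≤-pred 2<)))
      ...   | inj₁ i<1+r | inj₂ B′ = by-moves mX (weaken
              (moves-X B′ i<1+r (λ a b i<a a≤ i<b b≤ → above a b i<a (ℕ.m≤n⇒m≤1+n a≤) i<b (ℕ.m≤n⇒m≤1+n b≤))
                 i<p ℕ.≤-refl (λ f → ¬e (sym f)) dec′) i<1+r)

    peelB : PeelB (2 + r) → PeelA (1 + r) ⊎ PeelB (1 + r) → AllCommute (4 + r) ⊎ Structure (4 + r)
    peelB peel peel′ with noncommuting? (3 + r) dec
    ... | inj₁ com = inj₁ com
    ... | inj₂ (i , l , i<l , l≤ , above , ¬e) = inj₂ (farᴮ peel i<p above i<l l≤ ¬e peel′)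
      where
      i<p : i ℕ.< 2 + r
      i<p with ℕ.m≤n⇒m<n∨m≡n (ℕ.≤-pred (ℕ.≤-trans i<l l≤))
      ... | inj₁ lt = lt
      ... | inj₂ ≡.refl with ℕ.≤-antisym i<l l≤
      ...   | ≡.refl = ⊥-elim (¬e (sym (PeelB.commuting peel)))

    peelA : PeelA (2 + r) → PeelA (1 + r) ⊎ PeelB (1 + r) → Structure (4 + r)
    peelA peel peel′ with total (X ∙ Z) (Z ∙ X) | peel′
    ... | inj₁ le | inj₁ A′ = FourLargest.TypeA.peelAA G x x-step r peel le A′
    ... | inj₁ le | inj₂ B′ = ⊥-elim (FourLargest.TypeA.¬peelAB G x x-step r peel le B′)
    ... | inj₂ ge | inj₁ A′ = Structureᵒ (FourLargest.TypeA.peelAA (opposite G) x x-step r (PeelAᵒ peel) ge (PeelAᵒ A′))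
    ... | inj₂ ge | inj₂ B′ = ⊥-elim (FourLargest.TypeA.¬peelAB (opposite G) x x-step r (PeelAᵒ peel) ge (PeelBᵒ B′))

    twoPeels : PeelA (2 + r) ⊎ PeelB (2 + r) → PeelA (1 + r) ⊎ PeelB (1 + r) →
               AllCommute (4 + r) ⊎ Structure (4 + r)
    twoPeels (inj₁ A) peel′ = inj₂ (peelA A peel′)
    twoPeels (inj₂ B) peel′ = peelB B peel′

-- Counting products

-- Linear arithmetic by certificate: the hypotheses are added up to a ≤ b, the number `k` is the
-- slack, and the equation is left to the ring solver.
linear : ∀ {a b c d} k → a ℕ.≤ b → c + b + k ≡ d + a → c ℕ.≤ d
linear {a} {b} {c} {d} k a≤b e = ℕ.+-cancelʳ-≤ b c d (begin
  c + b         ≤⟨ ℕ.m≤m+n (c + b) k ⟩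
  c + b + k   ≡⟨ e ⟩
  d + a         ≤⟨ ℕ.+-monoʳ-≤ d a≤b ⟩
  d + b         ∎)
  where open ℕ.≤-Reasoning

searchList : ∀ {a b} {P : ℕ → Set a} {Q : ℕ → Set b} (T : List ℕ) → (∀ j → j ∈ T → P j ⊎ Q j) →
             (Σ ℕ λ j → j ∈ T × P j) ⊎ (∀ j → j ∈ T → Q j)
searchList [] f = inj₂ λ _ ()
searchList (t ∷ T) f with f t (here ≡.refl) | searchList T (λ j j∈ → f j (there j∈))
... | inj₁ p | _                 = inj₁ (t , here ≡.refl , p)
... | inj₂ _ | inj₁ (j , j∈ , p) = inj₁ (j , there j∈ , p)
... | inj₂ q | inj₂ qs           = inj₂ λ { j (here ≡.refl) → q ; j (there j∈) → qs j j∈ }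

Descending : List ℕ → Set
Descending = AllPairs ℕ._>_

downFrom-descending : ∀ n → Descending (downFrom n)
downFrom-descending zero    = []
downFrom-descending (suc n) = All.tabulate ∈.∈-downFrom⁻ ∷ downFrom-descending n

record Partition {a b} (n : ℕ) (P : ℕ → Set a) (Q : ℕ → Set b) : Set (a ⊔ b) where
  field
    I J       : List ℕ
    I-desc    : Descending I
    J-desc    : Descending J
    size      : length I + length J ≡ n
    I-<       : ∀ {j} → j ∈ I → j ℕ.< n
    J-<       : ∀ {j} → j ∈ J → j ℕ.< n
    I-P       : ∀ {j} → j ∈ I → P j
    J-Q       : ∀ {j} → j ∈ J → Q j
    cover     : ∀ j → j ℕ.< n → j ∈ I ⊎ j ∈ J
    disjoint  : ∀ {j} → j ∈ I → j ∈ J → ⊥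

partition : ∀ {a b} {P : ℕ → Set a} {Q : ℕ → Set b} n → (∀ j → j ℕ.< n → P j ⊎ Q j) → Partition n P Q
partition zero f = record
  { I = [] ; J = [] ; I-desc = [] ; J-desc = [] ; size = ≡.refl ; I-< = λ () ; J-< = λ ()
  ; I-P = λ () ; J-Q = λ () ; cover = λ _ () ; disjoint = λ () }
partition (suc n) f with partition n (λ j j< → f j (ℕ.m≤n⇒m≤1+n j<)) | f n ℕ.≤-refl
... | part | inj₁ p = record
  { I = n ∷ I ; J = J ; I-desc = All.tabulate I-< ∷ I-desc ; J-desc = J-desc
  ; size = ≡.cong suc size
  ; I-< = λ { (here ≡.refl) → ℕ.≤-refl ; (there j∈) → ℕ.m≤n⇒m≤1+n (I-< j∈) }
  ; J-< = λ j∈ → ℕ.m≤n⇒m≤1+n (J-< j∈)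
  ; I-P = λ { (here ≡.refl) → p ; (there j∈) → I-P j∈ }
  ; J-Q = J-Q
  ; cover = λ { j (s≤s j≤) → extend j (ℕ.m≤n⇒m<n∨m≡n j≤) }
  ; disjoint = λ { (here ≡.refl) j∈ → ℕ.<-irrefl ≡.refl (J-< j∈) ; (there i∈) j∈ → disjoint i∈ j∈ }
  }
  where
  open Partition part
  extend : ∀ j → j ℕ.< n ⊎ j ≡ n → j ∈ n ∷ I ⊎ j ∈ J
  extend j (inj₁ j<)     = map₁ there (cover j j<)
  extend j (inj₂ ≡.refl) = inj₁ (here ≡.refl)
... | part | inj₂ q = record
  { I = I ; J = n ∷ J ; I-desc = I-desc ; J-desc = All.tabulate J-< ∷ J-desc
  ; size = ≡.trans (ℕ.+-suc _ _) (≡.cong suc size)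
  ; I-< = λ j∈ → ℕ.m≤n⇒m≤1+n (I-< j∈)
  ; J-< = λ { (here ≡.refl) → ℕ.≤-refl ; (there j∈) → ℕ.m≤n⇒m≤1+n (J-< j∈) }
  ; I-P = I-P
  ; J-Q = λ { (here ≡.refl) → q ; (there j∈) → J-Q j∈ }
  ; cover = λ { j (s≤s j≤) → extend j (ℕ.m≤n⇒m<n∨m≡n j≤) }
  ; disjoint = λ { i∈ (here ≡.refl) → ℕ.<-irrefl ≡.refl (I-< i∈) ; i∈ (there j∈) → disjoint i∈ j∈ }
  }
  where
  open Partition part
  extend : ∀ j → j ℕ.< n ⊎ j ≡ n → j ∈ I ⊎ j ∈ n ∷ J
  extend j (inj₁ j<)     = map₂ there (cover j j<)
  extend j (inj₂ ≡.refl) = inj₂ (here ≡.refl)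

record Insertion (t : ℕ) (T : List ℕ) : Set where
  field
    T⁺     : List ℕ
    desc   : Descending T⁺
    size   : length T⁺ ≡ suc (length T)
    to     : ∀ {j} → j ∈ T⁺ → j ≡ t ⊎ j ∈ T
    from-t : t ∈ T⁺
    from   : ∀ {j} → j ∈ T → j ∈ T⁺

insertion : ∀ t T → Descending T → (t ∈ T → ⊥) → Insertion t T
insertion t [] d t∉ = record
  { T⁺ = t ∷ [] ; desc = [] ∷ [] ; size = ≡.refl ; to = λ { (here e) → inj₁ e }
  ; from-t = here ≡.refl ; from = λ () }
insertion t (s ∷ T) (s> ∷ d) t∉ with ℕ.<-cmp s t
... | tri< s<t _ _ = record
  { T⁺ = t ∷ s ∷ T ; desc = (s<t ∷ All.map (λ u<s → ℕ.<-trans u<s s<t) s>) ∷ s> ∷ d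
  ; size = ≡.refl ; to = λ { (here e) → inj₁ e ; (there j∈) → inj₂ j∈ }
  ; from-t = here ≡.refl ; from = there }
... | tri≈ _ s≡t _ = ⊥-elim (t∉ (here (≡.sym s≡t)))
... | tri> _ _ t<s = record
  { T⁺ = s ∷ T⁺ ; desc = All.tabulate below ∷ desc ; size = ≡.cong suc size
  ; to = λ { (here e) → inj₂ (here e) ; (there j∈) → map₂ there (to j∈) }
  ; from-t = there from-t ; from = λ { (here e) → here e ; (there j∈) → there (from j∈) } }
  where
  open Insertion (insertion t T d (λ t∈ → t∉ (there t∈)))
  below : ∀ {j} → j ∈ T⁺ → j ℕ.< s
  below j∈ with to j∈
  ... | inj₁ ≡.refl = t<s
  ... | inj₂ j∈T    = All.lookup s> j∈T

record Removal (t : ℕ) (T : List ℕ) : Set where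
  field
    T⁻   : List ℕ
    desc : Descending T⁻
    size : length T ≡ suc (length T⁻)
    to   : ∀ {j} → j ∈ T⁻ → j ∈ T
    t∉   : t ∈ T⁻ → ⊥
    from : ∀ {j} → j ∈ T → j ≡ t ⊎ j ∈ T⁻

removal : ∀ {t T} → Descending T → t ∈ T → Removal t T
removal {t} {_ ∷ T} (t> ∷ d) (here ≡.refl) = record
  { T⁻ = T ; desc = d ; size = ≡.refl ; to = there
  ; t∉ = λ t∈ → ℕ.<-irrefl ≡.refl (All.lookup t> t∈)
  ; from = λ { (here e) → inj₁ e ; (there j∈) → inj₂ j∈ } }
removal {t} {s ∷ T} (s> ∷ d) (there t∈) = record
  { T⁻ = s ∷ T⁻ ; desc = All.tabulate (λ j∈ → All.lookup s> (to j∈)) ∷ desc ; size = ≡.cong suc size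
  ; to = λ { (here e) → here e ; (there j∈) → there (to j∈) }
  ; t∉ = λ { (here ≡.refl) → ℕ.<-irrefl ≡.refl (All.lookup s> t∈) ; (there j∈) → t∉ j∈ }
  ; from = λ { (here e) → inj₂ (here e) ; (there j∈) → map₂ there (from j∈) } }
  where open Removal (removal d t∈)

module Counting {c ℓ ℓ₂} (G : OrderedGroup c ℓ ℓ₂)
  (x : ℕ → OrderedGroup.Carrier G)
  (x-step : Increasing G x) where

  open OrderedGroup G renaming (_≤_ to infix 4 _≤_)
  open OrderTheory G
  open GroupNotions group
  open Subgroups group
  open IsSubgroup
  open TwoPeels G x x-step
  open import Algebra.Properties.Group group using (∙-cancelˡ)

  -- e + |S_k²| ≤ n.
  Bound : ℕ → ℕ → ℕ → Set (c ⊔ ℓ)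
  Bound k e n = ∀ L → Distinct L → All (Old k) L → e + length L ℕ.≤ n

  distinct-++ : ∀ {p q} {P : Carrier → Set p} {Q : Carrier → Set q} {L M} → Distinct L → Distinct M →
                All P L → All Q M → (∀ {g h} → P g → Q h → g ≈ h → ⊥) → Distinct (L ++ M)
  distinct-++ dL dM aL aM sep = AllPairs.++⁺ dL dM (All.map (λ p → All.map (λ q → sep p q) aM) aL)

  New : ℕ → Carrier → Set ℓ
  New k u = Old (suc k) u × ¬ Old k u

  Old-suc : ∀ {k u} → Old k u → Old (suc k) u
  Old-suc (a , b , a< , b< , e) = a , b , ℕ.m≤n⇒m≤1+n a< , ℕ.m≤n⇒m≤1+n b< , e

  Old-resp : ∀ {k u v} → u ≈ v → Old k u → Old k v
  Old-resp u≈v (a , b , a< , b< , e) = a , b , a< , b< , trans (sym u≈v) e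

  shrink : ∀ {k e n} → Bound (suc k) e n → ∀ L → Distinct L → All (New k) L →
           Bound k (e + length L) n
  shrink {k} {e} {n} bound L dL aL M dM aM = ≡.subst (ℕ._≤ n)
    (≡.trans (≡.cong (e ℕ.+_) (List.length-++ L)) (≡.sym (ℕ.+-assoc e _ _)))
    (bound (L ++ M) (distinct-++ dL dM aL aM (λ { (_ , ¬old) old e → ¬old (Old-resp (sym e) old) }))
      (All.++⁺ (All.map proj₁ aL) (All.map Old-suc aM)))

  Product : ∀ {p q} → (ℕ → Set p) → (ℕ → Set q) → Carrier → Set (ℓ ⊔ p ⊔ q)
  Product P Q u = Σ ℕ λ i → Σ ℕ λ j → P i × Q j × u ≈ x i ∙ x j

  record Sumset (I J : List ℕ) (top : Carrier) : Set (c ⊔ ℓ ⊔ ℓ₂) where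
    field
      L        : List Carrier
      distinct : Distinct L
      below    : All (_≤ top) L
      products : All (Product (_∈ I) (_∈ J)) L
      size     : suc (length L) ≡ length I + length J

  -- The products decrease strictly along a staircase: the left index runs down through its list
  -- first, then the right one does so at the last left index. This gives |I| + |J| - 1 values.
  sumset : ∀ i I j J → Descending (i ∷ I) → Descending (j ∷ J) → Sumset (i ∷ I) (j ∷ J) (x i ∙ x j)
  sumset i [] j J _ dJ = record
    { L        = map (λ k → x i ∙ x k) (j ∷ J)
    ; distinct = AllPairs.map⁺ (AllPairs.map (λ l<k e → <-irrefl (sym (∙-cancelˡ _ _ _ e)) (x-< l<k)) dJ)
    ; below    = All.map⁺ (≤-refl ∷ All.map (λ k<j → ∙-monoʳ-≤ (x i) (<⇒≤ (x-< k<j))) (AllPairs.head dJ))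
    ; products = All.map⁺ (All.tabulate λ {k} k∈ → i , k , here ≡.refl , k∈ , refl)
    ; size     = ≡.cong (λ n → suc (suc n)) (List.length-map _ J)
    }
  sumset i (i′ ∷ I) j J ((i′<i ∷ _) ∷ dI) dJ = record
    { L        = x i ∙ x j ∷ L
    ; distinct = All.map (λ le e → <-irrefl (sym e) (≤-<-trans le lt)) below ∷ distinct
    ; below    = ≤-refl ∷ All.map (λ le → <⇒≤ (≤-<-trans le lt)) below
    ; products = (i , j , here ≡.refl , here ≡.refl , refl)
                 ∷ All.map (λ { (a , b , a∈ , b∈ , e) → a , b , there a∈ , b∈ , e }) products
    ; size     = ≡.cong suc size
    }
    where
    open Sumset (sumset i′ I j J dI dJ)
    lt : x i′ ∙ x j < x i ∙ x j
    lt = ∙-monoˡ-< (x j) (x-< i′<i)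

  squares : ∀ m → Sumset (downFrom (suc m)) (downFrom (suc m)) (x m ∙ x m)
  squares m = sumset m (downFrom m) m (downFrom m) (downFrom-descending (suc m)) (downFrom-descending (suc m))

  squares-Old : ∀ m → All (Old (suc m)) (Sumset.L (squares m))
  squares-Old m = All.map
    (λ { (a , b , a∈ , b∈ , e) → a , b , ∈.∈-downFrom⁻ a∈ , ∈.∈-downFrom⁻ b∈ , e }) (Sumset.products (squares m))

  Old? : ∀ k {K} → k ℕ.≤ K → Decidable K → ∀ {a b} → a ℕ.< K → b ℕ.< K → Dec (Old k (x a ∙ x b))
  Old? k k≤K dec {a} {b} a< b<
    with search {P = λ i → Σ ℕ λ j → j ℕ.< k × x a ∙ x b ≈ x i ∙ x j}
                {Q = λ i → ∀ j → j ℕ.< k → ¬ x a ∙ x b ≈ x i ∙ x j} k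
                (λ i i< → search k (λ j j< → decide i j i< j<))
    where
    decide : ∀ i j → i ℕ.< k → j ℕ.< k → x a ∙ x b ≈ x i ∙ x j ⊎ ¬ x a ∙ x b ≈ x i ∙ x j
    decide i j i< j< with dec a< b< (ℕ.≤-trans i< k≤K) (ℕ.≤-trans j< k≤K)
    ... | yes e = inj₁ e
    ... | no ¬e = inj₂ ¬e
  ... | inj₁ (i , i< , j , j< , e) = yes (i , j , i< , j< , e)
  ... | inj₂ none                  = no λ { (i , j , i< , j< , e) → none i i< j j< e }

  -- Nothing but X² and XY = YX is removed.
  record Peel₀ (p : ℕ) : Set ℓ where
    field
      commuting : x (suc p) ⟷ x p
      left      : ∀ j → j ℕ.< p → Old (suc p) (x j ∙ x (suc p))
      right     : ∀ j → j ℕ.< p → Old (suc p) (x (suc p) ∙ x j)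

  Peel₀-generated : ∀ {p q} → Peel₀ p → {Q : Carrier → Set q} → IsSubgroup Q →
                    Q (x (suc p)) → Q (x p) → ∀ j → j ℕ.≤ suc p → Q (x j)
  Peel₀-generated peel sub QX QY = generated-by-top sub QX QY
    (λ j j<p → inj₁ (left j j<p)) (λ j j<p → inj₁ (right j j<p))
    where open Peel₀ peel

  Peel₀-commute : ∀ {p} → Peel₀ p → AllCommute (2 + p)
  Peel₀-commute {p} peel a b (s≤s a≤) (s≤s b≤) = ⟨⟩-abelian pairwise (span a a≤) (span b b≤)
    where
    span : ∀ j → j ℕ.≤ suc p → ⟨ x (suc p) ,, x p ⟩ (x j)
    span = Peel₀-generated peel ⟨⟩-isSubgroup genˡ genʳ
    pairwise : ∀ {g h} → Mem (x (suc p) ∷ x p ∷ []) g → Mem (x (suc p) ∷ x p ∷ []) h → g ⟷ h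
    pairwise (here e)         (here f)         = trans (∙-cong e f) (sym (∙-cong f e))
    pairwise (here e)         (there (here f)) = trans (∙-cong e f) (trans (Peel₀.commuting peel) (sym (∙-cong f e)))
    pairwise (there (here e)) (here f)         = trans (∙-cong e f) (trans (sym (Peel₀.commuting peel)) (sym (∙-cong f e)))
    pairwise (there (here e)) (there (here f)) = trans (∙-cong e f) (sym (∙-cong f e))

  data Peel (p e n : ℕ) : Set (c ⊔ ℓ) where
    four : Bound (1 + p) (e + 4) n → Peel p e n
    typeA : PeelA p → Bound (1 + p) (e + 3) n → Peel p e n
    typeB : PeelB p → Bound (1 + p) (e + 3) n → Peel p e n
    none : Peel₀ p → Peel p e n

  module _ (p : ℕ) {e n} (bound : Bound (2 + p) e n) (dec : Decidable (2 + p)) where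

    private
      X = x (suc p)
      Y = x p
      X< : suc p ℕ.< 2 + p
      X< = ℕ.≤-refl
      Y< : p ℕ.< 2 + p
      Y< = ℕ.m≤n⇒m≤1+n ℕ.≤-refl
      Y<X : Y < X
      Y<X = x-step p

      <p : ∀ {j} → j ℕ.< p → j ℕ.< 2 + p
      <p j<p = ℕ.m≤n⇒m≤1+n (ℕ.m≤n⇒m≤1+n j<p)

      large : ∀ {a b} → a ℕ.< 2 + p → b ℕ.< 2 + p → Y ∙ Y < x a ∙ x b → New (suc p) (x a ∙ x b)
      large a< b< lt = (_ , _ , a< , b< , refl) , λ old → <⇒≱ lt (Old-≤ old)

      XX-new : New (suc p) (X ∙ X)
      XX-new = large X< X< (∙-mono-< Y<X Y<X)
      XY-new : New (suc p) (X ∙ Y)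
      XY-new = large X< Y< (∙-monoˡ-< Y Y<X)
      YX-new : New (suc p) (Y ∙ X)
      YX-new = large Y< X< (∙-monoʳ-< Y Y<X)

      XY<XX : X ∙ Y < X ∙ X
      XY<XX = ∙-monoʳ-< X Y<X
      YX<XX : Y ∙ X < X ∙ X
      YX<XX = ∙-monoˡ-< X Y<X

      <⇒≉ : ∀ {g h} → g < h → h ≈ g → ⊥
      <⇒≉ lt e = <-irrefl (sym e) lt

      old? : ∀ {a b} → a ℕ.< 2 + p → b ℕ.< 2 + p → Dec (Old (suc p) (x a ∙ x b))
      old? = Old? (suc p) (ℕ.n≤1+n _) dec

      classify : ∀ {a b i j} → a ℕ.< 2 + p → b ℕ.< 2 + p → i ℕ.< 2 + p → j ℕ.< 2 + p →
                 (New (suc p) (x a ∙ x b) × ¬ x a ∙ x b ≈ x i ∙ x j) ⊎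
                 (Old (suc p) (x a ∙ x b) ⊎ x a ∙ x b ≈ x i ∙ x j)
      classify a< b< i< j< with old? a< b< | dec a< b< i< j<
      ... | yes old | _     = inj₂ (inj₁ old)
      ... | no _    | yes f = inj₂ (inj₂ f)
      ... | no ¬old | no ¬f = inj₁ (((_ , _ , a< , b< , refl) , ¬old) , ¬f)

      data Mixed (u : Carrier) : Set ℓ where
        mixedˡ : ∀ {j} → j ℕ.< p → u ≈ x j ∙ X → Mixed u
        mixedʳ : ∀ {j} → j ℕ.< p → u ≈ X ∙ x j → Mixed u

      three : ∀ g → New (suc p) g → (X ∙ Y ≈ g → ⊥) → (g < X ∙ X) → Bound (1 + p) (e + 3) n
      three g g-new XY≉g g<XX = shrink bound (X ∙ X ∷ X ∙ Y ∷ g ∷ [])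
        ((<⇒≉ XY<XX ∷ <⇒≉ g<XX ∷ []) ∷ (XY≉g ∷ []) ∷ [] ∷ [])
        (XX-new ∷ XY-new ∷ g-new ∷ [])

      four-new : ∀ g h → New (suc p) g → New (suc p) h → (X ∙ Y ≈ g → ⊥) → (X ∙ Y ≈ h → ⊥) →
                 (g ≈ h → ⊥) → g < X ∙ X → h < X ∙ X → Bound (1 + p) (e + 4) n
      four-new g h g-new h-new XY≉g XY≉h g≉h g<XX h<XX = shrink bound (X ∙ X ∷ X ∙ Y ∷ g ∷ h ∷ [])
        ((<⇒≉ XY<XX ∷ <⇒≉ g<XX ∷ <⇒≉ h<XX ∷ []) ∷ (XY≉g ∷ XY≉h ∷ []) ∷ (g≉h ∷ []) ∷ [] ∷ [])
        (XX-new ∷ XY-new ∷ g-new ∷ h-new ∷ [])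

      xX<YX : ∀ {j} → j ℕ.< p → x j ∙ X < Y ∙ X
      xX<YX j<p = ∙-monoˡ-< X (x-< j<p)
      Xx<XY : ∀ {j} → j ℕ.< p → X ∙ x j < X ∙ Y
      Xx<XY j<p = ∙-monoʳ-< X (x-< j<p)

      peel-noncommuting : ¬ X ⟷ Y → Peel p e n
      peel-noncommuting ¬XY with search p
        (λ j j<p → classify {j} {suc p} {suc p} {p} (<p j<p) X< X< Y<)
        | search p (λ j j<p → classify {suc p} {j} {p} {suc p} X< (<p j<p) Y< X<)
      ... | inj₁ (j , j<p , w-new , w≉) | _ = four (four-new (Y ∙ X) (x j ∙ X) YX-new w-new
              ¬XY (λ f → w≉ (sym f)) (<⇒≉ (xX<YX j<p)) YX<XX (<-trans (xX<YX j<p) YX<XX))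
      ... | inj₂ _ | inj₁ (j , j<p , w-new , w≉) = four (four-new (Y ∙ X) (X ∙ x j) YX-new w-new
              ¬XY (<⇒≉ (Xx<XY j<p)) (λ f → w≉ (sym f)) YX<XX (<-trans (Xx<XY j<p) XY<XX))
      ... | inj₂ left | inj₂ right = typeA
              (record { noncommuting = ¬XY ; left = left ; right = right })
              (three (Y ∙ X) YX-new ¬XY YX<XX)

      module _ (XY : X ⟷ Y) where

        mixed<XY : ∀ {u} → Mixed u → u < X ∙ Y
        mixed<XY (mixedˡ j<p f) = ≤-<-trans (≤-reflexive f) (<-≤-trans (xX<YX j<p) (≤-reflexive (sym XY)))
        mixed<XY (mixedʳ j<p f) = ≤-<-trans (≤-reflexive f) (Xx<XY j<p)

        -- Besides X² and XY a third new value is known. Any further new mixed product that differs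
        -- from it is a fourth; if there is none, this value is the `v` of `PeelB`.
        with-new : ∀ {a b} → a ℕ.< 2 + p → b ℕ.< 2 + p →
                   New (suc p) (x a ∙ x b) → Mixed (x a ∙ x b) → Peel p e n
        with-new {a} {b} a< b< v-new v-mixed with search p
          (λ j j<p → classify {j} {suc p} (<p j<p) X< a< b<)
          | search p (λ j j<p → classify {suc p} {j} X< (<p j<p) a< b<)
        ... | inj₁ (j , j<p , w-new , w≉) | _ = four (second w-new w≉ (mixedˡ j<p refl))
          where
          second : ∀ {w} → New (suc p) w → ¬ w ≈ x a ∙ x b → Mixed w → Bound (1 + p) (e + 4) n
          second w-new w≉ w-mixed = four-new (x a ∙ x b) _ v-new w-new
            (<⇒≉ (mixed<XY v-mixed)) (<⇒≉ (mixed<XY w-mixed)) (λ f → w≉ (sym f))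
            (<-trans (mixed<XY v-mixed) XY<XX) (<-trans (mixed<XY w-mixed) XY<XX)
        ... | inj₂ _ | inj₁ (j , j<p , w-new , w≉) = four (four-new (x a ∙ x b) _ v-new w-new
            (<⇒≉ (mixed<XY v-mixed)) (<⇒≉ (Xx<XY j<p)) (λ f → w≉ (sym f))
            (<-trans (mixed<XY v-mixed) XY<XX) (<-trans (Xx<XY j<p) XY<XX))
        ... | inj₂ left | inj₂ right = typeB
            (record { commuting = XY ; v = x a ∙ x b ; left = left ; right = right })
            (three (x a ∙ x b) v-new (<⇒≉ (mixed<XY v-mixed)) (<-trans (mixed<XY v-mixed) XY<XX))

        peel-commuting : Peel p e n
        peel-commuting with search p (λ j j<p → new? {j} {suc p} (<p j<p) X<)
                          | search p (λ j j<p → new? {suc p} {j} X< (<p j<p))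
          where
          new? : ∀ {a b} → a ℕ.< 2 + p → b ℕ.< 2 + p →
                 New (suc p) (x a ∙ x b) ⊎ Old (suc p) (x a ∙ x b)
          new? a< b< with old? a< b<
          ... | yes old = inj₂ old
          ... | no ¬old = inj₁ ((_ , _ , a< , b< , refl) , ¬old)
        ... | inj₁ (j , j<p , v-new) | _ = with-new (<p j<p) X< v-new (mixedˡ j<p refl)
        ... | inj₂ _ | inj₁ (j , j<p , v-new) = with-new X< (<p j<p) v-new (mixedʳ j<p refl)
        ... | inj₂ left | inj₂ right = none (record { commuting = XY ; left = left ; right = right })

    peel : Peel p e n
    peel with dec X< Y< Y< X<
    ... | no ¬XY = peel-noncommuting ¬XY
    ... | yes XY = peel-commuting XY

-- Induction on the doubling

leastCounterexample : ∀ {a} {C : ℕ → Set a} n → (∀ j → j ℕ.< n → Dec (C j)) →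
  (Σ ℕ λ j → j ℕ.< n × ¬ C j × (∀ i → i ℕ.< j → C i)) ⊎ (∀ j → j ℕ.< n → C j)
leastCounterexample zero d = inj₂ λ _ ()
leastCounterexample (suc n) d with leastCounterexample n (λ j j< → d j (ℕ.m≤n⇒m≤1+n j<)) | d n ℕ.≤-refl
... | inj₁ (j , j< , ¬c , least) | _     = inj₁ (j , ℕ.m≤n⇒m≤1+n j< , ¬c , least)
... | inj₂ all                   | no ¬c = inj₁ (n , ℕ.≤-refl , ¬c , all)
... | inj₂ all                   | yes q = inj₂ λ { j (s≤s j≤) → extend j (ℕ.m≤n⇒m<n∨m≡n j≤) }
  where
  extend : ∀ j → j ℕ.< n ⊎ j ≡ n → _
  extend j (inj₁ j<)     = all j j<
  extend j (inj₂ ≡.refl) = q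

module Induction {c ℓ ℓ₂} (G : OrderedGroup c ℓ ℓ₂)
  (x : ℕ → OrderedGroup.Carrier G)
  (x-step : Increasing G x) where

  open OrderedGroup G renaming (_≤_ to infix 4 _≤_)
  open OrderTheory G
  open GroupNotions group
  open Subgroups group
  open IsSubgroup
  open TwoPeels G x x-step
  open Counting G x x-step
  open GroupSolver group using (solve; _⊜_; _⊙_; _⁻)

  restrict : ∀ {k} → Decidable (suc k) → Decidable k
  restrict dec a b i j = dec (ℕ.m≤n⇒m≤1+n a) (ℕ.m≤n⇒m≤1+n b) (ℕ.m≤n⇒m≤1+n i) (ℕ.m≤n⇒m≤1+n j)

  Fresh : ℕ → Set ℓ
  Fresh m = ∀ j → j ℕ.< m → ¬ Old m (x j ∙ x m) × ¬ Old m (x m ∙ x j)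

  Reached : ℕ → Set ℓ
  Reached m = Σ ℕ λ j → j ℕ.< m × (Old m (x j ∙ x m) ⊎ Old m (x m ∙ x j))

  reached? : ∀ m → Decidable (suc m) → Reached m ⊎ Fresh m
  reached? m dec = search m λ j j<m → decide j (ℕ.m≤n⇒m≤1+n j<m)
    where
    decide : ∀ j → j ℕ.< suc m → (Old m (x j ∙ x m) ⊎ Old m (x m ∙ x j)) ⊎
                                  (¬ Old m (x j ∙ x m) × ¬ Old m (x m ∙ x j))
    decide j j< with Old? m (ℕ.n≤1+n m) dec {j} {m} j< ℕ.≤-refl | Old? m (ℕ.n≤1+n m) dec {m} {j} ℕ.≤-refl j<
    ... | yes p | _     = inj₁ (inj₁ p)
    ... | no _  | yes q = inj₁ (inj₂ q)
    ... | no ¬p | no ¬q = inj₂ (¬p , ¬q)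

  Reached-∈ : ∀ {m q} {Q : Carrier → Set q} → IsSubgroup Q → Reached m →
              (∀ j → j ℕ.< m → Q (x j)) → Q (x m)
  Reached-∈ {Q = Q} sub (j , j<m , old) on = [ fromˡ , fromʳ ]′ old
    where
    Old-∈ : ∀ {u} → Old _ u → Q u
    Old-∈ (a , b , a< , b< , e) = ≈∈ sub (sym e) (∙∈ sub (on a a<) (on b b<))
    fromˡ : Old _ (x j ∙ x _) → Q (x _)
    fromˡ old = cancelˡ-∈ sub (on j j<m) (Old-∈ old)
    fromʳ : Old _ (x _ ∙ x j) → Q (x _)
    fromʳ old = cancelʳ-∈ sub (on j j<m) (Old-∈ old)

  extend : ∀ {q} {Q : ℕ → Set q} {m} → (∀ j → j ℕ.< m → Q j) → Q m → ∀ j → j ℕ.< suc m → Q j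
  extend on q j (s≤s j≤) with ℕ.m≤n⇒m<n∨m≡n j≤
  ... | inj₁ j<     = on j j<
  ... | inj₂ ≡.refl = q

  commute-suc : ∀ {m} → AllCommute m → (∀ j → j ℕ.< m → x m ⟷ x j) → AllCommute (suc m)
  commute-suc {m} com on a b a< b< = extend {Q = λ a → x a ⟷ x b}
    (λ a a<m → extend {Q = λ b → x a ⟷ x b} (λ b b<m → com a b a<m b<m) (sym (on a a<m)) b b<)
    (extend {Q = λ b → x m ⟷ x b} on refl b b<) a a<

  AllCommute-Reached : ∀ {m} → AllCommute m → Reached m → AllCommute (suc m)
  AllCommute-Reached com reached = commute-suc com λ j j< →
    Reached-∈ (centralizer-isSubgroup (x j)) reached (λ i i< → com i j i< j<)

  -- For {f j, g j} = {Xxⱼ, xⱼX}, X = x_m.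
  module Rows (m : ℕ) (f g : ℕ → Carrier)
    (f-mono : ∀ {i j} → i ℕ.< j → f i < f j) (g-mono : ∀ {i j} → i ℕ.< j → g i < g j)
    (f-new : ∀ j → j ℕ.< m → New m (f j)) (g-new : ∀ j → j ℕ.< m → New m (g j))
    (f-< : ∀ j → j ℕ.< m → f j < x m ∙ x m) (g-< : ∀ j → j ℕ.< m → g j < x m ∙ x m)
    (V : List ℕ) (V-desc : Descending V) (V-< : ∀ {j} → j ∈ V → j ℕ.< m)
    (separate : ∀ {j} → j ∈ V → ∀ i → i ℕ.< m → f i ≈ g j → ⊥) where

    rows : List Carrier
    rows = map f (downFrom m) ++ map g V ++ (x m ∙ x m) ∷ []

    rows-distinct : Distinct rows
    rows-distinct = AllPairs.++⁺
      (AllPairs.map⁺ (AllPairs.map (λ j<i e → <-irrefl (sym e) (f-mono j<i)) (downFrom-descending m)))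
      (AllPairs.++⁺
        (AllPairs.map⁺ (AllPairs.map (λ j<i e → <-irrefl (sym e) (g-mono j<i)) V-desc))
        ([] ∷ [])
        (All.map⁺ (All.tabulate λ j∈ → (λ e → <-irrefl e (g-< _ (V-< j∈))) ∷ [])))
      (All.map⁺ (All.tabulate λ i∈ → All.++⁺
        (All.map⁺ (All.tabulate λ j∈ → separate j∈ _ (∈.∈-downFrom⁻ i∈)))
        ((λ e → <-irrefl e (f-< _ (∈.∈-downFrom⁻ i∈))) ∷ [])))

    XX-new : ∀ k → k ≡ m → New k (x k ∙ x k)
    XX-new k _ = (k , k , ℕ.≤-refl , ℕ.≤-refl , refl) ,
      λ { (a , b , a< , b< , e) → <-irrefl (sym e) (∙-mono-< (x-< a<) (x-< b<)) }

    rows-new : All (New m) rows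
    rows-new = All.++⁺ (All.map⁺ (All.tabulate λ i∈ → f-new _ (∈.∈-downFrom⁻ i∈)))
      (All.++⁺ (All.map⁺ (All.tabulate λ j∈ → g-new _ (V-< j∈))) (XX-new m ≡.refl ∷ []))

    rows-length : length rows ≡ m + (length V + 1)
    rows-length = ≡.trans (List.length-++ (map f (downFrom m))) (≡.cong₂ ℕ._+_
      (≡.trans (List.length-map f (downFrom m)) (List.length-downFrom m))
      (≡.trans (List.length-++ (map g V)) (≡.cong (_+ 1) (List.length-map g V))))

    shrink-rows : ∀ {e n} → Bound (suc m) e n → Bound m (e + (m + (length V + 1))) n
    shrink-rows {e} {n} bound = ≡.subst (λ l → Bound m (e + l) n) rows-length
      (shrink bound rows rows-distinct rows-new)

  module FreshRows {m : ℕ} (fresh : Fresh m) where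
    f g : ℕ → Carrier
    f j = x m ∙ x j
    g j = x j ∙ x m
    f-mono : ∀ {i j} → i ℕ.< j → f i < f j
    f-mono i<j = ∙-monoʳ-< (x m) (x-< i<j)
    g-mono : ∀ {i j} → i ℕ.< j → g i < g j
    g-mono i<j = ∙-monoˡ-< (x m) (x-< i<j)
    f-new : ∀ j → j ℕ.< m → New m (f j)
    f-new j j< = (m , j , ℕ.≤-refl , ℕ.m≤n⇒m≤1+n j< , refl) , proj₂ (fresh j j<)
    g-new : ∀ j → j ℕ.< m → New m (g j)
    g-new j j< = (j , m , ℕ.m≤n⇒m≤1+n j< , ℕ.≤-refl , refl) , proj₁ (fresh j j<)
    f-< : ∀ j → j ℕ.< m → f j < x m ∙ x m
    f-< j = f-mono
    g-< : ∀ j → j ℕ.< m → g j < x m ∙ x m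
    g-< j = g-mono
    module Left  = Rows m f g f-mono g-mono f-new g-new f-< g-<
    module Right = Rows m g f g-mono f-mono g-new f-new g-< f-<

  lower-bound : ∀ {m e n} → Bound (suc m) e n → e + (m + suc m) ℕ.≤ n
  lower-bound {m} {e} bound = ≡.subst (λ l → e + l ℕ.≤ _) length≡
    (bound (Sumset.L (squares m)) (Sumset.distinct (squares m)) (squares-Old m))
    where
    length≡ : length (Sumset.L (squares m)) ≡ m + suc m
    length≡ = ℕ.suc-injective (≡.trans (Sumset.size (squares m))
      (≡.cong₂ ℕ._+_ (List.length-downFrom (suc m)) (List.length-downFrom (suc m))))

  -- Let X = x_m be fresh and j least with Xx_j ≠ x_jX. The smaller of these two products is missing
  -- from the row of the other: the rows agree before j and the other row is too large from j on.
  -- With X² this makes m + 2 new products, and S_m² has at least 2m - 1, which exceeds 3m in total.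
  abelian-step : ∀ {p e n} → AllCommute (suc p) → Bound (2 + p) e n → n ℕ.≤ 3 * suc p + e →
                 Decidable (2 + p) → AllCommute (2 + p)
  abelian-step {p} {e} {n} com bound n≤ dec with reached? (suc p) dec
  ... | inj₁ reached = AllCommute-Reached com reached
  ... | inj₂ fresh with leastCounterexample {C = λ j → x (suc p) ⟷ x j} (suc p)
                          (λ j j< → dec ℕ.≤-refl (ℕ.m≤n⇒m≤1+n j<) (ℕ.m≤n⇒m≤1+n j<) ℕ.≤-refl)
  ...   | inj₂ on = commute-suc com on
  ...   | inj₁ (j , j<m , ¬com , least) = ⊥-elim (ℕ.<⇒≱ (too-many (larger (total (g j) (f j)))) n≤)
    where
    open FreshRows fresh
    m = suc p
    V-< : ∀ {i} → i ∈ j ∷ [] → i ℕ.< m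
    V-< (here ≡.refl) = j<m
    larger : g j ≤ f j ⊎ f j ≤ g j → Bound (suc p) (e + (m + 2)) n
    larger (inj₁ le) = Left.shrink-rows (j ∷ []) ([] ∷ []) V-< (λ { (here ≡.refl) → separate }) bound
      where
      separate : ∀ i → i ℕ.< m → f i ≈ g j → ⊥
      separate i i<m fi≈gj with ℕ.<-cmp i j
      ... | tri< i<j _ _    = <-irrefl (trans (sym (least i i<j)) fi≈gj) (g-mono i<j)
      ... | tri≈ _ ≡.refl _ = ¬com fi≈gj
      ... | tri> _ _ j<i    = <-irrefl (sym fi≈gj) (≤-<-trans le (f-mono j<i))
    larger (inj₂ le) = Right.shrink-rows (j ∷ []) ([] ∷ []) V-< (λ { (here ≡.refl) → separate }) bound
      where
      separate : ∀ i → i ℕ.< m → g i ≈ f j → ⊥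
      separate i i<m gi≈fj with ℕ.<-cmp i j
      ... | tri< i<j _ _    = <-irrefl (trans (least i i<j) gi≈fj) (f-mono i<j)
      ... | tri≈ _ ≡.refl _ = ¬com (sym gi≈fj)
      ... | tri> _ _ j<i    = <-irrefl (sym gi≈fj) (≤-<-trans le (g-mono j<i))
    too-many : Bound (suc p) (e + (m + 2)) n → 3 * suc p + e ℕ.< n
    too-many bound′ = linear 0 (lower-bound bound′) (eq e p n)
      where
      eq : ∀ e p n → 1 + (3 * (1 + p) + e) + n + 0 ≡
                     n + (e + ((1 + p) + 2) + (p + (1 + p)))
      eq = solve-∀

  none-or-three : ∀ {p e n} → Peel p e n → Peel₀ p ⊎ Bound (1 + p) (e + 3) n
  none-or-three (none p₀)       = inj₁ p₀
  none-or-three (typeA _ bound) = inj₂ bound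
  none-or-three (typeB _ bound) = inj₂ bound
  none-or-three {e = e} (four bound) = inj₂ λ L d a →
    ℕ.≤-trans (ℕ.+-monoˡ-≤ (length L) (ℕ.+-monoʳ-≤ e (ℕ.n≤1+n 3))) (bound L d a)

  -- |S²| ≤ 3|S| − 3 forces S to be commutative.
  abelian-small : ∀ m {e n} → Bound (suc m) e n → n ℕ.≤ 3 * m + e → Decidable (suc m) →
                  AllCommute (suc m)
  abelian-small zero    bound n≤ dec zero zero _ _ = refl
  abelian-small zero    bound n≤ dec (suc a) _ (s≤s ()) _
  abelian-small zero    bound n≤ dec zero (suc b) _ (s≤s ())
  abelian-small (suc p) {e} {n} bound n≤ dec with none-or-three (peel p bound dec)
  ... | inj₁ p₀     = Peel₀-commute p₀
  ... | inj₂ bound′ = abelian-step (abelian-small p bound′ (linear 0 n≤ (eq e p n)) (restrict dec)) bound n≤ dec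
    where
    eq : ∀ e p n → n + (3 * (1 + p) + e) + 0 ≡ 3 * p + (e + 3) + n
    eq = solve-∀

  -- What is kept of an arithmetic progression: two commuting elements that generate the same
  -- subgroup as S_k. The field `least` states one inclusion by testing against all subgroups.
  record TwoGenerated (k : ℕ) : Set (Level.suc (c ⊔ ℓ)) where
    field
      {a b}   : Carrier
      commute : a ⟷ b
      least   : ∀ {Q : Pred} → IsSubgroup Q → (∀ j → j ℕ.< k → Q (x j)) → Q a × Q b
      spans   : ∀ j → j ℕ.< k → ⟨ a ,, b ⟩ (x j)

  -- |S²| ≤ 3|S| − 4 forces a commutative S to lie in an arithmetic progression.
  two-generated : ∀ m {e n} → AllCommute (suc m) → Bound (suc m) e n → suc n ℕ.≤ 3 * m + e →
                  Decidable (suc m) → TwoGenerated (suc m)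
  two-generated zero {e} {n} com bound n< dec = ⊥-elim (ℕ.<⇒≱ n< (≡.subst (ℕ._≤ n) (ℕ.+-identityʳ e) (bound [] [] [])))
  two-generated (suc p) {e} {n} com bound n< dec with none-or-three (peel p bound dec)
  ... | inj₁ p₀ = record
    { a       = x (suc p) ; b = x p
    ; commute = Peel₀.commuting p₀
    ; least   = λ sub on → on (suc p) ℕ.≤-refl , on p (ℕ.m≤n⇒m≤1+n ℕ.≤-refl)
    ; spans   = λ { j (s≤s j≤) → Peel₀-generated p₀ ⟨⟩-isSubgroup genˡ genʳ j j≤ }
    }
  ... | inj₂ bound′ = record
    { commute = commute
    ; least   = λ sub on → least sub (λ j j< → on j (ℕ.m≤n⇒m≤1+n j<))
    ; spans   = extend {Q = λ j → ⟨ a ,, b ⟩ (x j)} spans (top (reached? (suc p) dec))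
    }
    where
    eq₀ : ∀ e p n → 1 + n + (3 * (1 + p) + e) + 0 ≡ 3 * p + (e + 3) + (1 + n)
    eq₀ = solve-∀
    open TwoGenerated (two-generated p
      (λ a b a< b< → com a b (ℕ.m≤n⇒m≤1+n a<) (ℕ.m≤n⇒m≤1+n b<)) bound′ (linear 0 n< (eq₀ e p n)) (restrict dec))
    top : Reached (suc p) ⊎ Fresh (suc p) → ⟨ a ,, b ⟩ (x (suc p))
    top (inj₁ reached) = Reached-∈ ⟨⟩-isSubgroup reached spans
    top (inj₂ fresh)   = ⊥-elim (ℕ.<⇒≱ (linear 0 (ℕ.+-mono-≤ n< (lower-bound
        (FreshRows.Left.shrink-rows fresh [] [] (λ ()) (λ ()) bound))) (eq e p n)) ℕ.≤-refl)
      where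
      eq : ∀ e p n → 1 + n + (3 * (1 + p) + e + n) + 0 ≡
                     n + (1 + n + (e + ((1 + p) + (0 + 1)) + (p + (1 + p))))
      eq = solve-∀

  -- If X = x_m is not reached from S_m, then S_m lies in an arithmetic progression and most of it
  -- is mapped into S_m by conjugation with X.
  module Unreached {p r e n : ℕ} (2r+3≤p : 2 * r + 3 ℕ.≤ p) (bound : Bound (2 + p) e n)
    (n≤ : n ℕ.≤ 3 * (1 + p) + (1 + r) + e) (dec : Decidable (2 + p)) (fresh : Fresh (1 + p)) where

    m = 1 + p
    X = x m

    Kept Moved : ℕ → Set ℓ
    Kept j  = Σ ℕ λ i → i ℕ.< m × x j ∙ X ≈ X ∙ x i
    Moved j = ∀ i → i ℕ.< m → ¬ X ∙ x i ≈ x j ∙ X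

    kept? : Partition m Kept Moved
    kept? = partition m λ j j<m → search m λ i i<m → decide j i j<m i<m
      where
      decide : ∀ j i → j ℕ.< m → i ℕ.< m → x j ∙ X ≈ X ∙ x i ⊎ ¬ X ∙ x i ≈ x j ∙ X
      decide j i j<m i<m with dec (ℕ.m≤n⇒m≤1+n j<m) ℕ.≤-refl ℕ.≤-refl (ℕ.m≤n⇒m≤1+n i<m)
      ... | yes f = inj₁ f
      ... | no ¬f = inj₂ λ f → ¬f (sym f)

    open Partition kept? renaming (I to U; J to V)

    u v : ℕ
    u = length U
    v = length V

    bound′ : Bound m (e + (m + (v + 1))) n
    bound′ = FreshRows.Left.shrink-rows fresh V J-desc J-< (λ j∈ → J-Q j∈) bound

    -- The m products Xx_i, the `v` moved products x_jX and X² are all new, and S_m² has at least 2m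
    -- - 1 elements.
    v≤1+r : v ℕ.≤ 1 + r
    v≤1+r = linear 0 (ℕ.≤-trans (lower-bound bound′) n≤) (eq e p r v)
      where
      eq : ∀ e p r v → v + (3 * (1 + p) + (1 + r) + e) + 0 ≡
           1 + r + (e + ((1 + p) + (v + 1)) + (p + (1 + p)))
      eq = solve-∀

    -- After the m + v + 1 new products, at most 2m + r - v remain for S_m². This is at most 3m - 4,
    -- because m ≥ 2r + 4.
    two-gen : TwoGenerated m
    two-gen = two-generated p
      (abelian-small p bound′ (linear (1 + v + r) (ℕ.+-mono-≤ n≤ 2r+3≤p) (eq e p r v n)) (restrict dec))
      bound′ (linear (v + r) (ℕ.+-mono-≤ n≤ 2r+3≤p) (eq′ e p r v n)) (restrict dec)
      where
      eq : ∀ e p r v n → n + (3 * (1 + p) + (1 + r) + e + p) + (1 + v + r) ≡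
           3 * p + (e + ((1 + p) + (v + 1))) + (n + (2 * r + 3))
      eq = solve-∀
      eq′ : ∀ e p r v n → 1 + n + (3 * (1 + p) + (1 + r) + e + p) + (v + r) ≡
           3 * p + (e + ((1 + p) + (v + 1))) + (n + (2 * r + 3))
      eq′ = solve-∀

    module _ {Q : Pred} (sub : IsSubgroup Q) (on-U : ∀ {j} → j ∈ U → Q (x j)) where

      private
        record State (T₁ T₂ : List ℕ) : Set (c ⊔ ℓ) where
          field
            desc₁    : Descending T₁
            desc₂    : Descending T₂
            size₁₂   : length T₁ + length T₂ ≡ m
            u≤       : u ℕ.≤ length T₁
            in₁      : ∀ {j} → j ∈ T₁ → j ℕ.< m × Q (x j)
            in₂      : ∀ {j} → j ∈ T₂ → j ℕ.< m
            disj     : ∀ {j} → j ∈ T₁ → j ∈ T₂ → ⊥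
            cov      : ∀ j → j ℕ.< m → j ∈ T₁ ⊎ j ∈ T₂

        Relation : List ℕ → ℕ → Set ℓ
        Relation T₁ t = Σ ℕ λ i → i ∈ T₁ × Σ ℕ λ a → a ∈ T₁ × Σ ℕ λ b → b ∈ T₁ × x i ∙ x t ≈ x a ∙ x b

        NoRelation : List ℕ → ℕ → Set ℓ
        NoRelation T₁ t = ∀ i → i ∈ T₁ → ∀ a → a ∈ T₁ → ∀ b → b ∈ T₁ → ¬ x i ∙ x t ≈ x a ∙ x b

        -- S_m² would contain the disjoint sets T₁² and T₁T₂.
        too-large : ∀ {T₁ T₂ t} → State T₁ T₂ → t ∈ T₂ → (∀ t → t ∈ T₂ → NoRelation T₁ t) → ⊥
        too-large {[]} st _ _ = ℕ.<⇒≱ (linear 0 (ℕ.+-mono-≤ (ℕ.+-mono-≤ (State.u≤ st) v≤1+r)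
            (ℕ.+-mono-≤ 2r+3≤p (ℕ.≤-reflexive (≡.sym size)))) (eq p r u v)) (z≤n {r + 2})
          where
          eq : ∀ p r u v → 1 + (r + 2) + (0 + (1 + r) + (p + (u + v))) + 0 ≡
                           0 + (u + v + (2 * r + 3 + (1 + p)))
          eq = solve-∀
        too-large {i ∷ I} {[]} st () _
        -- T₁² and T₁T₂ have at least 2|T₁| - 1 and m - 1 elements, and |T₁| ≥ u = m - v. Comparison
        -- with |S_m²| ≤ 2m + r - v gives m ≤ v + r + 2 ≤ 2r + 3, whereas m = p + 1 ≥ 2r + 4.
        too-large {i ∷ I} {t ∷ J} st _ unrelated = ℕ.<⇒≱ (linear 0
            (ℕ.+-mono-≤ (ℕ.+-mono-≤ (ℕ.+-mono-≤ many n≤) (ℕ.+-mono-≤ (ℕ.*-monoʳ-≤ 2 u≤) v≤1+r))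
              (ℕ.+-mono-≤ (ℕ.+-mono-≤ 2r+3≤p (ℕ.≤-reflexive (≡.sym S₁.size)))
                (ℕ.+-mono-≤ (ℕ.≤-reflexive (≡.trans (≡.sym size₁₂) (≡.sym S₂.size)))
                  (ℕ.≤-reflexive (≡.cong (2 ℕ.*_) (≡.sym size))))))
            (eq p r e n u v (length (i ∷ I)) (length S₁.L) (length S₂.L))) (z≤n {0})
          where
          open State st
          module S₁ = Sumset (sumset i I i I desc₁ desc₁)
          module S₂ = Sumset (sumset i I t J desc₁ desc₂)
          old : ∀ {T} → (∀ {j} → j ∈ T → j ℕ.< m) →
                ∀ {w} → Product (_∈ i ∷ I) (_∈ T) w → Old m w
          old on (a , b , a∈ , b∈ , f) = a , b , proj₁ (in₁ a∈) , on b∈ , f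
          separate : ∀ {g h} → Product (_∈ i ∷ I) (_∈ i ∷ I) g → Product (_∈ i ∷ I) (_∈ t ∷ J) h → g ≈ h → ⊥
          separate (a , b , a∈ , b∈ , f) (a′ , b′ , a′∈ , b′∈ , f′) g≈h =
            unrelated b′ b′∈ a′ a′∈ a a∈ b b∈ (trans (sym f′) (trans (sym g≈h) f))
          many : e + (m + (v + 1)) + (length S₁.L + length S₂.L) ℕ.≤ n
          many = ≡.subst (λ l → e + (m + (v + 1)) + l ℕ.≤ n) (List.length-++ S₁.L)
            (bound′ (S₁.L ++ S₂.L) (distinct-++ S₁.distinct S₂.distinct S₁.products S₂.products separate)
              (All.++⁺ (All.map (old (λ j∈ → proj₁ (in₁ j∈))) S₁.products) (All.map (old in₂) S₂.products)))
          eq : ∀ p r e n u v t₁ l₁ l₂ →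
            1 + 0 + (n + (3 * (1 + p) + (1 + r) + e) + (2 * t₁ + (1 + r)) ℕ.+
              (p + (1 + l₁) + (1 + l₂ + 2 * (u + v)))) + 0 ≡
            0 + (e + ((1 + p) + (v + 1)) + (l₁ + l₂) + n + (2 * u + v) ℕ.+
              (2 * r + 3 + (t₁ + t₁) + ((1 + p) + 2 * (1 + p))))
          eq = solve-∀

        relation? : ∀ {T₁ T₂} → State T₁ T₂ → ∀ t → t ∈ T₂ → Relation T₁ t ⊎ NoRelation T₁ t
        relation? {T₁} {T₂} st t t∈ =
          searchList T₁ λ i i∈ → searchList T₁ λ a a∈ → searchList T₁ λ b b∈ → decide i∈ a∈ b∈
          where
          open State st
          < : ∀ {j} → j ∈ T₁ → j ℕ.< 2 + p
          < j∈ = ℕ.m≤n⇒m≤1+n (proj₁ (in₁ j∈))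
          decide : ∀ {i a b} → i ∈ T₁ → a ∈ T₁ → b ∈ T₁ →
            x i ∙ x t ≈ x a ∙ x b ⊎ ¬ x i ∙ x t ≈ x a ∙ x b
          decide i∈ a∈ b∈ with dec (< i∈) (ℕ.m≤n⇒m≤1+n (in₂ t∈)) (< a∈) (< b∈)
          ... | yes f = inj₁ f
          ... | no ¬f = inj₂ ¬f

        -- While T₂ is nonempty, `too-large` forces a relation x_i x_t = x_a x_b with i, a, b in T₁
        -- and t in T₂. It puts x_t into `Q`, and t changes sides.
        closure : ∀ k {T₁ T₂} → length T₂ ≡ k → State T₁ T₂ → ∀ j → j ℕ.< m → Q (x j)
        closure zero {T₁} {[]} _ st j j<m with State.cov st j j<m
        ... | inj₁ j∈ = proj₂ (State.in₁ st j∈)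
        closure (suc k) {T₁} {t₀ ∷ T₂} size-T₂ st with searchList (t₀ ∷ T₂) (relation? st)
        ... | inj₂ unrelated = ⊥-elim (too-large st (here ≡.refl) unrelated)
        ... | inj₁ (t , t∈ , i , i∈ , a , a∈ , b , b∈ , f) = closure k
            (ℕ.suc-injective (≡.trans (≡.sym rem.size) size-T₂)) record
              { desc₁  = ins.desc
              ; desc₂  = rem.desc
              ; size₁₂ = ≡.trans (≡.cong (ℕ._+ length rem.T⁻) ins.size)
                  (≡.trans (≡.sym (ℕ.+-suc (length T₁) (length rem.T⁻)))
                    (≡.trans (≡.cong (length T₁ ℕ.+_) (≡.sym rem.size)) size₁₂))
              ; u≤     = ℕ.≤-trans u≤ (ℕ.≤-trans (ℕ.n≤1+n _) (ℕ.≤-reflexive (≡.sym ins.size)))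
              ; in₁    = λ j∈ → [ (λ { ≡.refl → in₂ t∈ , Qt }) , in₁ ]′ (ins.to j∈)
              ; in₂    = λ j∈ → in₂ (rem.to j∈)
              ; disj   = λ j∈ j∈′ → [ (λ { ≡.refl → rem.t∉ j∈′ }) , (λ j∈T₁ → disj j∈T₁ (rem.to j∈′)) ]′ (ins.to j∈)
              ; cov    = λ j j<m → [ (λ j∈ → inj₁ (ins.from j∈))
                                   , (λ j∈ → map₁ (λ { ≡.refl → ins.from-t }) (rem.from j∈)) ]′ (cov j j<m)
              }
          where
          open State st
          module ins = Insertion (insertion t T₁ desc₁ (λ t∈T₁ → disj t∈T₁ t∈))
          module rem = Removal (removal desc₂ t∈)
          Qt : Q (x t)
          Qt = cancelˡ-∈ sub (proj₂ (in₁ i∈)) (≈∈ sub (sym f) (∙∈ sub (proj₂ (in₁ a∈)) (proj₂ (in₁ b∈))))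

      generates : ∀ j → j ℕ.< m → Q (x j)
      generates = closure v ≡.refl record
        { desc₁ = I-desc ; desc₂ = J-desc ; size₁₂ = size ; u≤ = ℕ.≤-refl
        ; in₁ = λ j∈ → I-< j∈ , on-U j∈ ; in₂ = J-< ; disj = disjoint ; cov = cover }

    str : TwoGenerated m → Structure (2 + p)
    str two-gen = record
      { split     = record { commute = commute ; conj-a = proj₁ images ; conj-b = proj₂ images }
      ; generated = extend {Q = λ j → ⟨ a ,, b ,, X ⟩ (x j)}
          (λ j j<m → ⟨,⟩-least ⟨⟩-isSubgroup gen₁ gen₂ (spans j j<m)) gen₃
      }
      where
      open TwoGenerated two-gen
      sub : IsSubgroup (λ g → ⟨ a ,, b ⟩ (conj X g))
      sub = conj-isSubgroup X ⟨⟩-isSubgroup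
      on-U : ∀ {j} → j ∈ U → ⟨ a ,, b ⟩ (conj X (x j))
      on-U {j} j∈ with I-P j∈
      ... | i , i<m , f = resp (begin-equality
        x i                   ≈⟨ solve 2 (λ g h → h ⊜ g ⁻ ⊙ (g ⊙ h)) refl X (x i) ⟩
        X ⁻¹ ∙ (X ∙ x i)      ≈⟨ ∙-congˡ f ⟨
        X ⁻¹ ∙ (x j ∙ X)      ≈⟨ assoc _ _ _ ⟨
        conj X (x j)          ∎) (spans i i<m)
      images : ⟨ a ,, b ⟩ (conj X a) × ⟨ a ,, b ⟩ (conj X b)
      -- The elements that X conjugates into ⟨a, b⟩ form a subgroup. It contains the kept elements,
      -- hence S_m, hence a and b.
      images = least sub (generates sub on-U)

  Good : ℕ → Set (c ⊔ ℓ)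
  Good k = AllCommute k ⊎ Structure k

  good-suc : ∀ {p r e n} → 2 * r + 3 ℕ.≤ p → Bound (2 + p) e n →
    n ℕ.≤ 3 * (1 + p) + (1 + r) + e → Decidable (2 + p) → Good (1 + p) → Good (2 + p)
  good-suc {p} 2r+3≤p bound n≤ dec good with reached? (suc p) dec
  ... | inj₂ fresh = inj₂ (str two-gen)
    where open Unreached 2r+3≤p bound n≤ dec fresh
  ... | inj₁ reached with good
  ...   | inj₁ com = inj₁ (AllCommute-Reached com reached)
  ...   | inj₂ str = inj₂ record
          { split     = split
          ; generated = extend {Q = λ j → ⟨ a ,, b ,, t ⟩ (x j)} generated
                          (Reached-∈ ⟨⟩-isSubgroup reached generated)
          }
    where open Structure str

  -- |S²| ≤ 3|S| − 3 + r.
  good : ∀ r k {e n} → Bound k e n → n + 3 ℕ.≤ 3 * k + r + e → r ≡ 0 ⊎ 2 * r + 4 ℕ.≤ k →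
         Decidable k → Good k
  good zero    zero    bound n≤ _ dec = inj₁ λ _ _ ()
  good zero    (suc m) {e} {n} bound n≤ _ dec = inj₁ (abelian-small m bound (linear 0 n≤ (eq e m n)) dec)
    where
    eq : ∀ e m n → n + (3 * (1 + m) + 0 + e) + 0 ≡ 3 * m + e + (n + 3)
    eq = solve-∀
  good (suc r) k bound n≤ (inj₁ ()) dec
  good (suc r) k bound n≤ (inj₂ k≥) dec
    with ℕ.m≤n⇒∃[o]m+o≡n (ℕ.≤-trans (ℕ.m≤n+m 4 (2 * suc r)) k≥)
  good (suc r) .(4 + q) {e} {n} bound n≤ (inj₂ k≥) dec | q , ≡.refl = top (peel (2 + q) bound dec)
    where
    2r+2≤q : 2 * r + 2 ℕ.≤ q
    2r+2≤q = linear 0 k≥ (eq r q)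
      where
      eq : ∀ r q → 2 * r + 2 + (4 + q) + 0 ≡ q + (2 * (1 + r) + 4)
      eq = solve-∀

    good₃⇒good₄ : Good (3 + q) → Good (4 + q)
    good₃⇒good₄ = good-suc (linear 1 2r+2≤q (eq r q)) bound (linear 0 n≤ (eq′ q r e n)) dec
      where
      eq : ∀ r q → 2 * r + 3 + q + 1 ≡ 2 + q + (2 * r + 2)
      eq = solve-∀
      eq′ : ∀ q r e n → n + (3 * (4 + q) + (1 + r) + e) + 0 ≡
                        3 * (3 + q) + (1 + r) + e + (n + 3)
      eq′ = solve-∀

    good₃ : Bound (3 + q) (e + 4) n → Good (3 + q)
    good₃ bound′ = good r (3 + q) bound′ (linear 0 n≤ (eq q r e n))
        (inj₂ (linear 1 2r+2≤q (eq′ r q))) (restrict dec)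
      where
      eq : ∀ q r e n → n + 3 + (3 * (4 + q) + (1 + r) + e) + 0 ≡
                       3 * (3 + q) + r + (e + 4) + (n + 3)
      eq = solve-∀
      eq′ : ∀ r q → 2 * r + 4 + q + 1 ≡ 3 + q + (2 * r + 2)
      eq′ = solve-∀

    good₂⇒good₃ : Bound (3 + q) (e + 3) n → Good (2 + q) → Good (3 + q)
    good₂⇒good₃ bound′ = good-suc (linear 0 2r+2≤q (eq r q)) bound′ (linear 0 n≤ (eq′ q r e n)) (restrict dec)
      where
      eq : ∀ r q → 2 * r + 3 + q + 0 ≡ 1 + q + (2 * r + 2)
      eq = solve-∀
      eq′ : ∀ q r e n → n + (3 * (4 + q) + (1 + r) + e) + 0 ≡
                        3 * (2 + q) + (1 + r) + (e + 3) + (n + 3)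
      eq′ = solve-∀

    -- Two elements and seven products are gone, and 7 = 2 · 3 + 1 lowers the excess by one. The
    -- size condition is passed on without slack.
    good₂ : Bound (2 + q) (e + 3 + 4) n → Good (2 + q)
    good₂ bound″ = good r (2 + q) bound″ (linear 0 n≤ (eq q r e n))
        (inj₂ (linear 0 2r+2≤q (eq′ r q))) (restrict (restrict dec))
      where
      eq : ∀ q r e n → n + 3 + (3 * (4 + q) + (1 + r) + e) + 0 ≡
                       3 * (2 + q) + r + (e + 3 + 4) + (n + 3)
      eq = solve-∀
      eq′ : ∀ r q → 2 * r + 4 + q + 0 ≡ 2 + q + (2 * r + 2)
      eq′ = solve-∀

    second : PeelA (2 + q) ⊎ PeelB (2 + q) → Bound (3 + q) (e + 3) n →
             Peel (1 + q) (e + 3) n → Good (4 + q)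
    second _     _      (none p₀)     = good₃⇒good₄ (inj₁ (Peel₀-commute p₀))
    second _     bound′ (four bound″) = good₃⇒good₄ (good₂⇒good₃ bound′ (good₂ bound″))
    second peel₁ _      (typeA A _)   = twoPeels q dec peel₁ (inj₁ A)
    second peel₁ _      (typeB B _)   = twoPeels q dec peel₁ (inj₂ B)

    top : Peel (2 + q) e n → Good (4 + q)
    top (none p₀)        = inj₁ (Peel₀-commute p₀)
    top (four bound′)    = good₃⇒good₄ (good₃ bound′)
    top (typeA A bound′) = second (inj₁ A) bound′ (peel (1 + q) bound′ (restrict dec))
    top (typeB B bound′) = second (inj₂ B) bound′ (peel (1 + q) bound′ (restrict dec))

-- Finite subsets as sequences

open import Data.Nat using (_≤_; _∸_; _^_)

module FiniteSets {c ℓ ℓ₂} (G : OrderedGroup c ℓ ℓ₂) where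

  open OrderedGroup G using (group) renaming (_≤_ to infix 4 _≼_)
  open Group group
  open OrderTheory G renaming (_<_ to infix 4 _≺_)
  open GroupNotions group
  open Subgroups group
  open Nilpotency group using (ε-sub; class≤2)
  open IsSubgroup

  Mem-resp : ∀ {L g h} → g ≈ h → Mem L g → Mem L h
  Mem-resp e = Any.map (trans (sym e))

  record Sorted (S : List Carrier) : Set (c ⊔ ℓ ⊔ ℓ₂) where
    field
      L         : List Carrier
      ascending : AllPairs _≺_ L
      size      : length L ≡ length S
      to        : ∀ {g} → Mem L g → Mem S g
      from      : ∀ {g} → Mem S g → Mem L g

  -- The order offers only a choice between ≼ and ≽; that `g` is not in the list makes the chosen
  -- inequality strict.
  insert : ∀ g L → AllPairs _≺_ L → (Mem L g → ⊥) → Sorted (g ∷ L)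
  insert g [] _ _ = record { L = g ∷ [] ; ascending = [] ∷ [] ; size = ≡.refl ; to = λ z → z ; from = λ z → z }
  insert g (h ∷ L) (h≺ ∷ asc) g∉ with total g h
  ... | inj₁ g≼h = record
    { L = g ∷ h ∷ L ; ascending = (g≺h ∷ All.map (<-trans g≺h) h≺) ∷ h≺ ∷ asc ; size = ≡.refl
    ; to = λ z → z ; from = λ z → z }
    where
    g≺h : g ≺ h
    g≺h = g≼h , λ e → g∉ (here e)
  ... | inj₂ h≼g = record
    { L = h ∷ L′ ; ascending = below ∷ ascending ; size = ≡.cong suc size
    ; to = λ { (here e) → there (here e) ; (there m) → swap (to m) }
    ; from = λ { (here e) → there (from (here e)) ; (there (here e)) → here e ; (there (there m)) → there (from (there m)) } }
    where
    open Sorted (insert g L asc (λ m → g∉ (there m))) renaming (L to L′)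
    swap : ∀ {k} → Mem (g ∷ L) k → Mem (g ∷ h ∷ L) k
    swap (here e)  = here e
    swap (there m) = there (there m)
    h≺g : h ≺ g
    h≺g = h≼g , λ e → g∉ (here (sym e))
    below : All (h ≺_) L′
    below = All.tabulateₛ setoid λ m → smaller (to m)
      where
      smaller : ∀ {k} → Mem (g ∷ L) k → h ≺ k
      smaller (here e)  = <-≤-trans h≺g (≤-reflexive (sym e))
      smaller (there m) = go h≺ m
        where
        go : ∀ {M k} → All (h ≺_) M → Mem M k → h ≺ k
        go (p ∷ _)  (here e)  = <-≤-trans p (≤-reflexive (sym e))
        go (_ ∷ ps) (there m) = go ps m

  sort : ∀ S → Distinct S → Sorted S
  sort [] _ = record { L = [] ; ascending = [] ; size = ≡.refl ; to = λ z → z ; from = λ z → z }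
  sort (g ∷ S) (g≉ ∷ dS) = record
    { L = I.L ; ascending = I.ascending ; size = ≡.trans I.size (≡.cong suc R.size)
    ; to = λ m → out (I.to m) ; from = λ { (here e) → I.from (here e) ; (there m) → I.from (there (R.from m)) } }
    where
    module R = Sorted (sort S dS)
    g∉ : ∀ {M} → All (λ h → ¬ g ≈ h) M → Mem M g → ⊥
    g∉ (n ∷ _)  (here e)  = n e
    g∉ (_ ∷ ns) (there m) = g∉ ns m
    module I = Sorted (insert g R.L R.ascending (λ m → g∉ g≉ (R.to m)))
    out : ∀ {k} → Mem (g ∷ R.L) k → Mem (g ∷ S) k
    out (here e)  = here e
    out (there m) = there (R.to m)

  -- Continuing past the list with ratio p > ε makes the sequence increasing on all of ℕ.
  sequence : Carrier → Carrier → List Carrier → ℕ → Carrier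
  sequence p g []      zero    = g
  sequence p g []      (suc n) = sequence p g [] n ∙ p
  sequence p g (h ∷ L) zero    = g
  sequence p g (h ∷ L) (suc n) = sequence p h L n

  sequence-step : ∀ {p g L} → ε ≺ p → AllPairs _≺_ (g ∷ L) →
                  ∀ n → sequence p g L n ≺ sequence p g L (suc n)
  sequence-step {p} {g} {[]} ε≺p asc n = begin-strict
    s       ≈⟨ identityʳ s ⟨
    s ∙ ε   <⟨ ∙-monoʳ-< s ε≺p ⟩
    s ∙ p   ∎
    where s = sequence p g [] n
  sequence-step {L = h ∷ []}    ε≺p ((g≺h ∷ _) ∷ asc) zero    = g≺h
  sequence-step {L = h ∷ _ ∷ _} ε≺p ((g≺h ∷ _) ∷ asc) zero    = g≺h
  sequence-step {L = h ∷ L}     ε≺p (_ ∷ asc)         (suc n) = sequence-step ε≺p asc n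

  sequence-Mem : ∀ p g L j → j ℕ.< length (g ∷ L) → Mem (g ∷ L) (sequence p g L j)
  sequence-Mem p g []      zero    _        = here refl
  sequence-Mem p g []      (suc j) (s≤s ())
  sequence-Mem p g (h ∷ L) zero    _        = here refl
  sequence-Mem p g (h ∷ L) (suc j) (s≤s j<) = there (sequence-Mem p h L j j<)

  Mem-sequence : ∀ p g L {k} → Mem (g ∷ L) k → Σ ℕ λ j → j ℕ.< length (g ∷ L) × k ≈ sequence p g L j
  Mem-sequence p g []      (here e)  = 0 , s≤s z≤n , e
  Mem-sequence p g (h ∷ L) (here e)  = 0 , s≤s z≤n , e
  Mem-sequence p g (h ∷ L) (there m) with Mem-sequence p h L m
  ... | j , j< , e = suc j , s≤s j< , e

  -- In a list without repetitions two members are equal exactly if their positions agree, and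
  -- positions can be compared. The list in question will be the given enumeration of S².
  equal? : ∀ {T g h} → Distinct T → Mem T g → Mem T h → Dec (g ≈ h)
  equal? (_ ∷ _)  (here e)  (here f)  = yes (trans e (sym f))
  equal? (_ ∷ d)  (there m) (there n) = equal? d m n
  equal? {_} {g} {h} (t≉ ∷ _) (here e) (there n) = no λ f → go t≉ n f
    where
    go : ∀ {M} → All (λ k → ¬ _ ≈ k) M → Mem M h → g ≈ h → ⊥
    go (q ∷ _)  (here k)  f = q (trans (sym e) (trans f k))
    go (_ ∷ qs) (there n) f = go qs n f
  equal? {_} {g} {h} (t≉ ∷ _) (there m) (here e) = no λ f → go t≉ m f
    where
    go : ∀ {M} → All (λ k → ¬ _ ≈ k) M → Mem M g → g ≈ h → ⊥
    go (q ∷ _)  (here k)  f = q (trans (sym e) (trans (sym f) k))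
    go (_ ∷ qs) (there n) f = go qs n f

  ─-size : ∀ {T g} (m : Mem T g) → length T ≡ suc (length (T ─ m))
  ─-size (here _)              = ≡.refl
  ─-size {_ ∷ _ ∷ _} (there m) = ≡.cong suc (─-size m)

  ─-Mem : ∀ {T g h} (m : Mem T g) → ¬ g ≈ h → Mem T h → Mem (T ─ m) h
  ─-Mem (here e)  g≉h (here f)  = ⊥-elim (g≉h (trans e (sym f)))
  ─-Mem (here _)  g≉h (there n) = n
  ─-Mem (there m) g≉h (here f)  = here f
  ─-Mem (there m) g≉h (there n) = there (─-Mem m g≉h n)

  pigeonhole : ∀ {T} L → Distinct L → All (Mem T) L → length L ≤ length T
  pigeonhole []      _        _        = z≤n
  pigeonhole {T} (g ∷ L) (g≉ ∷ d) (m ∷ ms) = ≡.subst (suc (length L) ≤_) (≡.sym (─-size m))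
    (s≤s (pigeonhole L d (All.zipWith (λ { (g≉h , n) → ─-Mem m g≉h n }) (g≉ , ms))))

  abelian⇒metabelian : ∀ {H : Pred} → Abelian H → Metabelian H × NilpotentOfClassAtMost 2 H
  abelian⇒metabelian {H} ab =
      (λ p q → trans (∙-cong (trivial p) (trivial q)) (sym (∙-cong (trivial q) (trivial p))))
    , ⟨⟩-least ε-sub λ { (_ , _ , p , _ , e) → trans e (commutator-⟷ (begin-equality
        _ ∙ _   ≈⟨ ∙-congʳ (trivial p) ⟩
        ε ∙ _   ≈⟨ trans (identityˡ _) (sym (identityʳ _)) ⟩
        _ ∙ ε   ≈⟨ ∙-congˡ (trivial p) ⟨
        _ ∙ _   ∎)) }
    where
    trivial : ∀ {g} → γ H 1 g → g ≈ ε
    trivial = derived⊆ ε-sub λ g∈ h∈ → commutator-⟷ (ab g∈ h∈)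

  module _ (S : List Carrier) {p g h L} (ε≺p : ε ≺ p) (ascending : AllPairs _≺_ (g ∷ h ∷ L))
    (to : ∀ {k} → Mem (g ∷ h ∷ L) k → Mem S k) (from : ∀ {k} → Mem S k → Mem (g ∷ h ∷ L) k) where

    private
      x : ℕ → Carrier
      x = sequence p g (h ∷ L)
      K = length (g ∷ h ∷ L)
      x-step : ∀ i → x i ≺ x (suc i)
      x-step = sequence-step ε≺p ascending
      module I = Induction G x x-step
      module Q = TwoPeels G x x-step
      module C = Counting G x x-step

      x∈S : ∀ j → j ℕ.< K → Mem S (x j)
      x∈S j j<K = to (sequence-Mem p g (h ∷ L) j j<K)

      S-least : ∀ {Q : Pred} → IsSubgroup Q → (∀ j → j ℕ.< K → Q (x j)) → ∀ {k} → ⟨ Mem S ⟩ k → Q k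
      S-least sub on = ⟨⟩-least sub λ m → let j , j<K , e = Mem-sequence p g (h ∷ L) (from m)
                                          in ≈∈ sub (sym e) (on j j<K)

    conclusion : I.Good K → Metabelian ⟨ Mem S ⟩ × (Nilpotent Whole → NilpotentOfClassAtMost 2 ⟨ Mem S ⟩)
    conclusion (inj₁ com) = proj₁ (abelian⇒metabelian ab) , λ _ → proj₂ (abelian⇒metabelian ab)
      where
      ab : Abelian ⟨ Mem S ⟩
      ab = ⟨⟩-abelian λ m m′ →
        let a , a< , e = Mem-sequence p g (h ∷ L) (from m)
            b , b< , f = Mem-sequence p g (h ∷ L) (from m′)
        in trans (∙-cong e f) (trans (com a b a< b<) (sym (∙-cong f e)))
    conclusion (inj₂ str) =
        Split.metabelian split (S-least ⟨⟩-isSubgroup generated)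
      , λ nilpotent → class≤2 torsion-free split nilpotent (S-least ⟨⟩-isSubgroup generated)
      where open Q.Structure str

    module _ {T : List Carrier} (T-distinct : Distinct T)
      (S²⊆T : ∀ {k} → Square S k → Mem T k) where

      private
        product∈T : ∀ {a b} → a ℕ.< K → b ℕ.< K → Mem T (x a ∙ x b)
        product∈T a<K b<K = S²⊆T (_ , _ , x∈S _ a<K , x∈S _ b<K , refl)

      decidable : Q.Decidable K
      decidable a b i j = equal? T-distinct (product∈T a b) (product∈T i j)

      bound : C.Bound K 0 (length T)
      bound M dM aM = pigeonhole M dM (All.map (λ { (a , b , a< , b< , e) → Mem-resp (sym e) (product∈T a< b<) }) aM)

    small-doubling : ∀ {T} → Distinct T → (∀ {k} → Square S k → Mem T k) →
      ∀ r → length T + 3 ≤ 3 * K + r + 0 → 2 * r + 4 ≤ K →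
      Metabelian ⟨ Mem S ⟩ × (Nilpotent Whole → NilpotentOfClassAtMost 2 ⟨ Mem S ⟩)
    small-doubling dT S²⊆T r small large =
      conclusion (I.good r K (bound dT S²⊆T) small (inj₂ large) (decidable dT S²⊆T))

-- The numerical hypotheses

linear≤exponential : ∀ s → 1 ≤ s → 2 * suc s + 4 ≤ 2 ^ (s + 2)
-- Both sides are 8.
linear≤exponential (suc zero)    _ = ℕ.≤-refl
linear≤exponential (suc (suc s)) _ = ℕ.≤-trans (linear (2 * s + 6) (ℕ.≤-refl {0}) (eq s))
    (ℕ.*-monoʳ-≤ 2 (linear≤exponential (suc s) (s≤s z≤n)))
  where
  eq : ∀ s → 2 * (3 + s) + 4 + 0 + (2 * s + 6) ≡ 2 * (2 * (2 + s) + 4) + 0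
  eq = solve-∀

theorem2p10 : ∀ {c ℓ ℓ₂ : Level} (G : OrderedGroup c ℓ ℓ₂) (s : ℕ) → 1 ≤ s →
    let open OrderedGroupNotions G
    in (S : List Carrier) → Unique S →
    2 ^ (s + 2) ≤ length S →
    HasCard (Square S) (3 * length S ∸ 2 + s) →
    Metabelian ⟨ Mem S ⟩ × (Nilpotent Whole → NilpotentOfClassAtMost 2 ⟨ Mem S ⟩)
theorem2p10 G s 1≤s S S-distinct 2^s≤S (T , T-distinct , T≡S² , T-size) = conclude (sort S S-distinct)
  where
  open FiniteSets G
  open OrderedGroupNotions G
  open OrderTheory G using (∙-monoʳ-<; ≤-<-trans; ≤-reflexive)
  open Group group using (_∙_; _⁻¹; inverseˡ; sym)

  large : ∀ {k} → k ≡ length S → 2 * suc s + 4 ≤ k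
  large ≡.refl = ℕ.≤-trans (linear≤exponential s 1≤s) 2^s≤S

  four≤ : ∀ {k} → k ≡ length S → 4 ≤ k
  four≤ e = ℕ.≤-trans (ℕ.m≤n+m 4 (2 * suc s)) (large e)

  small : ∀ {k} → k ≡ length S → length T + 3 ≤ 3 * k + suc s + 0
  -- The excess is s + 1, as 3k - 2 + s = 3k - 3 + (s + 1); the subtraction is not truncated, since
  -- 2 ≤ 3k.
  small {k} e@≡.refl = linear 0 (ℕ.≤-reflexive (ℕ.m∸n+n≡m 2≤3k))
      (≡.trans (≡.cong (λ n → n + 3 + 3 * k + 0) T-size) (eq (3 * k ∸ 2) (3 * k) s))
    where
    2≤3k : 2 ≤ 3 * k
    2≤3k = ℕ.≤-trans (ℕ.≤-trans (s≤s (s≤s z≤n)) (four≤ e)) (ℕ.m≤n*m k 3)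
    eq : ∀ a b s → a + s + 3 + b + 0 ≡ b + (1 + s) + 0 + (a + 2)
    eq = solve-∀

  conclude : Sorted S → Metabelian ⟨ Mem S ⟩ × (Nilpotent Whole → NilpotentOfClassAtMost 2 ⟨ Mem S ⟩)
  conclude record { L = [] ; size = e } with four≤ e
  ... | ()
  conclude record { L = _ ∷ [] ; size = e } with four≤ e
  ... | s≤s ()
  conclude record { L = g ∷ h ∷ L ; ascending = asc@((g≺h ∷ _) ∷ _) ; size = e ; to = to ; from = from } =
    -- The ratio g⁻¹h of the two smallest elements exceeds ε and continues the sequence beyond S.
    small-doubling S (≤-<-trans (≤-reflexive (sym (inverseˡ g))) (∙-monoʳ-< (g ⁻¹) g≺h)) asc to from
      T-distinct (λ {k} → proj₂ (T≡S² k)) (suc s) (small e) (large e)
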